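{- Let $G$ be a simple graph with vertex set $[\ell]=\{1,\dots,\ell\}$. Then $$\mathrm{Hilb}(\Omega^1(\mathcal{A}_G),t)=\sum_{\varnothing\ne F\in\Delta(G)}\frac{t^{1-\#F}}{(1-t)^{\ell-\#F+1}}.$$
   Context: Let $\mathbb{K}$ be a field, $V=\mathbb{K}^\ell$ and $S=\mathbb{K}[x_1,\dots,x_\ell]$ with $\deg x_i=1$, where $x_1,\dots,x_\ell$ are the coordinate functions. For a simple graph $G$ with vertex set $[\ell]$ and edge set $E(G)$, the graphic arrangement is $\mathcal{A}_G=\{\{x_u=x_v\}\mid\{u,v\}\in E(G)\}$. $\Delta(G)$ is the clique complex of $G$: the set of all cliques of $G$, i.e. subsets $F\subset[\ell]$ such that $\{u,v\}\in E(G)$ for all distinct $u,v\in F$ (including $\varnothing$ and all singletons). For a finite set $\mathcal{A}$ of linear hyperplanes in $V$, $\alpha_H\in V^*$ denotes a defining linear form of $H\in\mathcal{A}$ and $Q(\mathcal{A})=\prod_{H\in\mathcal{A}}\alpha_H$. Let $\Omega_V^1=\bigoplus_i S\,dx_i$, $\Omega_V^2=\bigwedge^2\Omega_V^1$, and for $\alpha=\sum c_ix_i$ let $d\alpha=\sum c_i\,dx_i$. Define $$\Omega^1(\mathcal{A})=\{\omega\in \tfrac{1}{Q(\mathcal{A})}\Omega^1_V \mid Q(\mathcal{A})\,\omega\wedge d\alpha_H\in\alpha_H\Omega_V^2\ \text{for all } H\in\mathcal{A}\},$$ graded by setting $\deg(dx_i)=0$ (so $f\,dx_i$ with $f$ a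 homogeneous rational function has degree $\deg f$, possibly negative). For a graded module $M=\bigoplus_{i\in\mathbb{Z}}M_i$, $\mathrm{Hilb}(M,t)=\sum_{i\in\mathbb{Z}}(\dim_{\mathbb{K}}M_i)t^i$. -}

module Defs where

open import Algebra.Apartness.Bundles using (HeytingField; HeytingCommutativeRing)
open import Algebra.Bundles using (CommutativeRing)
open import Algebra.Module.Bundles using (LeftModule)
import Algebra.Definitions.RawMonoid as RawMonoidSum
import Algebra.Properties.Ring as RingProperties
import Algebra.Properties.Semiring.Sum as SemiringSum
open import Data.Bool.Base using (if_then_else_)
open import Data.Fin.Base as Fin using (Fin; toℕ; zero; suc)
import Data.Fin.Properties as Finₚ
open import Data.Fin.Subset using (Subset; inside; outside; ∣_∣; _∈_)
open import Data.Fin.Subset.Properties using (_∈?_; nonempty?)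
open import Data.Integer.Base as ℤ using (ℤ; +_; -[1+_])
open import Data.List.Base as List using (List; []; _∷_; _++_)
open import Data.List.Relation.Unary.All as All using (All; []; _∷_)
open import Data.Nat.Base as ℕ using (ℕ; zero; suc; _∸_)
import Data.Nat.ListAction as ℕList
import Data.Nat.Properties as ℕₚ
open import Data.Product.Base using (Σ; Σ-syntax; ∃; _×_; _,_)
open import Data.Sum.Base using (_⊎_; inj₁; inj₂)
open import Data.Vec.Base as Vec using (Vec; []; _∷_)
import Data.Vec.Functional as Vector
open import Data.Vec.Functional using (Vector)
import Data.Vec.Properties as Vecₚ
open import Function.Base using (_∘_)
open import Level using (0ℓ; _⊔_)
open import Relation.Binary.Core using (Rel)
open import Relation.Binary.Definitions using (Decidable; Irreflexive; Symmetric)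
open import Relation.Binary.PropositionalEquality as ≡ using (_≡_; _≢_)
import Relation.Binary.Reasoning.Setoid as SetoidReasoning
open import Relation.Nullary.Decidable using (Dec; yes; no; does; _×-dec_; _→-dec_; ¬?)
open import Relation.Nullary.Negation using (contradiction)

------------------------------------------------------------------------
-- Graphs and cliques

record SimpleGraph (ℓ : ℕ) : Set₁ where
  infix 4 _~_ _~?_
  field
    _~_      : Rel (Fin ℓ) 0ℓ
    ~-sym    : Symmetric _~_
    ~-irrefl : Irreflexive _≡_ _~_
    _~?_     : Decidable _~_

module _ {ℓ : ℕ} (G : SimpleGraph ℓ) where
  open SimpleGraph G

  -- Each edge {u , v} is listed exactly once, as (u , v) with u < v.
  edges : List (Fin ℓ × Fin ℓ)
  edges = List.filter (λ (u , v) → (u Finₚ.<? v) ×-dec (u ~? v))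
            (List.cartesianProduct (List.allFin ℓ) (List.allFin ℓ))

  IsClique : Subset ℓ → Set
  IsClique F = ∀ u v → u ∈ F → v ∈ F → u ≢ v → u ~ v

  isClique? : ∀ F → Dec (IsClique F)
  isClique? F = Finₚ.all? λ u → Finₚ.all? λ v →
    (u ∈? F) →-dec ((v ∈? F) →-dec (¬? (u Finₚ.≟ v) →-dec (u ~? v)))

allSubsets : ∀ n → List (Subset n)
allSubsets zero    = [] ∷ []
allSubsets (suc n) = List.map (outside ∷_) (allSubsets n) ++ List.map (inside ∷_) (allSubsets n)

nonemptyCliques : ∀ {ℓ} → SimpleGraph ℓ → List (Subset ℓ)
nonemptyCliques {ℓ} G =
  List.filter (λ F → nonempty? F ×-dec isClique? G F) (allSubsets ℓ)

------------------------------------------------------------------------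
-- Formal power series and Laurent series in t, by their coefficients

PowerSeries LaurentSeries : Set
PowerSeries   = ℕ → ℕ
LaurentSeries = ℤ → ℕ

infixl 7 _⊛_
infixr 7 t^_·_
infix  8 [1-t]⁻_

_⊛_ : PowerSeries → PowerSeries → PowerSeries
(f ⊛ g) n = ℕList.sum (List.map (λ i → f i ℕ.* g (n ∸ i)) (List.upTo (suc n)))

-- The expansion of 1/(1-t)ᵏ: the k-th power of 1/(1-t) = 1 + t + t² + ⋯ .
[1-t]⁻_ : ℕ → PowerSeries
([1-t]⁻ zero)  zero    = 1
([1-t]⁻ zero)  (suc _) = 0
([1-t]⁻ suc k)         = (λ _ → 1) ⊛ [1-t]⁻ k

t^_·_ : ℤ → PowerSeries → LaurentSeries
(t^ a · f) d with d ℤ.- a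
... | + n      = f n
... | -[1+ _ ] = 0

∑ₗ : ∀ {a} {A : Set a} → List A → (A → LaurentSeries) → LaurentSeries
∑ₗ xs f d = ℕList.sum (List.map (λ x → f x d) xs)

------------------------------------------------------------------------
-- Polynomials and differential forms
--
-- The ground field is a Heyting field, i.e. a field whose inequality _#_
-- ("the difference is invertible") is a tight apartness.  Classically
-- these are precisely the fields, with _#_ the negation of _≈_.

module Polynomials {c r s} (K : HeytingField c r s) where

  private
    module H = HeytingField K
    𝕂-ring = HeytingCommutativeRing.commutativeRing H.heytingCommutativeRing
  open CommutativeRing 𝕂-ring hiding (zero) renaming (Carrier to 𝕂)
  open SemiringSum semiring
    using (sum; sum⁺-syntax; ∑-distrib-+; sum-cong-≋; sum-replicate-zero; *-distribˡ-sum)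
  open RingProperties ring using (-0#≈0#; -1*x≈-x; -‿+-comm; -‿distribʳ-*)
  open SetoidReasoning setoid

  infixl 9 _▹_

  _▹_ : ∀ {n} → (Vec ℕ (suc n) → 𝕂) → ℕ → Vec ℕ n → 𝕂
  (f ▹ i) e = f (i ∷ e)

  -- conv f g e is the sum of f a * g b over all a + b = e.
  conv : ∀ {n} → (Vec ℕ n → 𝕂) → (Vec ℕ n → 𝕂) → Vec ℕ n → 𝕂
  conv f g []      = f [] * g []
  conv f g (k ∷ e) = ∑[ i ≤ k ] conv (f ▹ toℕ i) (g ▹ (k ∸ toℕ i)) e

  conv-+ˡ : ∀ {n} (f f′ g : Vec ℕ n → 𝕂) e →
            conv (λ a → f a + f′ a) g e ≈ conv f g e + conv f′ g e
  conv-+ˡ f f′ g []      = distribʳ _ _ _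
  conv-+ˡ f f′ g (k ∷ e) =
    trans (sum-cong-≋ {suc k} λ i → conv-+ˡ (f ▹ toℕ i) (f′ ▹ toℕ i) (g ▹ (k ∸ toℕ i)) e)
      (∑-distrib-+ {suc k} (λ i → conv (f ▹ toℕ i) (g ▹ (k ∸ toℕ i)) e) (λ i → conv (f′ ▹ toℕ i) (g ▹ (k ∸ toℕ i)) e))

  conv-+ʳ : ∀ {n} (f g g′ : Vec ℕ n → 𝕂) e →
            conv f (λ a → g a + g′ a) e ≈ conv f g e + conv f g′ e
  conv-+ʳ f g g′ []      = distribˡ _ _ _
  conv-+ʳ f g g′ (k ∷ e) =
    trans (sum-cong-≋ {suc k} λ i → conv-+ʳ (f ▹ toℕ i) (g ▹ (k ∸ toℕ i)) (g′ ▹ (k ∸ toℕ i)) e)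
      (∑-distrib-+ {suc k} (λ i → conv (f ▹ toℕ i) (g ▹ (k ∸ toℕ i)) e) (λ i → conv (f ▹ toℕ i) (g′ ▹ (k ∸ toℕ i)) e))

  conv-*ˡ : ∀ {n} x (f g : Vec ℕ n → 𝕂) e →
            conv (λ a → x * f a) g e ≈ x * conv f g e
  conv-*ˡ x f g []      = *-assoc _ _ _
  conv-*ˡ x f g (k ∷ e) =
    trans (sum-cong-≋ {suc k} λ i → conv-*ˡ x (f ▹ toℕ i) (g ▹ (k ∸ toℕ i)) e)
      (sym (*-distribˡ-sum {suc k} x λ i → conv (f ▹ toℕ i) (g ▹ (k ∸ toℕ i)) e))

  conv-*ʳ : ∀ {n} x (f g : Vec ℕ n → 𝕂) e →
            conv f (λ a → x * g a) e ≈ x * conv f g e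
  conv-*ʳ x f g [] = begin
    f [] * (x * g [])  ≈⟨ *-assoc _ _ _ ⟨
    f [] * x * g []    ≈⟨ *-congʳ (*-comm _ _) ⟩
    x * f [] * g []    ≈⟨ *-assoc _ _ _ ⟩
    x * (f [] * g [])  ∎
  conv-*ʳ x f g (k ∷ e) =
    trans (sum-cong-≋ {suc k} λ i → conv-*ʳ x (f ▹ toℕ i) (g ▹ (k ∸ toℕ i)) e)
      (sym (*-distribˡ-sum {suc k} x λ i → conv (f ▹ toℕ i) (g ▹ (k ∸ toℕ i)) e))

  conv-vanish : ∀ {n} (f g : Vec ℕ n → 𝕂) e →
                (∀ a b → Vec.sum a ℕ.+ Vec.sum b ≡ Vec.sum e → f a ≈ 0# ⊎ g b ≈ 0#) →
                conv f g e ≈ 0#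
  conv-vanish f g [] z with z [] [] ≡.refl
  ... | inj₁ f≈0 = trans (*-congʳ f≈0) (zeroˡ _)
  ... | inj₂ g≈0 = trans (*-congˡ g≈0) (zeroʳ _)
  conv-vanish f g (k ∷ e) z =
    trans (sum-cong-≋ {suc k} λ i → conv-vanish (f ▹ toℕ i) (g ▹ (k ∸ toℕ i)) e λ a b eq → z _ _ (split i a b eq))
          (sum-replicate-zero (suc k))
    where
    split : ∀ (i : Fin (suc k)) a b → Vec.sum a ℕ.+ Vec.sum b ≡ Vec.sum e →
            (toℕ i ℕ.+ Vec.sum a) ℕ.+ (k ∸ toℕ i ℕ.+ Vec.sum b) ≡ k ℕ.+ Vec.sum e
    split i a b eq = ≡.trans (interchange (toℕ i) (Vec.sum a) (k ∸ toℕ i) (Vec.sum b))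
      (≡.cong₂ ℕ._+_ (ℕₚ.m+[n∸m]≡n (Finₚ.toℕ≤pred[n] i)) eq)
      where
      open import Algebra.Properties.CommutativeSemigroup ℕₚ.+-commutativeSemigroup
        using (interchange)

  -- Polynomials in ℓ variables: finitely supported coefficient functions on
  -- exponent vectors, finiteness being witnessed by a bound on the total degree.
  record Poly (ℓ : ℕ) : Set (c ⊔ r) where
    field
      coeff  : Vec ℕ ℓ → 𝕂
      bound  : ℕ
      vanish : ∀ e → bound ℕ.< Vec.sum e → coeff e ≈ 0#
  open Poly public

  infix  4 _≈ₚ_
  infixl 6 _+ₚ_ _-ₚ_
  infixl 7 _*ₚ_
  infixr 7 _·ₚ_

  _≈ₚ_ : ∀ {ℓ} → Poly ℓ → Poly ℓ → Set r
  p ≈ₚ q = ∀ e → coeff p e ≈ coeff q e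

  0ₚ : ∀ {ℓ} → Poly ℓ
  0ₚ = record { coeff = λ _ → 0# ; bound = 0 ; vanish = λ _ _ → refl }

  _+ₚ_ _-ₚ_ _*ₚ_ : ∀ {ℓ} → Poly ℓ → Poly ℓ → Poly ℓ
  p +ₚ q = record
    { coeff  = λ e → coeff p e + coeff q e
    ; bound  = bound p ℕ.⊔ bound q
    ; vanish = λ e lt → trans
        (+-cong (vanish p e (ℕₚ.≤-<-trans (ℕₚ.m≤m⊔n _ _) lt))
                (vanish q e (ℕₚ.≤-<-trans (ℕₚ.m≤n⊔m (bound p) _) lt)))
        (+-identityˡ 0#)
    }
  p -ₚ q = record
    { coeff  = λ e → coeff p e - coeff q e
    ; bound  = bound p ℕ.⊔ bound q
    ; vanish = λ e lt → trans
        (+-cong (vanish p e (ℕₚ.≤-<-trans (ℕₚ.m≤m⊔n _ _) lt))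
                (-‿cong (vanish q e (ℕₚ.≤-<-trans (ℕₚ.m≤n⊔m (bound p) _) lt))))
        (-‿inverseʳ 0#)
    }
  p *ₚ q = record
    { coeff  = conv (coeff p) (coeff q)
    ; bound  = bound p ℕ.+ bound q
    ; vanish = λ e lt → conv-vanish _ _ e (split e lt)
    }
    where
    split : ∀ e → bound p ℕ.+ bound q ℕ.< Vec.sum e →
            ∀ a b → Vec.sum a ℕ.+ Vec.sum b ≡ Vec.sum e →
            coeff p a ≈ 0# ⊎ coeff q b ≈ 0#
    split e lt a b eq with bound p ℕₚ.<? Vec.sum a | bound q ℕₚ.<? Vec.sum b
    ... | yes lt₁ | _       = inj₁ (vanish p a lt₁)
    ... | no  _   | yes lt₂ = inj₂ (vanish q b lt₂)
    ... | no  ≮₁  | no  ≮₂  = contradiction lt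
      (ℕₚ.≤⇒≯ (ℕₚ.≤-trans (ℕₚ.≤-reflexive (≡.sym eq))
                          (ℕₚ.+-mono-≤ (ℕₚ.≮⇒≥ ≮₁) (ℕₚ.≮⇒≥ ≮₂))))

  _·ₚ_ : ∀ {ℓ} → 𝕂 → Poly ℓ → Poly ℓ
  x ·ₚ p = record
    { coeff  = λ e → x * coeff p e
    ; bound  = bound p
    ; vanish = λ e lt → trans (*-congˡ (vanish p e lt)) (zeroʳ x)
    }

  monomial : ∀ {ℓ} → Vec ℕ ℓ → Poly ℓ
  monomial m = record
    { coeff  = λ e → if does (Vecₚ.≡-dec ℕₚ._≟_ m e) then 1# else 0#
    ; bound  = Vec.sum m
    ; vanish = λ e lt → off e lt
    }
    where
    off : ∀ e → Vec.sum m ℕ.< Vec.sum e →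
          (if does (Vecₚ.≡-dec ℕₚ._≟_ m e) then 1# else 0#) ≈ 0#
    off e lt with Vecₚ.≡-dec ℕₚ._≟_ m e
    ... | no  _      = refl
    ... | yes ≡.refl = contradiction lt (ℕₚ.<-irrefl ≡.refl)

  1ₚ : ∀ {ℓ} → Poly ℓ
  1ₚ = monomial (Vec.replicate _ 0)

  const : ∀ {ℓ} → 𝕂 → Poly ℓ
  const x = x ·ₚ 1ₚ

  var : ∀ {ℓ} → Fin ℓ → Poly ℓ
  var i = monomial (Vec.replicate _ 0 Vec.[ i ]≔ 1)

  -- The zero polynomial is homogeneous of every degree.
  IsHomogeneous : ∀ {ℓ} → Poly ℓ → ℤ → Set r
  IsHomogeneous p d = ∀ e → + Vec.sum e ≢ d → coeff p e ≈ 0#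

  ----------------------------------------------------------------------
  -- Linear forms and arrangements

  -- The form c₁x₁ + ⋯ + c_ℓx_ℓ, by its coefficients.
  LinearForm : ℕ → Set c
  LinearForm ℓ = Vector 𝕂 ℓ

  linear : ∀ {ℓ} → LinearForm ℓ → Poly ℓ
  linear α = Vector.foldr _+ₚ_ 0ₚ λ i → α i ·ₚ var i

  coordinate : ∀ {ℓ} → Fin ℓ → LinearForm ℓ
  coordinate u i = if does (u Finₚ.≟ i) then 1# else 0#

  -- A central arrangement, given by one defining form α_H for each hyperplane H.
  Arrangement : ℕ → Set c
  Arrangement ℓ = List (LinearForm ℓ)

  -- Distinct edges give distinct hyperplanes, so there is no repetition.
  graphicArrangement : ∀ {ℓ} → SimpleGraph ℓ → Arrangement ℓ
  graphicArrangement G =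
    List.map (λ (u , v) i → coordinate u i - coordinate v i) (edges G)

  Q : ∀ {ℓ} → Arrangement ℓ → Poly ℓ
  Q = List.foldr (λ α p → linear α *ₚ p) 1ₚ

  deg-Q : ∀ {ℓ} → Arrangement ℓ → ℕ
  deg-Q = List.length

  Q-homogeneous : ∀ {ℓ} (𝒜 : Arrangement ℓ) → IsHomogeneous (Q 𝒜) (+ deg-Q 𝒜)
  Q-homogeneous = product
    where
    sum-zeros : ∀ n → Vec.sum (Vec.replicate n 0) ≡ 0
    sum-zeros zero    = ≡.refl
    sum-zeros (suc n) = sum-zeros n

    sum-unit : ∀ {n} (i : Fin n) → Vec.sum (Vec.replicate n 0 Vec.[ i ]≔ 1) ≡ 1
    sum-unit {suc n} zero    = ≡.cong suc (sum-zeros n)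
    sum-unit {suc n} (suc i) = sum-unit i

    off : ∀ {n} (m e : Vec ℕ n) → Vec.sum e ≢ Vec.sum m → coeff (monomial m) e ≈ 0#
    off m e ne with Vecₚ.≡-dec ℕₚ._≟_ m e
    ... | no  _      = refl
    ... | yes ≡.refl = contradiction ≡.refl ne

    combination : ∀ {ℓ k} (α : Vector 𝕂 k) (v : Vector (Fin ℓ) k) e → Vec.sum e ≢ 1 →
                  coeff (Vector.foldr _+ₚ_ 0ₚ λ i → α i ·ₚ var (v i)) e ≈ 0#
    combination {k = zero}  α v e ne = refl
    combination {k = suc k} α v e ne = trans
      (+-cong (trans (*-congˡ (off (Vec.replicate _ 0 Vec.[ v zero ]≔ 1) e
                λ eq → ne (≡.trans eq (sum-unit (v zero))))) (zeroʳ _))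
              (combination (α ∘ suc) (v ∘ suc) e ne))
      (+-identityˡ 0#)

    product : ∀ {ℓ} (𝒜 : Arrangement ℓ) → IsHomogeneous (Q 𝒜) (+ List.length 𝒜)
    product {ℓ} [] e ne =
      off (Vec.replicate ℓ 0) e λ eq → ne (≡.cong +_ (≡.trans eq (sum-zeros ℓ)))
    product (α ∷ 𝒜) e ne =
      conv-vanish (coeff (linear α)) (coeff (Q 𝒜)) e split
      where
      split : ∀ a b → Vec.sum a ℕ.+ Vec.sum b ≡ Vec.sum e →
              coeff (linear α) a ≈ 0# ⊎ coeff (Q 𝒜) b ≈ 0#
      split a b eq with Vec.sum a ℕₚ.≟ 1
      ... | no  ≢1 = inj₁ (combination α (λ i → i) a ≢1)
      ... | yes ≡1 = inj₂ (product 𝒜 b λ eq′ → ne (≡.trans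
              (≡.cong +_ (≡.trans (≡.sym eq) (≡.cong (ℕ._+ Vec.sum b) ≡1)))
              (≡.cong (ℤ._+_ (+ 1)) eq′)))

  ----------------------------------------------------------------------
  -- Differential forms with polynomial coefficients

  -- ∑ᵢ ηᵢ dxᵢ
  OneForm : ℕ → Set (c ⊔ r)
  OneForm ℓ = Vector (Poly ℓ) ℓ

  -- ∑_{i<j} θᵢⱼ dxᵢ ∧ dxⱼ
  TwoForm : ℕ → Set (c ⊔ r)
  TwoForm ℓ = (i j : Fin ℓ) → i Fin.< j → Poly ℓ

  infix  4 _≈₂_
  infixl 7 _∧_ _•_

  _≈₂_ : ∀ {ℓ} → TwoForm ℓ → TwoForm ℓ → Set r
  θ ≈₂ θ′ = ∀ i j i<j → θ i j i<j ≈ₚ θ′ i j i<j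

  _∧_ : ∀ {ℓ} → OneForm ℓ → OneForm ℓ → TwoForm ℓ
  (η ∧ ξ) i j _ = η i *ₚ ξ j -ₚ η j *ₚ ξ i

  _•_ : ∀ {ℓ} → Poly ℓ → TwoForm ℓ → TwoForm ℓ
  (p • θ) i j i<j = p *ₚ θ i j i<j

  d : ∀ {ℓ} → LinearForm ℓ → OneForm ℓ
  d α i = const (α i)

  ----------------------------------------------------------------------
  -- Logarithmic forms
  --
  -- The elements ω = η/Q(𝒜) of (1/Q(𝒜))Ω¹_V are represented by their
  -- numerators η = Q(𝒜)ω.  As S is a domain and Q(𝒜) ≠ 0, η/Q(𝒜) and
  -- η′/Q(𝒜) are equal iff η and η′ are.

  IsLogarithmic : ∀ {ℓ} → Arrangement ℓ → OneForm ℓ → Set (c ⊔ r)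
  IsLogarithmic {ℓ} 𝒜 η =
    All (λ α → Σ[ θ ∈ TwoForm ℓ ] η ∧ d α ≈₂ linear α • θ) 𝒜

  -- Homogeneous elements of degree k in Ω¹(𝒜).  Since deg dxᵢ = 0, the form
  -- η/Q(𝒜) has degree k iff each ηᵢ is homogeneous of degree k + deg Q(𝒜).
  record LogForm {ℓ} (𝒜 : Arrangement ℓ) (k : ℤ) : Set (c ⊔ r) where
    field
      numerator   : OneForm ℓ
      logarithmic : IsLogarithmic 𝒜 numerator
      homogeneous : ∀ i → IsHomogeneous (numerator i) (k ℤ.+ + deg-Q 𝒜)
  open LogForm public

  private
    [x+y]-[z+w] : ∀ x y z w → (x + y) - (z + w) ≈ (x - z) + (y - w)
    [x+y]-[z+w] x y z w = begin
      (x + y) - (z + w)      ≈⟨ +-congˡ (-‿+-comm z w) ⟨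
      (x + y) + (- z + - w)  ≈⟨ interchange x y (- z) (- w) ⟩
      (x - z) + (y - w)      ∎
      where
      open import Algebra.Properties.CommutativeSemigroup
        (CommutativeRing.+-commutativeSemigroup 𝕂-ring) using (interchange)

    scale-difference : ∀ x y z → x * y - x * z ≈ x * (y - z)
    scale-difference x y z = begin
      x * y - x * z      ≈⟨ +-congˡ (-‿distribʳ-* x z) ⟩
      x * y + x * (- z)  ≈⟨ distribˡ x y (- z) ⟨
      x * (y - z)        ∎

    module _ {ℓ} {𝒜 : Arrangement ℓ} where

      log-0 : IsLogarithmic 𝒜 (λ _ → 0ₚ)
      log-0 = All.universal (λ α → (λ _ _ _ → 0ₚ) , λ i j _ e → begin
        conv (λ _ → 0#) (coeff (d α j)) e - conv (λ _ → 0#) (coeff (d α i)) e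
          ≈⟨ +-cong (conv-vanish _ _ e λ _ _ _ → inj₁ refl)
                    (-‿cong (conv-vanish _ _ e λ _ _ _ → inj₁ refl)) ⟩
        0# - 0#
          ≈⟨ -‿inverseʳ 0# ⟩
        0#
          ≈⟨ conv-vanish (coeff (linear α)) _ e (λ _ _ _ → inj₂ refl) ⟨
        conv (coeff (linear α)) (λ _ → 0#) e ∎) 𝒜

      log-+ : ∀ {η ξ} → IsLogarithmic 𝒜 η → IsLogarithmic 𝒜 ξ →
              IsLogarithmic 𝒜 (λ i → η i +ₚ ξ i)
      log-+ {η} {ξ} p q = All.zipWith (λ {α} → add α) (p , q)
        where
        add : ∀ α → (Σ[ θ ∈ TwoForm ℓ ] η ∧ d α ≈₂ linear α • θ) ×
                    (Σ[ θ ∈ TwoForm ℓ ] ξ ∧ d α ≈₂ linear α • θ) →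
              Σ[ θ ∈ TwoForm ℓ ] (λ i → η i +ₚ ξ i) ∧ d α ≈₂ linear α • θ
        add α ((θ , h) , (θ′ , h′)) =
          (λ i j i<j → θ i j i<j +ₚ θ′ i j i<j) , λ i j i<j e →
          trans (+-cong (conv-+ˡ _ _ _ e) (-‿cong (conv-+ˡ _ _ _ e)))
          (trans ([x+y]-[z+w] _ _ _ _)
          (trans (+-cong (h i j i<j e) (h′ i j i<j e))
                 (sym (conv-+ʳ _ _ _ e))))

      log-* : ∀ {η} x → IsLogarithmic 𝒜 η → IsLogarithmic 𝒜 (λ i → x ·ₚ η i)
      log-* x = All.map λ (θ , h) →
        (λ i j i<j → x ·ₚ θ i j i<j) , λ i j i<j e →
        trans (+-cong (conv-*ˡ x _ _ e) (-‿cong (conv-*ˡ x _ _ e)))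
        (trans (scale-difference x _ _)
        (trans (*-congˡ (h i j i<j e))
               (sym (conv-*ʳ x _ _ e))))

  -- The graded piece Ω¹(𝒜)ₖ as a vector space over 𝕂.
  Ω¹ : ∀ {ℓ} → Arrangement ℓ → ℤ → LeftModule ring (c ⊔ r) r
  Ω¹ 𝒜 k = record
    { Carrierᴹ = LogForm 𝒜 k
    ; _≈ᴹ_     = λ ω ω′ → ∀ i → numerator ω i ≈ₚ numerator ω′ i
    ; _+ᴹ_     = λ ω ω′ → record
      { numerator   = λ i → numerator ω i +ₚ numerator ω′ i
      ; logarithmic = log-+ {η = numerator ω} {numerator ω′} (logarithmic ω) (logarithmic ω′)
      ; homogeneous = λ i e ne →
          trans (+-cong (homogeneous ω i e ne) (homogeneous ω′ i e ne)) (+-identityˡ 0#)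
      }
    ; _*ₗ_     = scale
    ; 0ᴹ       = record
      { numerator   = λ _ → 0ₚ
      ; logarithmic = log-0
      ; homogeneous = λ _ _ _ → refl
      }
    ; -ᴹ_      = scale (- 1#)
    ; isLeftModule = record
      { isLeftSemimodule = record
        { +ᴹ-isCommutativeMonoid = record
          { isMonoid = record
            { isSemigroup = record
              { isMagma = record
                { isEquivalence = record
                  { refl  = λ i e → refl
                  ; sym   = λ p i e → sym (p i e)
                  ; trans = λ p q i e → trans (p i e) (q i e)
                  }
                ; ∙-cong = λ p q i e → +-cong (p i e) (q i e)
                }
              ; assoc = λ _ _ _ i e → +-assoc _ _ _
              }
            ; identity = (λ _ i e → +-identityˡ _) , (λ _ i e → +-identityʳ _)
            }
          ; comm = λ _ _ i e → +-comm _ _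
          }
        ; isPreleftSemimodule = record
          { *ₗ-cong      = λ x≈y p i e → *-cong x≈y (p i e)
          ; *ₗ-zeroˡ     = λ _ i e → zeroˡ _
          ; *ₗ-distribʳ  = λ _ _ _ i e → distribʳ _ _ _
          ; *ₗ-identityˡ = λ _ i e → *-identityˡ _
          ; *ₗ-assoc     = λ _ _ _ i e → *-assoc _ _ _
          ; *ₗ-zeroʳ     = λ _ i e → zeroʳ _
          ; *ₗ-distribˡ  = λ _ _ _ i e → distribˡ _ _ _
          }
        }
      ; -ᴹ‿cong    = λ p i e → *-congˡ (p i e)
      ; -ᴹ‿inverse = (λ _ i e → trans (+-congʳ (-1*x≈-x _)) (-‿inverseˡ _))
                   , (λ _ i e → trans (+-congˡ (-1*x≈-x _)) (-‿inverseʳ _))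
      }
    }
    where
    scale : 𝕂 → LogForm 𝒜 k → LogForm 𝒜 k
    scale x ω = record
      { numerator   = λ i → x ·ₚ numerator ω i
      ; logarithmic = log-* {η = numerator ω} x (logarithmic ω)
      ; homogeneous = λ i e ne → trans (*-congˡ (homogeneous ω i e ne)) (zeroʳ x)
      }

  ----------------------------------------------------------------------
  -- Dimension and Hilbert series

  module _ {m ℓm} (M : LeftModule ring m ℓm) where
    open LeftModule M

    linearCombination : ∀ {n} → Vector 𝕂 n → Vector Carrierᴹ n → Carrierᴹ
    linearCombination x b = RawMonoidSum.sum +ᴹ-rawMonoid λ i → x i *ₗ b i

    IsLinearlyIndependent : ∀ {n} → Vector Carrierᴹ n → Set (c ⊔ r ⊔ ℓm)
    IsLinearlyIndependent b = ∀ x → linearCombination x b ≈ᴹ 0ᴹ → ∀ i → x i ≈ 0#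

    IsSpanning : ∀ {n} → Vector Carrierᴹ n → Set (c ⊔ m ⊔ ℓm)
    IsSpanning b = ∀ v → ∃ λ x → v ≈ᴹ linearCombination x b

    HasDimension : ℕ → Set (c ⊔ r ⊔ m ⊔ ℓm)
    HasDimension n =
      Σ[ b ∈ Vector Carrierᴹ n ] IsLinearlyIndependent b × IsSpanning b

  -- Hilb(⊕ₖ Mₖ , t) = h
  HasHilbertSeries : ∀ {m ℓm} → (ℤ → LeftModule ring m ℓm) → LaurentSeries →
                     Set (c ⊔ r ⊔ m ⊔ ℓm)
  HasHilbertSeries M h = ∀ k → HasDimension (M k) (h k)

-- For a clique F put ω_F = ∑_{w ∈ F} dx_w / ∏_{j ∈ F, j ≠ w} (x_w − x_j), a logarithmic form of degree
-- 1 − #F.  Filter Ω¹(𝒜_G) by the vanishing of the coefficients of dx_w for w < v.  The leading coefficient of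
-- a form ∑_{w ≥ v} ω_w dx_w is g / ∏_{j ∈ N} (x_v − x_j), with N the set of neighbours j > v of v.  In the
-- coordinates x_v and u_j = x_v − x_j, the logarithmic condition at non-adjacent i, j ∈ N puts g in the ideal
-- (u_i , u_j), so ω_v is a combination of the monomials in x_v and the u_j with exponents ≥ −1, where the
-- exponents equal to −1 occur at the elements of a clique in N.  If F is v together with this clique, such a
-- monomial is the leading coefficient of a polynomial multiple of ω_F, and the exponents ≥ 0 range over x_v
-- and the u_j with j ∉ F: this accounts for the summand of F.

module Submission where

open import Defs
open import Algebra.Apartness.Bundles using (HeytingField; HeytingCommutativeRing)
open import Algebra.Bundles using (CommutativeRing)
open import Algebra.Module.Bundles using (LeftModule)
import Algebra.Properties.AbelianGroup as AbelianGroupProperties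
import Algebra.Properties.CommutativeSemigroup as CommutativeSemigroupProperties
import Algebra.Properties.Group as GroupProperties
import Algebra.Properties.Ring as RingProperties
import Algebra.Properties.Semiring.Sum as SemiringSum
open import Algebra.Structures using (IsCommutativeRing)
open import Data.Bool.Base using (if_then_else_)
open import Data.Empty using (⊥)
open import Data.Fin.Base as Fin using (Fin; toℕ; zero; suc)
open import Data.Fin.Induction using (>-weakInduction)
import Data.Fin.Properties as Finₚ
open import Data.Fin.Subset as Subset using (Subset; inside; outside; ∣_∣; ∁)
import Data.Fin.Subset.Properties as Subsetₚ
open import Data.Integer.Base as ℤ using (ℤ; +_; -[1+_])
import Data.Integer.Properties as ℤₚ
open import Data.Integer.Solver using (module +-*-Solver)
open import Data.List.Base as List using (List; []; _∷_; _++_)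
open import Data.List.Membership.Propositional using (_∈_; _∉_; find; lose)
open import Data.List.Membership.Propositional.Properties
open import Data.List.Membership.Propositional.Properties.WithK using (unique∧set⇒bag)
import Data.List.Properties as Listₚ
open import Data.List.Relation.Binary.BagAndSetEquality using (∼bag⇒↭)
open import Data.List.Relation.Binary.Permutation.Propositional as Perm using (_↭_)
open import Data.List.Relation.Binary.Permutation.Propositional.Properties using (↭-length)
open import Data.List.Relation.Unary.All as All using (All; []; _∷_)
import Data.List.Relation.Unary.All.Properties as Allₚ
open import Data.List.Relation.Unary.AllPairs using (AllPairs; []; _∷_)
import Data.List.Relation.Unary.AllPairs.Properties as AllPairsₚ
open import Data.List.Relation.Unary.Any as Any using (here; there)
open import Data.List.Relation.Unary.Any.Properties using (lookup-index)
open import Data.List.Relation.Unary.Unique.Propositional using (Unique)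
import Data.List.Relation.Unary.Unique.Propositional.Properties as Uniqueₚ
open import Data.Nat.Base as ℕ using (ℕ; zero; suc; _∸_; z≤n; s≤s)
import Data.Nat.ListAction as ℕList
import Data.Nat.Properties as ℕₚ
open import Data.Product.Base using (Σ-syntax; ∃; _×_; _,_; proj₁; proj₂)
open import Data.Sum.Base using (_⊎_; inj₁; inj₂)
open import Data.Vec.Base as Vec using (Vec; []; _∷_)
open import Data.Vec.Functional using (Vector; foldr)
import Data.Vec.Properties as Vecₚ
open import Function.Base using (_∘_; id; case_of_)
open import Function.Bundles using (mk⇔)
open import Level using (_⊔_)
open import Relation.Binary.Definitions using (tri<; tri≈; tri>)
open import Relation.Binary.PropositionalEquality as ≡ using (_≡_; _≢_)
import Relation.Binary.Reasoning.Setoid as SetoidReasoning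
open import Relation.Nullary.Decidable
  using (Dec; yes; no; does; _×-dec_; _⊎-dec_; _→-dec_; ¬?; dec-true; decidable-stable)
open import Relation.Nullary.Negation using (¬_; contradiction)
open import Relation.Unary using (Pred; Decidable)

-- Equality in the ground field is not decidable, so no step tests whether a coefficient or a
-- polynomial is zero, and no unique factorisation is invoked. Divisibility by x_a - x_b is
-- vanishing under x_a ↦ x_b, and products of differences are divided out one factor at a time: a
-- factor already removed stays cancellable on the remaining hyperplanes. Dimensions come from
-- explicit bases indexed by exponent vectors; whether a coefficient can be nonzero is decided from
-- its exponent and the graph alone.
--
-- The ideal (u_i , u_j) comes from restricting numerators to x_v = x_i = x_j. The edge {v , j}
-- kills the component at i, which is neither v nor j; the edge {v , i} makes the components at i
-- and v opposite, so the one at v vanishes as well. The differences along edges that do not start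
-- at v survive this restriction, as i and j are not adjacent.
--
-- Multiplying by the product of all u_j with j ∈ N turns the exponents -1 into 0. A clique is then
-- read off from a monomial as v with the neighbours of exponent 0, so different cliques contribute
-- disjoint sets of monomials.

-- Cauchy products and Horner evaluation over a commutative ring.

module Convolution {c r} (R : CommutativeRing c r) where
  open CommutativeRing R hiding (zero)
  open SemiringSum semiring
    using (sum⁺-syntax; ∑-distrib-+; sum-cong-≋; sum-replicate-zero; *-distribˡ-sum)
  open SetoidReasoning setoid

  infixl 7 _⋆_

  _⋆_ : (ℕ → Carrier) → (ℕ → Carrier) → ℕ → Carrier
  (a ⋆ b) k = ∑[ i ≤ k ] (a (toℕ i) * b (k ∸ toℕ i))

  ⋆-cong : ∀ {a a′ b b′} → (∀ i → a i ≈ a′ i) → (∀ i → b i ≈ b′ i) → ∀ k → (a ⋆ b) k ≈ (a′ ⋆ b′) k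
  ⋆-cong p q k = sum-cong-≋ {suc k} λ i → *-cong (p (toℕ i)) (q (k ∸ toℕ i))

  -- The definition splits off the first term of the sum. Splitting off the last one as well makes
  -- commutativity a plain induction.
  ⋆-sucʳ : ∀ a b k → (a ⋆ b) (suc k) ≈ (a ⋆ (b ∘ suc)) k + a (suc k) * b 0
  ⋆-sucʳ a b zero    = +-cong (sym (+-identityʳ _)) (+-identityʳ _)
  ⋆-sucʳ a b (suc k) = begin
    a 0 * b (2 ℕ.+ k) + ((a ∘ suc) ⋆ b) (suc k)                          ≈⟨ +-congˡ (⋆-sucʳ (a ∘ suc) b k) ⟩
    a 0 * b (2 ℕ.+ k) + (((a ∘ suc) ⋆ (b ∘ suc)) k + a (2 ℕ.+ k) * b 0)  ≈⟨ +-assoc _ _ _ ⟨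
    (a ⋆ (b ∘ suc)) (suc k) + a (2 ℕ.+ k) * b 0                          ∎

  ⋆-comm : ∀ a b k → (a ⋆ b) k ≈ (b ⋆ a) k
  ⋆-comm a b zero    = +-congʳ (*-comm _ _)
  ⋆-comm a b (suc k) = begin
    a 0 * b (suc k) + ((a ∘ suc) ⋆ b) k  ≈⟨ +-cong (*-comm _ _) (⋆-comm (a ∘ suc) b k) ⟩
    b (suc k) * a 0 + (b ⋆ (a ∘ suc)) k  ≈⟨ +-comm _ _ ⟩
    (b ⋆ (a ∘ suc)) k + b (suc k) * a 0  ≈⟨ ⋆-sucʳ b a k ⟨
    (b ⋆ a) (suc k)                      ∎

  ⋆-distribʳ : ∀ a b c k → ((λ i → a i + b i) ⋆ c) k ≈ (a ⋆ c) k + (b ⋆ c) k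
  ⋆-distribʳ a b c k = trans
    (sum-cong-≋ {suc k} λ i → distribʳ (c (k ∸ toℕ i)) (a (toℕ i)) (b (toℕ i)))
    (∑-distrib-+ {suc k} (λ i → a (toℕ i) * c (k ∸ toℕ i)) (λ i → b (toℕ i) * c (k ∸ toℕ i)))

  ⋆-scale : ∀ x a b k → ((λ i → x * a i) ⋆ b) k ≈ x * (a ⋆ b) k
  ⋆-scale x a b k = trans
    (sum-cong-≋ {suc k} λ i → *-assoc x (a (toℕ i)) (b (k ∸ toℕ i)))
    (sym (*-distribˡ-sum {suc k} x λ i → a (toℕ i) * b (k ∸ toℕ i)))

  ⋆-assoc : ∀ a b c k → ((a ⋆ b) ⋆ c) k ≈ (a ⋆ (b ⋆ c)) k
  ⋆-assoc a b c zero = begin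
    (a 0 * b 0 + 0#) * c 0 + 0#    ≈⟨ +-congʳ (*-congʳ (+-identityʳ _)) ⟩
    a 0 * b 0 * c 0 + 0#           ≈⟨ +-congʳ (*-assoc _ _ _) ⟩
    a 0 * (b 0 * c 0) + 0#         ≈⟨ +-congʳ (*-congˡ (+-identityʳ _)) ⟨
    a 0 * (b 0 * c 0 + 0#) + 0#    ∎
  ⋆-assoc a b c (suc k) = begin
    (a 0 * b 0 + 0#) * c (suc k) + (((a ⋆ b) ∘ suc) ⋆ c) k
      ≈⟨ +-cong (trans (*-congʳ (+-identityʳ _)) (*-assoc _ _ _))
           (⋆-distribʳ (λ i → a 0 * b (suc i)) ((a ∘ suc) ⋆ b) c k) ⟩
    a 0 * (b 0 * c (suc k)) + (((λ i → a 0 * b (suc i)) ⋆ c) k + (((a ∘ suc) ⋆ b) ⋆ c) k)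
      ≈⟨ +-congˡ (+-cong (⋆-scale (a 0) (b ∘ suc) c k) (⋆-assoc (a ∘ suc) b c k)) ⟩
    a 0 * (b 0 * c (suc k)) + (a 0 * ((b ∘ suc) ⋆ c) k + ((a ∘ suc) ⋆ (b ⋆ c)) k)
      ≈⟨ +-assoc _ _ _ ⟨
    a 0 * (b 0 * c (suc k)) + a 0 * ((b ∘ suc) ⋆ c) k + ((a ∘ suc) ⋆ (b ⋆ c)) k
      ≈⟨ +-congʳ (distribˡ _ _ _) ⟨
    a 0 * (b ⋆ c) (suc k) + ((a ∘ suc) ⋆ (b ⋆ c)) k
      ∎

  ⋆-zeroˡ : ∀ {a} b → (∀ i → a i ≈ 0#) → ∀ k → (a ⋆ b) k ≈ 0#
  ⋆-zeroˡ b a≈0 k = trans (sum-cong-≋ {suc k} λ i → trans (*-congʳ (a≈0 (toℕ i))) (zeroˡ (b (k ∸ toℕ i))))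
                          (sum-replicate-zero (suc k))

  -- A coefficient sequence carries no degree, so the last index `B` that is taken into account is
  -- an explicit argument.
  horner : Carrier → ℕ → (ℕ → Carrier) → Carrier
  horner r zero    a = a 0
  horner r (suc B) a = a 0 + r * horner r B (a ∘ suc)

  horner-cong : ∀ r B {a b} → (∀ i → a i ≈ b i) → horner r B a ≈ horner r B b
  horner-cong r zero    p = p 0
  horner-cong r (suc B) p = +-cong (p 0) (*-congˡ (horner-cong r B (p ∘ suc)))

  horner-0 : ∀ r B {a} → (∀ i → a i ≈ 0#) → horner r B a ≈ 0#
  horner-0 r zero    p = p 0
  horner-0 r (suc B) p = trans
    (+-cong (p 0) (trans (*-congˡ (horner-0 r B (p ∘ suc))) (zeroʳ r))) (+-identityˡ 0#)

  horner-constant : ∀ r B {a} → (∀ i → a (suc i) ≈ 0#) → horner r B a ≈ a 0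
  horner-constant r zero    p = refl
  horner-constant r (suc B) p = trans
    (+-congˡ (trans (*-congˡ (horner-0 r B p)) (zeroʳ r))) (+-identityʳ _)

  horner-+ : ∀ r B a b → horner r B (λ i → a i + b i) ≈ horner r B a + horner r B b
  horner-+ r zero    a b = refl
  horner-+ r (suc B) a b = begin
    a 0 + b 0 + r * horner r B (λ i → a (suc i) + b (suc i))                  ≈⟨ +-congˡ (*-congˡ (horner-+ r B _ _)) ⟩
    a 0 + b 0 + r * (horner r B (a ∘ suc) + horner r B (b ∘ suc))             ≈⟨ +-congˡ (distribˡ _ _ _) ⟩
    a 0 + b 0 + (r * horner r B (a ∘ suc) + r * horner r B (b ∘ suc))         ≈⟨ interchange _ _ _ _ ⟩
    a 0 + r * horner r B (a ∘ suc) + (b 0 + r * horner r B (b ∘ suc))         ∎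
    where open CommutativeSemigroupProperties +-commutativeSemigroup using (interchange)

  horner-scale : ∀ r B x a → horner r B (λ i → x * a i) ≈ x * horner r B a
  horner-scale r zero    x a = refl
  horner-scale r (suc B) x a = begin
    x * a 0 + r * horner r B (λ i → x * a (suc i))  ≈⟨ +-congˡ (*-congˡ (horner-scale r B x _)) ⟩
    x * a 0 + r * (x * horner r B (a ∘ suc))        ≈⟨ +-congˡ (x∙yz≈y∙xz r x _) ⟩
    x * a 0 + x * (r * horner r B (a ∘ suc))        ≈⟨ distribˡ _ _ _ ⟨
    x * (a 0 + r * horner r B (a ∘ suc))            ∎
    where open CommutativeSemigroupProperties *-commutativeSemigroup using (x∙yz≈y∙xz)

  horner-vanish : ∀ r {B B′} a → B ℕ.≤ B′ → (∀ i → B ℕ.< i → a i ≈ 0#) → horner r B′ a ≈ horner r B a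
  horner-vanish r {B′ = B′} a z≤n       v = horner-constant r B′ λ i → v (suc i) (s≤s z≤n)
  horner-vanish r           a (s≤s B≤B′) v =
    +-congˡ (*-congˡ (horner-vanish r (a ∘ suc) B≤B′ λ i B<i → v (suc i) (s≤s B<i)))

  -- Induction on `B`: the first coefficient of `a` contributes a scalar multiple of `b`, and the
  -- others a shifted product. The bound for `b` grows on the way, which `horner-vanish` undoes.
  horner-⋆ : ∀ r B B′ {a b} → (∀ i → B ℕ.< i → a i ≈ 0#) → (∀ i → B′ ℕ.< i → b i ≈ 0#) →
             horner r (B ℕ.+ B′) (a ⋆ b) ≈ horner r B a * horner r B′ b
  horner-⋆ r zero B′ {a} {b} v w = trans (horner-cong r B′ first) (horner-scale r B′ (a 0) b)
    where
    first : ∀ k → (a ⋆ b) k ≈ a 0 * b k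
    first zero    = +-identityʳ _
    first (suc k) = trans (+-congˡ (⋆-zeroˡ b (λ i → v (suc i) (s≤s z≤n)) k)) (+-identityʳ _)
  horner-⋆ r (suc B) B′ {a} {b} v w = begin
    (a 0 * b 0 + 0#) + r * horner r (B ℕ.+ B′) (λ k → a 0 * b (suc k) + ((a ∘ suc) ⋆ b) k)
      ≈⟨ +-cong (+-identityʳ _) (*-congˡ (horner-+ r (B ℕ.+ B′) _ _)) ⟩
    a 0 * b 0 + r * (horner r (B ℕ.+ B′) (λ k → a 0 * b (suc k)) + horner r (B ℕ.+ B′) ((a ∘ suc) ⋆ b))
      ≈⟨ +-congˡ (distribˡ _ _ _) ⟩
    a 0 * b 0 + (r * horner r (B ℕ.+ B′) (λ k → a 0 * b (suc k)) + r * horner r (B ℕ.+ B′) ((a ∘ suc) ⋆ b))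
      ≈⟨ +-assoc _ _ _ ⟨
    horner r (suc B ℕ.+ B′) (λ k → a 0 * b k) + r * horner r (B ℕ.+ B′) ((a ∘ suc) ⋆ b)
      ≈⟨ +-cong (horner-scale r (suc B ℕ.+ B′) (a 0) b) (*-congˡ (horner-⋆ r B B′ (λ i lt → v (suc i) (s≤s lt)) w)) ⟩
    a 0 * horner r (suc B ℕ.+ B′) b + r * (horner r B (a ∘ suc) * horner r B′ b)
      ≈⟨ +-cong (*-congˡ (horner-vanish r b (ℕₚ.m≤n+m B′ (suc B)) w)) (sym (*-assoc _ _ _)) ⟩
    a 0 * horner r B′ b + r * horner r B (a ∘ suc) * horner r B′ b
      ≈⟨ distribʳ _ _ _ ⟨
    (a 0 + r * horner r B (a ∘ suc)) * horner r B′ b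
      ∎

-- The commutative ring of polynomials.

module PolynomialRing {c r s} (K : HeytingField c r s) where

  open Polynomials K
  𝕂-ring : CommutativeRing c r
  𝕂-ring = HeytingCommutativeRing.commutativeRing (HeytingField.heytingCommutativeRing K)

  open CommutativeRing 𝕂-ring hiding (zero) renaming (Carrier to 𝕂)
  open SemiringSum semiring using (sum; sum-cong-≋; sum-replicate-zero)
  module Sum {c r} (R : CommutativeRing c r) = SemiringSum (CommutativeRing.semiring R)

  module _ {n : ℕ} where
    infix 4 _≈ᶜ_
    infixl 6 _+ᶜ_
    _≈ᶜ_ : (f g : Vec ℕ n → 𝕂) → Set r
    f ≈ᶜ g = ∀ e → f e ≈ g e

    _+ᶜ_ : (f g : Vec ℕ n → 𝕂) → Vec ℕ n → 𝕂
    (f +ᶜ g) e = f e + g e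

    -ᶜ_ : (f : Vec ℕ n → 𝕂) → Vec ℕ n → 𝕂
    (-ᶜ f) e = - f e

    0ᶜ 1ᶜ : Vec ℕ n → 𝕂
    0ᶜ _ = 0#
    1ᶜ = coeff 1ₚ

  conv-cong : ∀ {n} {f f′ g g′ : Vec ℕ n → 𝕂} → f ≈ᶜ f′ → g ≈ᶜ g′ → conv f g ≈ᶜ conv f′ g′
  conv-cong p q []      = *-cong (p []) (q [])
  conv-cong p q (k ∷ e) = sum-cong-≋ {suc k} λ i →
    conv-cong (λ e → p (toℕ i ∷ e)) (λ e → q (k ∸ toℕ i ∷ e)) e

  private
    isCommutativeRing′ : ∀ {n} →
      (∀ (f g h : Vec ℕ n → 𝕂) → conv (conv f g) h ≈ᶜ conv f (conv g h)) →
      (∀ (f g : Vec ℕ n → 𝕂) → conv f g ≈ᶜ conv g f) →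
      (∀ (f : Vec ℕ n → 𝕂) → conv 1ᶜ f ≈ᶜ f) →
      IsCommutativeRing (_≈ᶜ_ {n}) _+ᶜ_ conv -ᶜ_ 0ᶜ 1ᶜ
    isCommutativeRing′ assoc comm identityˡ = record
      { isRing = record
        { +-isAbelianGroup = record
          { isGroup = record
            { isMonoid = record
              { isSemigroup = record
                { isMagma = record
                  { isEquivalence = record
                    { refl  = λ e → refl
                    ; sym   = λ p e → sym (p e)
                    ; trans = λ p q e → trans (p e) (q e)
                    }
                  ; ∙-cong = λ p q e → +-cong (p e) (q e)
                  }
                ; assoc = λ _ _ _ e → +-assoc _ _ _
                }
              ; identity = (λ _ e → +-identityˡ _) , (λ _ e → +-identityʳ _)
              }
            ; inverse = (λ _ e → -‿inverseˡ _) , (λ _ e → -‿inverseʳ _)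
            ; ⁻¹-cong = λ p e → -‿cong (p e)
            }
          ; comm = λ _ _ e → +-comm _ _
          }
        ; *-cong     = conv-cong
        ; *-assoc    = assoc
        ; *-identity = identityˡ , λ f e → trans (comm f 1ᶜ e) (identityˡ f e)
        ; distrib    = (λ f g h → conv-+ʳ f g h) , (λ f g h → conv-+ˡ g h f)
        }
      ; *-comm = comm
      }

    -- Declared before its definition because of a mutual induction on the number of variables:
    -- commutativity and associativity of `conv` in n + 1 variables are those of `⋆` over the ring
    -- in n variables.
    coefficientIsRing : ∀ n → IsCommutativeRing (_≈ᶜ_ {n}) _+ᶜ_ conv -ᶜ_ 0ᶜ 1ᶜ

  coefficientRing : ℕ → CommutativeRing c r
  coefficientRing n = record { isCommutativeRing = coefficientIsRing n }

  module _ {n : ℕ} where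
    open Convolution (coefficientRing n) using (_⋆_)

    sum-apply : ∀ {m} (f : Fin m → Vec ℕ n → 𝕂) e →
                Sum.sum (coefficientRing n) f e ≡ sum λ i → f i e
    sum-apply {zero}  f e = ≡.refl
    sum-apply {suc m} f e = ≡.cong (λ x → f zero e + x) (sum-apply (f ∘ suc) e)

    -- A function of n + 1 exponents is a sequence of functions of n exponents. This reading
    -- transports the laws of `⋆` to `conv`.
    conv-⋆ : ∀ (f g : Vec ℕ (suc n) → 𝕂) k → conv f g ▹ k ≈ᶜ ((f ▹_) ⋆ (g ▹_)) k
    conv-⋆ f g k e = sym (reflexive (sum-apply {suc k} (λ i → conv (f ▹ toℕ i) (g ▹ (k ∸ toℕ i))) e))

  private
    conv-comm : ∀ {n} (f g : Vec ℕ n → 𝕂) → conv f g ≈ᶜ conv g f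
    conv-comm f g []      = *-comm _ _
    conv-comm {suc n} f g (k ∷ e) = begin
      conv f g (k ∷ e)          ≈⟨ conv-⋆ f g k e ⟩
      ((f ▹_) ⋆ (g ▹_)) k e     ≈⟨ ⋆-comm (f ▹_) (g ▹_) k e ⟩
      ((g ▹_) ⋆ (f ▹_)) k e     ≈⟨ conv-⋆ g f k e ⟨
      conv g f (k ∷ e)          ∎
      where
      open Convolution (coefficientRing n)
      open SetoidReasoning setoid

    conv-assoc : ∀ {n} (f g h : Vec ℕ n → 𝕂) → conv (conv f g) h ≈ᶜ conv f (conv g h)
    conv-assoc f g h [] = *-assoc _ _ _
    conv-assoc {suc n} f g h (k ∷ e) = begin
      conv (conv f g) h (k ∷ e)                 ≈⟨ conv-⋆ (conv f g) h k e ⟩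
      ((conv f g ▹_) ⋆ (h ▹_)) k e              ≈⟨ ⋆-cong {b = h ▹_} (conv-⋆ f g) (λ _ _ → refl) k e ⟩
      (((f ▹_) ⋆ (g ▹_)) ⋆ (h ▹_)) k e          ≈⟨ ⋆-assoc (f ▹_) (g ▹_) (h ▹_) k e ⟩
      ((f ▹_) ⋆ ((g ▹_) ⋆ (h ▹_))) k e          ≈⟨ ⋆-cong {f ▹_} (λ _ _ → refl) (conv-⋆ g h) k e ⟨
      ((f ▹_) ⋆ (conv g h ▹_)) k e              ≈⟨ conv-⋆ f (conv g h) k e ⟨
      conv f (conv g h) (k ∷ e)                 ∎
      where
      open Convolution (coefficientRing n)
      open SetoidReasoning setoid

    conv-identityˡ : ∀ {n} (f : Vec ℕ n → 𝕂) → conv 1ᶜ f ≈ᶜ f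
    conv-identityˡ f []      = *-identityˡ _
    conv-identityˡ f (k ∷ e) = trans
      (+-cong (conv-identityˡ (f ▹ k) e) (trans
        (sum-cong-≋ {k} λ i → conv-vanish 0ᶜ (f ▹ (k ∸ suc (toℕ i))) e λ _ _ _ → inj₁ refl)
        (sum-replicate-zero k)))
      (+-identityʳ _)
      where open import Data.Sum.Base using (inj₁)

    coefficientIsRing n = isCommutativeRing′ conv-assoc conv-comm conv-identityˡ

  infix 8 -ₚ_
  -ₚ_ : ∀ {ℓ} → Poly ℓ → Poly ℓ
  -ₚ p = record
    { coeff  = λ e → - coeff p e
    ; bound  = bound p
    ; vanish = λ e lt → trans (-‿cong (vanish p e lt)) -0#≈0#
    }
    where open RingProperties ring using (-0#≈0#)

  -- A record and opaque operations, so that unification does not look through coefficients.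
  infix 4 _≃_
  record _≃_ {ℓ} (p q : Poly ℓ) : Set r where
    constructor ⟪_⟫
    field at : p ≈ₚ q
  open _≃_ public

  infix  8 ⊟_
  infixl 7 _⊠_
  infixl 6 _⊞_

  opaque
    _⊞_ _⊠_ : ∀ {ℓ} → Poly ℓ → Poly ℓ → Poly ℓ
    _⊞_ = _+ₚ_
    _⊠_ = _*ₚ_

    ⊟_ : ∀ {ℓ} → Poly ℓ → Poly ℓ
    ⊟_ = -ₚ_

    zeroPoly onePoly : ∀ {ℓ} → Poly ℓ
    zeroPoly = 0ₚ
    onePoly  = 1ₚ

    polyIsCommutativeRing : ∀ ℓ → IsCommutativeRing (_≃_ {ℓ}) _⊞_ _⊠_ ⊟_ zeroPoly onePoly
    polyIsCommutativeRing ℓ = record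
      { isRing = record
        { +-isAbelianGroup = record
          { isGroup = record
            { isMonoid = record
              { isSemigroup = record
                { isMagma = record
                  { isEquivalence = record
                    { refl  = ⟪ C.refl ⟫
                    ; sym   = λ p → ⟪ C.sym (at p) ⟫
                    ; trans = λ p q → ⟪ C.trans (at p) (at q) ⟫
                    }
                  ; ∙-cong = λ p q → ⟪ C.+-cong (at p) (at q) ⟫
                  }
                ; assoc = λ p q u → ⟪ C.+-assoc (coeff p) (coeff q) (coeff u) ⟫
                }
              ; identity = (λ p → ⟪ C.+-identityˡ (coeff p) ⟫) , (λ p → ⟪ C.+-identityʳ (coeff p) ⟫)
              }
            ; inverse = (λ p → ⟪ C.-‿inverseˡ (coeff p) ⟫) , (λ p → ⟪ C.-‿inverseʳ (coeff p) ⟫)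
            ; ⁻¹-cong = λ p → ⟪ C.-‿cong (at p) ⟫
            }
          ; comm = λ p q → ⟪ C.+-comm (coeff p) (coeff q) ⟫
          }
        ; *-cong     = λ p q → ⟪ C.*-cong (at p) (at q) ⟫
        ; *-assoc    = λ p q u → ⟪ C.*-assoc (coeff p) (coeff q) (coeff u) ⟫
        ; *-identity = (λ p → ⟪ C.*-identityˡ (coeff p) ⟫) , (λ p → ⟪ C.*-identityʳ (coeff p) ⟫)
        ; distrib    = (λ p q u → ⟪ C.distribˡ (coeff p) (coeff q) (coeff u) ⟫)
                     , (λ p q u → ⟪ C.distribʳ (coeff p) (coeff q) (coeff u) ⟫)
        }
      ; *-comm = λ p q → ⟪ C.*-comm (coeff p) (coeff q) ⟫
      }
      where module C = CommutativeRing (coefficientRing ℓ)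

  polyRing : ℕ → CommutativeRing (c ⊔ r) r
  polyRing ℓ = record { isCommutativeRing = polyIsCommutativeRing ℓ }

-- Evaluation of polynomials in an algebra over the field.

module Evaluation {c r s} (K : HeytingField c r s) where
  open Polynomials K
  open PolynomialRing K
  module F = CommutativeRing 𝕂-ring
  open F using () renaming (Carrier to 𝕂)
  module FS = Sum 𝕂-ring

  VanishesBeyond : ∀ {n} → ℕ → (Vec ℕ n → 𝕂) → Set r
  VanishesBeyond B f = ∀ e → B ℕ.< Vec.sum e → f e F.≈ F.0#

  record Homomorphism {t u} (T : CommutativeRing t u) : Set (c ⊔ r ⊔ t ⊔ u) where
    open CommutativeRing T hiding (zero)
    field
      ι   : 𝕂 → Carrier
      ι-cong : ∀ {x y} → x F.≈ y → ι x ≈ ι y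
      ι-+ : ∀ x y → ι (x F.+ y) ≈ ι x + ι y
      ι-* : ∀ x y → ι (x F.* y) ≈ ι x * ι y
      ι-0 : ι F.0# ≈ 0#
      ι-1 : ι F.1# ≈ 1#

  module Horner {t u} (T : CommutativeRing t u) (hom : Homomorphism T) where
    open CommutativeRing T hiding (zero; 0#; 1#)
    open CommutativeRing T using () renaming (0# to 0ₜ; 1# to 1ₜ)
    open Convolution T
    module TS = Sum T
    open Homomorphism hom
    open SetoidReasoning setoid

    -- Nested Horner schemes, one per variable. The same `B` serves all of them, because a bound on
    -- the total degree bounds the degree in each variable.
    ev : ∀ {n} → (Fin n → Carrier) → ℕ → (Vec ℕ n → 𝕂) → Carrier
    ev {zero}  ρ B f = ι (f [])
    ev {suc n} ρ B f = horner (ρ zero) B λ k → ev (ρ ∘ suc) B (f ▹ k)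

    ev-cong : ∀ {n} (ρ : Fin n → Carrier) B {f g} → f ≈ᶜ g → ev ρ B f ≈ ev ρ B g
    ev-cong {zero}  ρ B p = ι-cong (p [])
    ev-cong {suc n} ρ B p = horner-cong _ B λ k → ev-cong (ρ ∘ suc) B λ e → p (k ∷ e)

    ev-0 : ∀ {n} (ρ : Fin n → Carrier) B {f} → f ≈ᶜ 0ᶜ → ev ρ B f ≈ 0ₜ
    ev-0 {zero}  ρ B p = trans (ι-cong (p [])) ι-0
    ev-0 {suc n} ρ B p = horner-0 _ B λ k → ev-0 (ρ ∘ suc) B λ e → p (k ∷ e)

    ev-+ : ∀ {n} (ρ : Fin n → Carrier) B f g → ev ρ B (f +ᶜ g) ≈ ev ρ B f + ev ρ B g
    ev-+ {zero}  ρ B f g = ι-+ _ _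
    ev-+ {suc n} ρ B f g = trans (horner-cong _ B λ k → ev-+ (ρ ∘ suc) B (f ▹ k) (g ▹ k)) (horner-+ _ B _ _)

    ev-scale : ∀ {n} (ρ : Fin n → Carrier) B x f → ev ρ B (λ e → x F.* f e) ≈ ι x * ev ρ B f
    ev-scale {zero}  ρ B x f = ι-* _ _
    ev-scale {suc n} ρ B x f = trans (horner-cong _ B λ k → ev-scale (ρ ∘ suc) B x (f ▹ k)) (horner-scale _ B _ _)

    ev-sum : ∀ {n m} (ρ : Fin n → Carrier) B (f : Fin m → Vec ℕ n → 𝕂) →
             ev ρ B (λ e → FS.sum λ i → f i e) ≈ TS.sum λ i → ev ρ B (f i)
    ev-sum {m = zero}  ρ B f = ev-0 ρ B λ _ → F.refl
    ev-sum {m = suc m} ρ B f = trans (ev-+ ρ B (f zero) _) (+-congˡ (ev-sum ρ B (f ∘ suc)))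

    private
      slice : ∀ {n B} {f : Vec ℕ (suc n) → 𝕂} → VanishesBeyond B f → ∀ k → VanishesBeyond B (f ▹ k)
      slice v k e lt = v (k ∷ e) (ℕₚ.<-≤-trans lt (ℕₚ.m≤n+m _ k))

      tail-0 : ∀ {n B} (ρ : Fin n → Carrier) B′ {f : Vec ℕ (suc n) → 𝕂} → VanishesBeyond B f →
               ∀ k → B ℕ.< k → ev ρ B′ (f ▹ k) ≈ 0ₜ
      tail-0 ρ B′ v k lt = ev-0 ρ B′ λ e → v (k ∷ e) (ℕₚ.<-≤-trans lt (ℕₚ.m≤m+n k _))

    ev-bound : ∀ {n} (ρ : Fin n → Carrier) {B B′ f} → VanishesBeyond B f → B ℕ.≤ B′ → ev ρ B′ f ≈ ev ρ B f
    ev-bound {zero}  ρ v B≤B′ = refl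
    ev-bound {suc n} ρ {B} {B′} v B≤B′ = trans
      (horner-vanish _ _ B≤B′ (tail-0 (ρ ∘ suc) B′ v))
      (horner-cong _ B λ k → ev-bound (ρ ∘ suc) (slice v k) B≤B′)

    -- Every slice of `conv f g` in the first variable is a Cauchy product of slices, so the
    -- induction hypothesis reduces the claim to `horner-⋆`.
    ev-* : ∀ {n} (ρ : Fin n → Carrier) B B′ {f g} → VanishesBeyond B f → VanishesBeyond B′ g →
           ev ρ (B ℕ.+ B′) (conv f g) ≈ ev ρ B f * ev ρ B′ g
    ev-* {zero}  ρ B B′ v w = ι-* _ _
    ev-* {suc n} ρ B B′ {f} {g} v w = begin
      horner x₀ (B ℕ.+ B′) (λ k → ev ρ′ (B ℕ.+ B′) (conv f g ▹ k))
        ≈⟨ horner-cong x₀ (B ℕ.+ B′) (λ k → begin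
             ev ρ′ (B ℕ.+ B′) (conv f g ▹ k)
               ≈⟨ ev-sum {m = suc k} ρ′ (B ℕ.+ B′) (λ i → conv (f ▹ toℕ i) (g ▹ (k ∸ toℕ i))) ⟩
             TS.sum {suc k} (λ i → ev ρ′ (B ℕ.+ B′) (conv (f ▹ toℕ i) (g ▹ (k ∸ toℕ i))))
               ≈⟨ TS.sum-cong-≋ {suc k} (λ i → ev-* ρ′ B B′ (slice v (toℕ i)) (slice w (k ∸ toℕ i))) ⟩
             ((λ i → ev ρ′ B (f ▹ i)) ⋆ (λ i → ev ρ′ B′ (g ▹ i))) k
               ∎) ⟩
      horner x₀ (B ℕ.+ B′) ((λ i → ev ρ′ B (f ▹ i)) ⋆ (λ i → ev ρ′ B′ (g ▹ i)))
        ≈⟨ horner-⋆ x₀ B B′ (tail-0 ρ′ B v) (tail-0 ρ′ B′ w) ⟩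
      ev ρ B f * ev ρ B′ g
        ∎
      where
      x₀ = ρ zero
      ρ′ = ρ ∘ suc

    ev-1 : ∀ {n} (ρ : Fin n → Carrier) B → ev ρ B 1ᶜ ≈ 1ₜ
    ev-1 {zero}  ρ B = ι-1
    ev-1 {suc n} ρ B = trans (horner-constant _ B λ k → ev-0 (ρ ∘ suc) B λ _ → F.refl) (ev-1 (ρ ∘ suc) B)

    ev-var : ∀ {n} (ρ : Fin n → Carrier) B i → ev ρ (suc B) (coeff (var i)) ≈ ρ i
    ev-var {suc n} ρ B zero = begin
      ev (ρ ∘ suc) (suc B) 0ᶜ + ρ zero * horner (ρ zero) B (λ k → ev (ρ ∘ suc) (suc B) (coeff (var zero) ▹ suc k))
        ≈⟨ +-cong (ev-0 (ρ ∘ suc) (suc B) λ _ → F.refl) (*-congˡ (trans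
             (horner-constant (ρ zero) B λ k → ev-0 (ρ ∘ suc) (suc B) λ _ → F.refl)
             (ev-1 (ρ ∘ suc) (suc B)))) ⟩
      0ₜ + ρ zero * 1ₜ  ≈⟨ +-identityˡ _ ⟩
      ρ zero * 1ₜ       ≈⟨ *-identityʳ _ ⟩
      ρ zero            ∎
    ev-var {suc n} ρ B (suc i) = trans
      (horner-constant (ρ zero) (suc B) {λ k → ev (ρ ∘ suc) (suc B) (coeff (var (suc i)) ▹ k)} λ k → ev-0 (ρ ∘ suc) (suc B) λ _ → F.refl)
      (ev-var (ρ ∘ suc) B i)

    eval : ∀ {ℓ} → (Fin ℓ → Carrier) → Poly ℓ → Carrier
    eval ρ p = ev ρ (bound p) (coeff p)

    eval-at : ∀ {ℓ} (ρ : Fin ℓ → Carrier) p {B} → bound p ℕ.≤ B → eval ρ p ≈ ev ρ B (coeff p)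
    eval-at ρ p le = sym (ev-bound ρ (vanish p) le)

    eval-cong : ∀ {ℓ} (ρ : Fin ℓ → Carrier) {p q} → p ≈ₚ q → eval ρ p ≈ eval ρ q
    eval-cong ρ {p} {q} p≈q = begin
      eval ρ p                                ≈⟨ eval-at ρ p (ℕₚ.m≤m⊔n (bound p) (bound q)) ⟩
      ev ρ (bound p ℕ.⊔ bound q) (coeff p)    ≈⟨ ev-cong ρ (bound p ℕ.⊔ bound q) p≈q ⟩
      ev ρ (bound p ℕ.⊔ bound q) (coeff q)    ≈⟨ eval-at ρ q (ℕₚ.m≤n⊔m (bound p) (bound q)) ⟨
      eval ρ q                                ∎

    eval-+ : ∀ {ℓ} (ρ : Fin ℓ → Carrier) p q → eval ρ (p +ₚ q) ≈ eval ρ p + eval ρ q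
    eval-+ ρ p q = trans (ev-+ ρ (bound p ℕ.⊔ bound q) (coeff p) (coeff q))
      (sym (+-cong (eval-at ρ p (ℕₚ.m≤m⊔n (bound p) (bound q))) (eval-at ρ q (ℕₚ.m≤n⊔m (bound p) (bound q)))))

    eval-* : ∀ {ℓ} (ρ : Fin ℓ → Carrier) p q → eval ρ (p *ₚ q) ≈ eval ρ p * eval ρ q
    eval-* ρ p q = ev-* ρ (bound p) (bound q) (vanish p) (vanish q)

    eval-scale : ∀ {ℓ} (ρ : Fin ℓ → Carrier) x p → eval ρ (x ·ₚ p) ≈ ι x * eval ρ p
    eval-scale ρ x p = ev-scale ρ (bound p) x (coeff p)

    eval-0 : ∀ {ℓ} (ρ : Fin ℓ → Carrier) → eval ρ 0ₚ ≈ 0ₜ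
    eval-0 ρ = ev-0 ρ 0 λ _ → F.refl

    eval-1 : ∀ {ℓ} (ρ : Fin ℓ → Carrier) → eval ρ 1ₚ ≈ 1ₜ
    eval-1 {ℓ} ρ = ev-1 ρ (bound (1ₚ {ℓ}))

    eval-const : ∀ {ℓ} (ρ : Fin ℓ → Carrier) x → eval ρ (const x) ≈ ι x
    eval-const ρ x = trans (eval-scale ρ x 1ₚ) (trans (*-congˡ (eval-1 ρ)) (*-identityʳ _))

    eval-neg : ∀ {ℓ} (ρ : Fin ℓ → Carrier) p → eval ρ (-ₚ p) ≈ - eval ρ p
    eval-neg ρ p = inverseʳ-unique (eval ρ p) (eval ρ (-ₚ p)) (begin
      eval ρ p + eval ρ (-ₚ p)  ≈⟨ eval-+ ρ p (-ₚ p) ⟨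
      eval ρ (p +ₚ -ₚ p)        ≈⟨ eval-cong ρ {p +ₚ -ₚ p} {0ₚ} (λ e → F.-‿inverseʳ _) ⟩
      eval ρ 0ₚ                 ≈⟨ eval-0 ρ ⟩
      0ₜ                        ∎)
      where open GroupProperties +-group using (inverseʳ-unique)

    eval-var : ∀ {ℓ} (ρ : Fin ℓ → Carrier) i → eval ρ (var i) ≈ ρ i
    eval-var ρ i = trans (eval-at ρ (var i) (ℕₚ.n≤1+n _)) (ev-var ρ (bound (var i)) i)

    -- The relation is left arbitrary because the main use is not equality but congruence modulo x_a
    -- - x_b; the instance for equality says that values depend only on the environment.
    ev-environment : ∀ {n w} (_~_ : Carrier → Carrier → Set w) →
      (∀ {x y} → x ≈ y → x ~ y) →
      (∀ {x y x′ y′} → x ~ x′ → y ~ y′ → (x + y) ~ (x′ + y′)) →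
      (∀ {x y x′ y′} → x ~ x′ → y ~ y′ → (x * y) ~ (x′ * y′)) →
      {ρ ρ′ : Fin n → Carrier} → (∀ i → ρ i ~ ρ′ i) → ∀ B f → ev ρ B f ~ ev ρ′ B f
    ev-environment {zero}  _~_ ~-≈ ~-+ ~-* p B f = ~-≈ refl
    ev-environment {suc n} _~_ ~-≈ ~-+ ~-* {ρ} {ρ′} p B f =
      horner-~ B λ k → ev-environment _~_ ~-≈ ~-+ ~-* (p ∘ suc) B (f ▹ k)
      where
      horner-~ : ∀ B {a b} → (∀ i → a i ~ b i) → horner (ρ zero) B a ~ horner (ρ′ zero) B b
      horner-~ zero    q = q 0
      horner-~ (suc B) q = ~-+ (q 0) (~-* (p zero) (horner-~ B (q ∘ suc)))

  record _⟶_ {t u t′ u′} {T : CommutativeRing t u} {T′ : CommutativeRing t′ u′}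
             (hom : Homomorphism T) (hom′ : Homomorphism T′) : Set (c ⊔ t ⊔ u ⊔ t′ ⊔ u′) where
    private
      module T  = CommutativeRing T
      module T′ = CommutativeRing T′
    field
      map   : T.Carrier → T′.Carrier
      map-+ : ∀ x y → map (x T.+ y) T′.≈ map x T′.+ map y
      map-* : ∀ x y → map (x T.* y) T′.≈ map x T′.* map y
      map-ι : ∀ x → map (Homomorphism.ι hom x) T′.≈ Homomorphism.ι hom′ x

    -- Horner schemes involve only sums, products and scalars. With a substitution as the map this
    -- gives composition of substitutions; with the adjunction of a variable it gives the inductive
    -- step of `ev-var-id`.
    map-ev : ∀ {n} (ρ : Fin n → T.Carrier) B f →
             map (Horner.ev T hom ρ B f) T′.≈ Horner.ev T′ hom′ (map ∘ ρ) B f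
    map-ev {zero}  ρ B f = map-ι (f [])
    map-ev {suc n} ρ B f = go B _ _ λ k → map-ev (ρ ∘ suc) B (f ▹ k)
      where
      module C = Convolution T
      module C′ = Convolution T′
      go : ∀ B a b → (∀ k → map (a k) T′.≈ b k) → map (C.horner (ρ zero) B a) T′.≈ C′.horner (map (ρ zero)) B b
      go zero    a b q = q 0
      go (suc B) a b q = T′.trans (map-+ _ _) (T′.+-cong (q 0)
        (T′.trans (map-* _ _) (T′.*-congˡ (go B (a ∘ suc) (b ∘ suc) (q ∘ suc)))))

-- Exponent vectors and substitution.

sum-increment : ∀ {n} (e : Vec ℕ n) i → Vec.sum (Vec.updateAt e i suc) ≡ suc (Vec.sum e)
sum-increment (k ∷ e) zero    = ≡.refl
sum-increment (k ∷ e) (suc i) =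
  ≡.trans (≡.cong (k ℕ.+_) (sum-increment e i)) (ℕₚ.+-suc k (Vec.sum e))

decrement : ∀ {n} (e : Vec ℕ n) i {t} → Vec.lookup e i ≡ suc t →
            ∃ λ e′ → e ≡ Vec.updateAt e′ i suc × Vec.lookup e′ i ≡ t
decrement (_ ∷ e) zero    {t} ≡.refl = t ∷ e , ≡.refl , ≡.refl
decrement (k ∷ e) (suc i)     eq with decrement e i eq
... | e′ , ≡.refl , eq′ = k ∷ e′ , ≡.refl , eq′

increment-injective : ∀ {n} i {e e′ : Vec ℕ n} → Vec.updateAt e i suc ≡ Vec.updateAt e′ i suc → e ≡ e′
increment-injective zero    {k ∷ e} {k′ ∷ e′} eq = ≡.cong₂ _∷_
  (ℕₚ.suc-injective (Vecₚ.∷-injectiveˡ eq)) (Vecₚ.∷-injectiveʳ eq)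
increment-injective (suc i) {k ∷ e} {k′ ∷ e′} eq = ≡.cong₂ _∷_
  (Vecₚ.∷-injectiveˡ eq) (increment-injective i (Vecₚ.∷-injectiveʳ eq))

module Substitution {c r s} (K : HeytingField c r s) where
  open Polynomials K
  open PolynomialRing K
  open Evaluation K
  open F using () renaming (Carrier to 𝕂)
  module FP = RingProperties F.ring

  conv-0ˡ : ∀ {n} {f : Vec ℕ n → 𝕂} g → f ≈ᶜ 0ᶜ → conv f g ≈ᶜ 0ᶜ
  conv-0ˡ {f = f} g f≈0 e = conv-vanish f g e λ a _ _ → inj₁ (f≈0 a)

  conv-head : ∀ {n} (f g : Vec ℕ (suc n) → 𝕂) → (∀ i → f ▹ suc i ≈ᶜ 0ᶜ) →
              ∀ k e → conv f g (k ∷ e) F.≈ conv (f ▹ 0) (g ▹ k) e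
  conv-head f g f≈0 k e = F.trans
    (F.+-congˡ (F.trans
      (FS.sum-cong-≋ {k} λ i → conv-0ˡ (g ▹ (k ∸ suc (toℕ i))) (f≈0 (toℕ i)) e)
      (FS.sum-replicate-zero k)))
    (F.+-identityʳ _)

  conv-var : ∀ {n} (i : Fin n) g e → conv (coeff (var i)) g (Vec.updateAt e i suc) F.≈ g e
  conv-var zero g (k ∷ e) = F.trans
    (F.+-cong (conv-0ˡ (g ▹ suc k) (λ _ → F.refl) e)
              (F.+-cong (CommutativeRing.*-identityˡ (coefficientRing _) (g ▹ k) e) (F.trans
                (FS.sum-cong-≋ {k} λ i → conv-0ˡ (g ▹ (k ∸ suc (toℕ i))) (λ _ → F.refl) e)
                (FS.sum-replicate-zero k))))
    (F.trans (F.+-identityˡ _) (F.+-identityʳ _))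
  conv-var (suc i) g (k ∷ e) = F.trans
    (conv-head (coeff (var (suc i))) g (λ _ _ → F.refl) k (Vec.updateAt e i suc))
    (conv-var i (g ▹ k) e)

  conv-var-0 : ∀ {n} (i : Fin n) g e → Vec.lookup e i ≡ 0 → conv (coeff (var i)) g e F.≈ F.0#
  conv-var-0 zero    g (_ ∷ e) ≡.refl = F.trans (F.+-identityʳ _) (conv-0ˡ (g ▹ 0) (λ _ → F.refl) e)
  conv-var-0 (suc i) g (k ∷ e) eq     = F.trans
    (conv-head (coeff (var (suc i))) g (λ _ _ → F.refl) k e)
    (conv-var-0 i (g ▹ k) e eq)

  opaque
    unfolding _⊞_ 

    constHom : ∀ m → Homomorphism (polyRing m)
    constHom m = record
      { ι      = const
      ; ι-cong = λ x≈y → ⟪ (λ e → F.*-congʳ x≈y) ⟫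
      ; ι-+    = λ x y → ⟪ (λ e → F.distribʳ _ _ _) ⟫
      ; ι-*    = λ x y → ⟪ (λ e → F.sym (begin
          conv (coeff (const x)) (coeff (const y)) e  ≈⟨ conv-*ˡ x 1ᶜ (coeff (const y)) e ⟩
          x F.* conv 1ᶜ (coeff (const y)) e           ≈⟨ F.*-congˡ (C.*-identityˡ (coeff (const y)) e) ⟩
          x F.* (y F.* 1ᶜ e)                          ≈⟨ F.*-assoc _ _ _ ⟨
          x F.* y F.* 1ᶜ e                            ∎)) ⟫
      ; ι-0    = ⟪ (λ e → F.zeroˡ _) ⟫
      ; ι-1    = ⟪ (λ e → F.*-identityˡ _) ⟫
      }
      where
      module C = CommutativeRing (coefficientRing m)
      open SetoidReasoning F.setoid

    X : ∀ {ℓ} → Fin ℓ → Poly ℓ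
    X = var

    infixl 9 _⟦_⟧
    _⟦_⟧ : ∀ {ℓ m} → Poly ℓ → (Fin ℓ → Poly m) → Poly m
    p ⟦ ρ ⟧ = Horner.eval (polyRing _) (constHom _) ρ p

    private module H {m} = Horner (polyRing m) (constHom m)

    ⟦⟧-cong : ∀ {ℓ m} (ρ : Fin ℓ → Poly m) {p q} → p ≃ q → p ⟦ ρ ⟧ ≃ q ⟦ ρ ⟧
    ⟦⟧-cong ρ {p} {q} p≃q = H.eval-cong ρ {p} {q} (at p≃q)

    ⟦⟧-+ : ∀ {ℓ m} (ρ : Fin ℓ → Poly m) p q → (p ⊞ q) ⟦ ρ ⟧ ≃ p ⟦ ρ ⟧ ⊞ q ⟦ ρ ⟧
    ⟦⟧-+ = H.eval-+

    ⟦⟧-* : ∀ {ℓ m} (ρ : Fin ℓ → Poly m) p q → (p ⊠ q) ⟦ ρ ⟧ ≃ p ⟦ ρ ⟧ ⊠ q ⟦ ρ ⟧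
    ⟦⟧-* = H.eval-*

    ⟦⟧-neg : ∀ {ℓ m} (ρ : Fin ℓ → Poly m) p → (⊟ p) ⟦ ρ ⟧ ≃ ⊟ (p ⟦ ρ ⟧)
    ⟦⟧-neg = H.eval-neg

    ⟦⟧-0 : ∀ {ℓ m} (ρ : Fin ℓ → Poly m) → zeroPoly ⟦ ρ ⟧ ≃ zeroPoly
    ⟦⟧-0 = H.eval-0

    ⟦⟧-1 : ∀ {ℓ m} (ρ : Fin ℓ → Poly m) → onePoly ⟦ ρ ⟧ ≃ onePoly
    ⟦⟧-1 = H.eval-1

    ⟦⟧-const : ∀ {ℓ m} (ρ : Fin ℓ → Poly m) x → const x ⟦ ρ ⟧ ≃ const x
    ⟦⟧-const = H.eval-const

    ⟦⟧-X : ∀ {ℓ m} (ρ : Fin ℓ → Poly m) i → X i ⟦ ρ ⟧ ≃ ρ i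
    ⟦⟧-X = H.eval-var

    ⟦⟧-environment : ∀ {ℓ m w} (_~_ : Poly m → Poly m → Set w) →
      (∀ {x y} → x ≃ y → x ~ y) →
      (∀ {x y x′ y′} → x ~ x′ → y ~ y′ → (x ⊞ y) ~ (x′ ⊞ y′)) →
      (∀ {x y x′ y′} → x ~ x′ → y ~ y′ → (x ⊠ y) ~ (x′ ⊠ y′)) →
      {ρ ρ′ : Fin ℓ → Poly m} → (∀ i → ρ i ~ ρ′ i) → ∀ p → (p ⟦ ρ ⟧) ~ (p ⟦ ρ′ ⟧)
    ⟦⟧-environment _~_ ~-≃ ~-+ ~-* ρ~ρ′ p =
      H.ev-environment _~_ ~-≃ ~-+ ~-* ρ~ρ′ (bound p) (coeff p)

    ⟦⟧-∘ : ∀ {ℓ m n} (ρ : Fin ℓ → Poly m) (ρ′ : Fin m → Poly n) p →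
           p ⟦ ρ ⟧ ⟦ ρ′ ⟧ ≃ p ⟦ (λ i → ρ i ⟦ ρ′ ⟧) ⟧
    ⟦⟧-∘ {m = m} {n} ρ ρ′ p = _⟶_.map-ev substitute ρ (bound p) (coeff p)
      where
      substitute : constHom m ⟶ constHom n
      substitute = record
        { map   = _⟦ ρ′ ⟧
        ; map-+ = ⟦⟧-+ ρ′
        ; map-* = ⟦⟧-* ρ′
        ; map-ι = ⟦⟧-const ρ′
        }

    private
      weaken : ∀ {n} → Poly n → Poly (suc n)
      weaken p = record
        { coeff  = λ where
            (zero ∷ e)  → coeff p e
            (suc _ ∷ e) → F.0#
        ; bound  = bound p
        ; vanish = λ where
            (zero ∷ e)  → vanish p e
            (suc _ ∷ e) _ → F.refl
        }

      weakenHom : ∀ n → constHom n ⟶ constHom (suc n)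
      weakenHom n = record
        { map   = weaken
        ; map-+ = λ p q → ⟪ (λ where
            (zero ∷ e)  → F.refl
            (suc _ ∷ e) → F.sym (F.+-identityˡ _)) ⟫
        ; map-* = λ p q → ⟪ (λ where
            (zero ∷ e)  → F.sym (conv-head (coeff (weaken p)) (coeff (weaken q)) (λ _ _ → F.refl) 0 e)
            (suc k ∷ e) → F.sym (F.trans
              (conv-head (coeff (weaken p)) (coeff (weaken q)) (λ _ _ → F.refl) (suc k) e)
              (conv-vanish (coeff p) 0ᶜ e λ _ _ _ → inj₂ F.refl))) ⟫
        ; map-ι = λ x → ⟪ (λ where
            (zero ∷ e)  → F.refl
            (suc _ ∷ e) → F.sym (F.zeroʳ x)) ⟫
        }

      weaken-var : ∀ {n} (i : Fin n) → weaken (var i) ≃ var (suc i)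
      weaken-var i = ⟪ (λ where
        (zero ∷ e)  → F.refl
        (suc _ ∷ e) → F.refl) ⟫

      module Cᵖ {n} = Convolution (polyRing n)

      -- By `w` the `a i` do not involve the first variable, so its powers keep them apart in the
      -- Horner sum.
      horner-coeff : ∀ {n} B a → (∀ i → B ℕ.< i → a i ≃ 0ₚ) → (∀ i k e → coeff (a i) (suc k ∷ e) F.≈ F.0#) →
                     ∀ k e → coeff (Cᵖ.horner {suc n} (var zero) B a) (k ∷ e) F.≈ coeff (a k) (0 ∷ e)
      horner-coeff zero    a v w zero    e = F.refl
      horner-coeff zero    a v w (suc k) e = F.trans (w 0 k e) (F.sym (at (v (suc k) (s≤s z≤n)) (0 ∷ e)))
      horner-coeff (suc B) a v w zero    e = F.trans
        (F.+-congˡ (conv-var-0 zero (coeff (Cᵖ.horner (var zero) B (a ∘ suc))) (0 ∷ e) ≡.refl)) (F.+-identityʳ _)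
      horner-coeff (suc B) a v w (suc k) e = F.trans
        (F.+-cong (w 0 k e) (F.trans
          (conv-var zero (coeff (Cᵖ.horner (var zero) B (a ∘ suc))) (k ∷ e))
          (horner-coeff B (a ∘ suc) (λ i lt → v (suc i) (s≤s lt)) (w ∘ suc) k e)))
        (F.+-identityˡ _)

      -- Evaluating a slice at the later variables is the weakening of its evaluation in n
      -- variables. Hence the outer Horner sum satisfies the hypotheses of `horner-coeff`, and its
      -- slices are known by induction.
      ev-var-id : ∀ {n} B (f : Vec ℕ n → 𝕂) → VanishesBeyond B f → ∀ e → coeff (H.ev var B f) e F.≈ f e
      ev-var-id {zero}  B f v []      = F.*-identityʳ _
      ev-var-id {suc n} B f v (k ∷ e) = F.trans
        (horner-coeff B _ (λ i lt → H.ev-0 (var ∘ suc) B λ e → v (i ∷ e) (ℕₚ.<-≤-trans lt (ℕₚ.m≤m+n i _)))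
          (λ i k e → at (slice i) (suc k ∷ e)) k e)
        (F.trans (at (slice k) (0 ∷ e)) (ev-var-id B (f ▹ k) (λ e lt → v (k ∷ e) (ℕₚ.<-≤-trans lt (ℕₚ.m≤n+m _ k))) e))
        where
        module R = CommutativeRing (polyRing (suc n))
        slice : ∀ i → H.ev (var ∘ suc) B (f ▹ i) ≃ weaken (H.ev var B (f ▹ i))
        slice i = R.sym (R.trans (_⟶_.map-ev (weakenHom n) var B (f ▹ i))
          (H.ev-environment _≃_ (λ x → x) R.+-cong R.*-cong weaken-var B (f ▹ i)))

    ⟦⟧-id : ∀ {ℓ} (p : Poly ℓ) → p ⟦ X ⟧ ≃ p
    ⟦⟧-id p = ⟪ ev-var-id (bound p) (coeff p) (vanish p) ⟫

-- Non-zero-divisors and finite products.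

module NonZeroDivisors {c r} (R : CommutativeRing c r) where
  open CommutativeRing R hiding (zero)
  open RingProperties ring
  open CommutativeSemigroupProperties *-commutativeSemigroup using (x∙yz≈y∙xz)

  -- Only products of differences x_a - x_b are ever cancelled. Cancellability of each factor passes
  -- to the product without any test for zero.
  NonZeroDivisor : Carrier → Set (c ⊔ r)
  NonZeroDivisor p = ∀ q → p * q ≈ 0# → q ≈ 0#

  nzd-≈ : ∀ {p q} → p ≈ q → NonZeroDivisor p → NonZeroDivisor q
  nzd-≈ p≈q nzd u qu≈0 = nzd u (trans (*-congʳ p≈q) qu≈0)

  nzd-1 : NonZeroDivisor 1#
  nzd-1 q eq = trans (sym (*-identityˡ q)) eq

  nzd-* : ∀ {p q} → NonZeroDivisor p → NonZeroDivisor q → NonZeroDivisor (p * q)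
  nzd-* nzd-p nzd-q u eq = nzd-q u (nzd-p _ (trans (sym (*-assoc _ _ _)) eq))

  nzd-cancelˡ : ∀ {p} → NonZeroDivisor p → ∀ {q u} → p * q ≈ p * u → q ≈ u
  nzd-cancelˡ {p} nzd {q} {u} eq = x-y≈0⇒x≈y q u (nzd (q - u)
    (trans (x[y-z]≈xy-xz p q u) (x≈y⇒x-y≈0 eq)))
    where open GroupProperties +-group using ()
            renaming (x∙y⁻¹≈ε⇒x≈y to x-y≈0⇒x≈y; x≈y⇒x∙y⁻¹≈ε to x≈y⇒x-y≈0)

  module _ {a} {A : Set a} where
    ∏ : List A → (A → Carrier) → Carrier
    ∏ xs f = List.foldr (λ x p → f x * p) 1# xs

    nzd-∏ : ∀ {f} xs → (∀ x → x ∈ xs → NonZeroDivisor (f x)) → NonZeroDivisor (∏ xs f)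
    nzd-∏ []       nzd = nzd-1
    nzd-∏ (x ∷ xs) nzd = nzd-* (nzd x (here ≡.refl)) (nzd-∏ xs λ y y∈xs → nzd y (there y∈xs))

    ∏-cong : ∀ {f g} xs → (∀ x → x ∈ xs → f x ≈ g x) → ∏ xs f ≈ ∏ xs g
    ∏-cong []       p = refl
    ∏-cong (x ∷ xs) p = *-cong (p x (here ≡.refl)) (∏-cong xs λ y y∈xs → p y (there y∈xs))

    ∏-++ : ∀ f xs ys → ∏ (xs ++ ys) f ≈ ∏ xs f * ∏ ys f
    ∏-++ f []       ys = sym (*-identityˡ _)
    ∏-++ f (x ∷ xs) ys = trans (*-congˡ (∏-++ f xs ys)) (sym (*-assoc _ _ _))

    ∏-↭ : ∀ f {xs ys} → xs ↭ ys → ∏ xs f ≈ ∏ ys f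
    ∏-↭ f Perm.refl         = refl
    ∏-↭ f (Perm.prep x p)   = *-congˡ (∏-↭ f p)
    ∏-↭ f (Perm.swap x y p) = trans (*-congˡ (*-congˡ (∏-↭ f p))) (x∙yz≈y∙xz _ _ _)
    ∏-↭ f (Perm.trans p q)  = trans (∏-↭ f p) (∏-↭ f q)

  ∏-map : ∀ {a b} {A : Set a} {B : Set b} (g : A → B) (f : B → Carrier) xs →
          ∏ (List.map g xs) f ≈ ∏ xs (f ∘ g)
  ∏-map g f []       = refl
  ∏-map g f (x ∷ xs) = *-congˡ (∏-map g f xs)

-- Divisibility by differences of variables.

merge : ∀ {ℓ} → Fin ℓ → Fin ℓ → Fin ℓ → Fin ℓ
merge a b i = if does (i Finₚ.≟ a) then b else i

merge-hit : ∀ {ℓ} (a b : Fin ℓ) → merge a b a ≡ b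
merge-hit a b with a Finₚ.≟ a
... | yes _   = ≡.refl
... | no  a≢a = contradiction ≡.refl a≢a

merge-miss : ∀ {ℓ} {a b i : Fin ℓ} → i ≢ a → merge a b i ≡ i
merge-miss {a = a} {i = i} i≢a with i Finₚ.≟ a
... | yes i≡a = contradiction i≡a i≢a
... | no  _   = ≡.refl

module Differences {c r s} (K : HeytingField c r s) (ℓ : ℕ) where
  open Polynomials K
  open PolynomialRing K
  open Evaluation K
  open Substitution K
  open CommutativeRing (polyRing ℓ) hiding (zero)
  open NonZeroDivisors (polyRing ℓ)
  open RingProperties ring using ([y-z]x≈yx-zx)

  private S = Poly ℓ

  opaque
    unfolding _⊞_ X

    coeff-X* : ∀ i (p : S) e → coeff (X i * p) (Vec.updateAt e i suc) F.≈ coeff p e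
    coeff-X* i p e = conv-var i (coeff p) e

    coeff-X*-0 : ∀ i (p : S) e → Vec.lookup e i ≡ 0 → coeff (X i * p) e F.≈ F.0#
    coeff-X*-0 i p e = conv-var-0 i (coeff p) e

    coeff-- : ∀ (p q : S) e → coeff (p - q) e F.≈ coeff p e F.- coeff q e
    coeff-- p q e = F.refl

    coeff-+ : ∀ (p q : S) e → coeff (p + q) e F.≈ coeff p e F.+ coeff q e
    coeff-+ p q e = F.refl

    coeff-0 : ∀ e → coeff (zeroPoly {ℓ}) e F.≈ F.0#
    coeff-0 e = F.refl

  diff : Fin ℓ → Fin ℓ → S
  diff a b = X a - X b

  diff-⟦⟧ : ∀ (ρ : Fin ℓ → S) a b → diff a b ⟦ ρ ⟧ ≈ ρ a - ρ b
  diff-⟦⟧ ρ a b = trans (⟦⟧-+ ρ (X a) (- X b))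
    (+-cong (⟦⟧-X ρ a) (trans (⟦⟧-neg ρ (X b)) (-‿cong (⟦⟧-X ρ b))))

  diff-self : ∀ a → diff a a ≈ 0#
  diff-self a = -‿inverseʳ (X a)

  diff-antisym : ∀ a b → diff a b ≈ - diff b a
  diff-antisym a b = sym (⁻¹-anti-homo‿- (X b) (X a))
    where open AbelianGroupProperties +-abelianGroup using (⁻¹-anti-homo‿-)

  -- The coefficient equations telescope along the exponents e, e + a − b, e + 2a − 2b, … .
  diff-cancel : ∀ {a b} → a ≢ b → ∀ p m →
                (∀ e → Vec.sum e ≡ suc m → coeff (diff a b * p) e F.≈ F.0#) →
                ∀ e → Vec.sum e ≡ m → coeff p e F.≈ F.0#
  diff-cancel {a} {b} a≢b p m z e = go (Vec.lookup e b) e ≡.refl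
    where
    open SetoidReasoning F.setoid
    open GroupProperties F.+-group using (x∙y⁻¹≈ε⇒x≈y)

    step : ∀ e → Vec.sum e ≡ m → coeff p e F.≈ coeff (X b * p) (Vec.updateAt e a suc)
    step e Σe≡m = begin
      coeff p e        ≈⟨ coeff-X* a p e ⟨
      coeff (X a * p) (Vec.updateAt e a suc)        ≈⟨ x∙y⁻¹≈ε⇒x≈y _ _ (begin
        coeff (X a * p) (Vec.updateAt e a suc) F.- coeff (X b * p) (Vec.updateAt e a suc)
          ≈⟨ coeff-- (X a * p) (X b * p) (Vec.updateAt e a suc) ⟨
        coeff (X a * p - X b * p) (Vec.updateAt e a suc)
          ≈⟨ at ([y-z]x≈yx-zx p (X a) (X b)) (Vec.updateAt e a suc) ⟨
        coeff (diff a b * p) (Vec.updateAt e a suc)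
          ≈⟨ z (Vec.updateAt e a suc) (≡.trans (sum-increment e a) (≡.cong suc Σe≡m)) ⟩
        F.0# ∎) ⟩
      coeff (X b * p) (Vec.updateAt e a suc)  ∎

    go : ∀ t e → Vec.lookup e b ≡ t → Vec.sum e ≡ m → coeff p e F.≈ F.0#
    go zero e e[b]≡t Σe≡m = F.trans (step e Σe≡m) (coeff-X*-0 b p (Vec.updateAt e a suc)
      (≡.trans (Vecₚ.lookup∘updateAt′ b a (a≢b ∘ ≡.sym) e) e[b]≡t))
    go (suc t) e e[b]≡t Σe≡m with decrement e b e[b]≡t
    ... | e′ , ≡.refl , e′[b]≡t = begin
      coeff p (Vec.updateAt e′ b suc)
        ≈⟨ step (Vec.updateAt e′ b suc) Σe≡m ⟩
      coeff (X b * p) (Vec.updateAt (Vec.updateAt e′ b suc) a suc)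
        ≡⟨ ≡.cong (coeff (X b * p)) (Vecₚ.updateAt-commutes a b a≢b e′) ⟩
      coeff (X b * p) (Vec.updateAt (Vec.updateAt e′ a suc) b suc)
        ≈⟨ coeff-X* b p (Vec.updateAt e′ a suc) ⟩
      coeff p (Vec.updateAt e′ a suc)
        ≈⟨ go t (Vec.updateAt e′ a suc)
             (≡.trans (Vecₚ.lookup∘updateAt′ b a (a≢b ∘ ≡.sym) e′) e′[b]≡t)
             (≡.trans (sum-increment e′ a) (≡.trans (≡.sym (sum-increment e′ b)) Σe≡m)) ⟩
      F.0# ∎

  nzd-diff : ∀ {a b} → a ≢ b → NonZeroDivisor (diff a b)
  nzd-diff a≢b p eq = ⟪ (λ e → F.trans
    (diff-cancel a≢b p (Vec.sum e) (λ e′ _ → F.trans (at eq e′) (coeff-0 e′)) e ≡.refl)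
    (F.sym (coeff-0 e))) ⟫

  ⟦⟧-∏ : ∀ {A : Set} (ρ : Fin ℓ → S) (f : A → S) xs → ∏ xs f ⟦ ρ ⟧ ≈ ∏ xs (λ x → f x ⟦ ρ ⟧)
  ⟦⟧-∏ ρ f []       = ⟦⟧-1 ρ
  ⟦⟧-∏ ρ f (x ∷ xs) = trans (⟦⟧-* ρ (f x) (∏ xs f)) (*-congˡ (⟦⟧-∏ ρ f xs))

  ⟦⟧-ext : ∀ {ρ ρ′ : Fin ℓ → S} → (∀ i → ρ i ≈ ρ′ i) → ∀ (p : S) → p ⟦ ρ ⟧ ≈ p ⟦ ρ′ ⟧
  ⟦⟧-ext = ⟦⟧-environment _≈_ id +-cong *-cong

  -- Restriction to the hyperplane x_a = x_b. The result stays in the same polynomial ring, so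
  -- restrictions can be composed and compared.
  identify : Fin ℓ → Fin ℓ → S → S
  identify a b p = p ⟦ X ∘ merge a b ⟧

  -- Division by x_a - x_b with remainder. Each variable is congruent to its image modulo
  -- `diff a b`, and the congruence extends to values by `⟦⟧-environment`; `⟦⟧-id` recovers `p` from
  -- its value at the variables.
  identify-divides : ∀ a b p → ∃ λ q → p ≈ identify a b p + diff a b * q
  identify-divides a b p =
    let q , eq = ⟦⟧-environment _~_ ~-≈ ~-+ ~-* {X} {X ∘ merge a b} X~ p
    in  q , trans (sym (⟦⟧-id p)) eq
    where
    _~_ : S → S → Set (c ⊔ r)
    x ~ y = ∃ λ q → x ≈ y + diff a b * q

    open SetoidReasoning setoid
    δ = diff a b

    ~-≈ : ∀ {x y} → x ≈ y → x ~ y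
    ~-≈ {x} {y} x≈y = 0# , trans x≈y (trans (sym (+-identityʳ y)) (+-congˡ (sym (zeroʳ δ))))

    ~-+ : ∀ {x y x′ y′} → x ~ x′ → y ~ y′ → (x + y) ~ (x′ + y′)
    ~-+ {x} {y} {x′} {y′} (q , p) (q′ , p′) = q + q′ , (begin
      x + y                             ≈⟨ +-cong p p′ ⟩
      (x′ + δ * q) + (y′ + δ * q′)      ≈⟨ interchange _ _ _ _ ⟩
      (x′ + y′) + (δ * q + δ * q′)      ≈⟨ +-congˡ (distribˡ δ q q′) ⟨
      (x′ + y′) + δ * (q + q′)          ∎)
      where open CommutativeSemigroupProperties +-commutativeSemigroup using (interchange)

    ~-* : ∀ {x y x′ y′} → x ~ x′ → y ~ y′ → (x * y) ~ (x′ * y′)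
    -- The quotient comes from x y - x′ y′ = (x - x′) y + x′ (y - y′).
    ~-* {x} {y} {x′} {y′} (q , p) (q′ , p′) = q * y + x′ * q′ , (begin
      x * y                                    ≈⟨ *-congʳ p ⟩
      (x′ + δ * q) * y                         ≈⟨ distribʳ y x′ (δ * q) ⟩
      x′ * y + δ * q * y                       ≈⟨ +-cong (*-congˡ p′) (*-assoc δ q y) ⟩
      x′ * (y′ + δ * q′) + δ * (q * y)         ≈⟨ +-congʳ (distribˡ x′ y′ (δ * q′)) ⟩
      x′ * y′ + x′ * (δ * q′) + δ * (q * y)    ≈⟨ +-congʳ (+-congˡ (x∙yz≈y∙xz x′ δ q′)) ⟩
      x′ * y′ + δ * (x′ * q′) + δ * (q * y)    ≈⟨ +-assoc _ _ _ ⟩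
      x′ * y′ + (δ * (x′ * q′) + δ * (q * y))  ≈⟨ +-congˡ (+-comm _ _) ⟩
      x′ * y′ + (δ * (q * y) + δ * (x′ * q′))  ≈⟨ +-congˡ (distribˡ δ (q * y) (x′ * q′)) ⟨
      x′ * y′ + δ * (q * y + x′ * q′)          ∎)
      where open CommutativeSemigroupProperties *-commutativeSemigroup using (x∙yz≈y∙xz)

    X~ : ∀ i → X i ~ X (merge a b i)
    X~ i with i Finₚ.≟ a
    ... | no  _      = ~-≈ refl
    ... | yes ≡.refl = 1# , (begin
      X a                     ≈⟨ +-identityʳ _ ⟨
      X a + 0#                ≈⟨ +-congˡ (-‿inverseʳ (X b)) ⟨
      X a + (X b - X b)       ≈⟨ +-assoc _ _ _ ⟨
      X a + X b - X b         ≈⟨ +-congʳ (+-comm _ _) ⟩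
      X b + X a - X b         ≈⟨ +-assoc _ _ _ ⟩
      X b + diff a b          ≈⟨ +-congˡ (*-identityʳ _) ⟨
      X b + diff a b * 1#     ∎)

  identify-0-divides : ∀ {a b p} → identify a b p ≈ 0# → ∃ λ q → p ≈ diff a b * q
  identify-0-divides {a} {b} {p} eq with identify-divides a b p
  ... | q , p≈ = q , trans p≈ (trans (+-congʳ eq) (+-identityˡ _))

  diff-rename : ∀ (t : Fin ℓ → Fin ℓ) a b → diff a b ⟦ X ∘ t ⟧ ≈ diff (t a) (t b)
  diff-rename t = diff-⟦⟧ (X ∘ t)

  identify-diff : ∀ a b → identify a b (diff a b) ≈ 0#
  identify-diff a b = trans (diff-rename (merge a b) a b)
    (≡.subst₂ (λ i j → diff i j ≈ 0#) (≡.sym (merge-hit a b)) (≡.sym merge-b) (diff-self b))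
    where
    merge-b : merge a b b ≡ b
    merge-b with b Finₚ.≟ a
    ... | yes _ = ≡.refl
    ... | no  _ = ≡.refl

  identify-multiple : ∀ {a b p q} → p ≈ diff a b * q → identify a b p ≈ 0#
  identify-multiple {a} {b} {p} {q} eq = begin
    identify a b p                                  ≈⟨ ⟦⟧-cong (X ∘ merge a b) eq ⟩
    identify a b (diff a b * q)                     ≈⟨ ⟦⟧-* (X ∘ merge a b) (diff a b) q ⟩
    identify a b (diff a b) * identify a b q        ≈⟨ *-congʳ (identify-diff a b) ⟩
    0# * identify a b q                             ≈⟨ zeroˡ _ ⟩
    0#                                              ∎
    where open SetoidReasoning setoid

  difference : Fin ℓ × Fin ℓ → S
  difference (a , b) = diff a b

  -- x_a - x_b is not identically zero on x_c = x_d. Its restriction there is then again a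
  -- difference of two distinct variables, hence a non-zero-divisor.
  Independent : Fin ℓ × Fin ℓ → Fin ℓ × Fin ℓ → Set
  Independent (a , b) (c , d) = merge c d a ≢ merge c d b

  nzd-difference-rename : ∀ (t : Fin ℓ → Fin ℓ) L → (∀ a b → (a , b) ∈ L → t a ≢ t b) →
                          NonZeroDivisor (∏ L difference ⟦ X ∘ t ⟧)
  nzd-difference-rename t L sep = nzd-≈ (sym (⟦⟧-∏ (X ∘ t) difference L))
    (nzd-∏ L λ (a , b) ab∈L → nzd-≈ (sym (diff-rename t a b)) (nzd-diff (sep a b ab∈L)))

  -- This takes the place of unique factorisation. After division by `diff a b` the quotient still
  -- vanishes on the other hyperplanes, since `diff a b` restricts to a non-zero-divisor on each of
  -- them.
  product-divides : ∀ L p → AllPairs Independent L →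
                    (∀ a b → (a , b) ∈ L → identify a b p ≈ 0#) → ∃ λ q → p ≈ ∏ L difference * q
  product-divides []            p []          z = p , sym (*-identityˡ p)
  product-divides ((a , b) ∷ L) p (ind ∷ inds) z with identify-0-divides (z a b (here ≡.refl))
  ... | q , p≈δq with product-divides L q inds (λ i j ij∈L →
                        nzd-≈ (sym (diff-rename (merge i j) a b)) (nzd-diff (All.lookup ind ij∈L))
                          (identify i j q)
                          (trans (sym (⟦⟧-* (X ∘ merge i j) (diff a b) q))
                                 (trans (⟦⟧-cong (X ∘ merge i j) (sym p≈δq)) (z i j (there ij∈L)))))
  ... | u , q≈Πu = u , trans p≈δq (trans (*-congˡ q≈Πu) (sym (*-assoc _ _ _)))

-- Homogeneous polynomials.

module Homogeneity {c r s} (K : HeytingField c r s) where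
  open Polynomials K
  open PolynomialRing K
  open Evaluation K
  open Substitution K
  open F using () renaming (Carrier to 𝕂)

  HomogeneousCoefficients : ∀ {n} → (Vec ℕ n → 𝕂) → ℤ → Set r
  HomogeneousCoefficients f d = ∀ e → + Vec.sum e ≢ d → f e F.≈ F.0#

  homogeneous-≃ : ∀ {ℓ} {p q : Poly ℓ} {d} → p ≃ q → IsHomogeneous p d → IsHomogeneous q d
  homogeneous-≃ p≃q h e ne = F.trans (F.sym (at p≃q e)) (h e ne)

  module _ {ℓ : ℕ} where
    private
      S = Poly ℓ
      module C = Convolution (polyRing ℓ)

    opaque
      unfolding _⊞_ X _⟦_⟧

      homogeneous-0 : ∀ d → IsHomogeneous (zeroPoly {ℓ}) d
      homogeneous-0 d e ne = F.refl

      homogeneous-+ : ∀ {p q : S} {d} → IsHomogeneous p d → IsHomogeneous q d → IsHomogeneous (p ⊞ q) d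
      homogeneous-+ hp hq e ne = F.trans (F.+-cong (hp e ne) (hq e ne)) (F.+-identityˡ _)

      homogeneous-neg : ∀ {p : S} {d} → IsHomogeneous p d → IsHomogeneous (⊟ p) d
      homogeneous-neg hp e ne = F.trans (F.-‿cong (hp e ne)) FP.-0#≈0#

      homogeneous-* : ∀ {p q : S} {d d′} → IsHomogeneous p d → IsHomogeneous q d′ →
                      IsHomogeneous (p ⊠ q) (d ℤ.+ d′)
      homogeneous-* {p} {q} {d} {d′} hp hq e ne = conv-vanish (coeff p) (coeff q) e split
        where
        split : ∀ a b → Vec.sum a ℕ.+ Vec.sum b ≡ Vec.sum e → coeff p a F.≈ F.0# ⊎ coeff q b F.≈ F.0#
        split a b eq with + Vec.sum a ℤₚ.≟ d | + Vec.sum b ℤₚ.≟ d′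
        ... | no ≢d      | _          = inj₁ (hp a ≢d)
        ... | yes _      | no ≢d′     = inj₂ (hq b ≢d′)
        ... | yes ≡.refl | yes ≡.refl = contradiction (≡.cong +_ (≡.sym eq)) ne

      homogeneous-monomial : ∀ (m : Vec ℕ ℓ) → IsHomogeneous (monomial m) (+ Vec.sum m)
      homogeneous-monomial m e ne with Vecₚ.≡-dec ℕₚ._≟_ m e
      ... | no  _      = F.refl
      ... | yes ≡.refl = contradiction ≡.refl ne

      homogeneous-X : ∀ i → IsHomogeneous (X {ℓ} i) (+ 1)
      homogeneous-X i = ≡.subst (λ d → IsHomogeneous (var i) (+ d)) (sum-unit i)
        (homogeneous-monomial (Vec.replicate ℓ 0 Vec.[ i ]≔ 1))
        where
        sum-zeros : ∀ n → Vec.sum (Vec.replicate n 0) ≡ 0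
        sum-zeros zero    = ≡.refl
        sum-zeros (suc n) = sum-zeros n

        sum-unit : ∀ {n} (i : Fin n) → Vec.sum (Vec.replicate n 0 Vec.[ i ]≔ 1) ≡ 1
        sum-unit {suc n} zero    = ≡.cong suc (sum-zeros n)
        sum-unit {suc n} (suc i) = sum-unit i

      -- The hypothesis is homogeneity of a coefficient function in no variables, which is the form
      -- met at the base of `homogeneous-ev`.
      homogeneous-const : ∀ {x d} → (+ 0 ≢ d → x F.≈ F.0#) → IsHomogeneous (const {ℓ} x) d
      homogeneous-const {x} {d} h e ne with + 0 ℤₚ.≟ d
      ... | no  0≢d    = F.trans (F.*-congʳ (h 0≢d)) (F.zeroˡ _)
      ... | yes ≡.refl = F.trans (F.*-congˡ (homogeneous-monomial (Vec.replicate ℓ 0) e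
        λ eq → ne (≡.trans eq (≡.cong +_ (sum-zeros ℓ))))) (F.zeroʳ x)
        where
        sum-zeros : ∀ n → Vec.sum (Vec.replicate n 0) ≡ 0
        sum-zeros zero    = ≡.refl
        sum-zeros (suc n) = sum-zeros n

      homogeneous-horner : ∀ {x : S} → IsHomogeneous x (+ 1) → ∀ B {a d} →
                           (∀ k → IsHomogeneous (a k) (d ℤ.- + k)) → IsHomogeneous (C.horner x B a) d
      homogeneous-horner hx zero {a} {d} ha = ≡.subst (IsHomogeneous (a 0)) (ℤₚ.+-identityʳ d) (ha 0)
      homogeneous-horner {x} hx (suc B) {a} {d} ha = homogeneous-+ {a 0} {x ⊠ C.horner x B (a ∘ suc)}
        (≡.subst (IsHomogeneous (a 0)) (ℤₚ.+-identityʳ d) (ha 0))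
        (≡.subst (IsHomogeneous (x ⊠ C.horner x B (a ∘ suc))) 1+[d-1]≡d
          (homogeneous-* {x} {C.horner x B (a ∘ suc)} {+ 1} {d ℤ.- + 1} hx (homogeneous-horner hx B {a ∘ suc} λ k →
            ≡.subst (IsHomogeneous (a (suc k))) (shift k) (ha (suc k)))))
        where
        1+[d-1]≡d : + 1 ℤ.+ (d ℤ.- + 1) ≡ d
        1+[d-1]≡d = ≡.trans (ℤₚ.+-comm (+ 1) (d ℤ.- + 1)) (≡.trans (ℤₚ.+-assoc d (ℤ.- + 1) (+ 1)) (ℤₚ.+-identityʳ d))

        shift : ∀ k → d ℤ.- + suc k ≡ d ℤ.- + 1 ℤ.- + k
        shift k = ≡.sym (≡.trans (ℤₚ.+-assoc d (ℤ.- + 1) (ℤ.- + k)) (≡.cong (λ z → d ℤ.+ z)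
          (≡.sym (ℤₚ.neg-distrib-+ (+ 1) (+ k)))))

      private module H = Horner (polyRing ℓ) (constHom ℓ)

      homogeneous-ev : ∀ {n} {ρ : Fin n → S} → (∀ i → IsHomogeneous (ρ i) (+ 1)) →
                       ∀ B {f : Vec ℕ n → 𝕂} {d} → HomogeneousCoefficients f d →
                       IsHomogeneous (H.ev ρ B f) d
      homogeneous-ev {zero}  hρ B {f} {d} hf = homogeneous-const {d = d} (hf [])
      homogeneous-ev {suc n} hρ B {f} {d} hf = homogeneous-horner (hρ zero) B λ k →
        homogeneous-ev (hρ ∘ suc) B λ e ne → hf (k ∷ e) λ eq → ne (lower k (Vec.sum e) eq)
        where
        lower : ∀ k m → + (k ℕ.+ m) ≡ d → + m ≡ d ℤ.- + k
        lower k m ≡.refl = ≡.sym (begin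
          + k ℤ.+ + m ℤ.- + k      ≡⟨ ≡.cong (ℤ._- + k) (ℤₚ.+-comm (+ k) (+ m)) ⟩
          + m ℤ.+ + k ℤ.- + k      ≡⟨ ℤₚ.+-assoc (+ m) (+ k) (ℤ.- + k) ⟩
          + m ℤ.+ (+ k ℤ.- + k)    ≡⟨ ≡.cong (λ z → + m ℤ.+ z) (ℤₚ.+-inverseʳ (+ k)) ⟩
          + m ℤ.+ + 0              ≡⟨ ℤₚ.+-identityʳ (+ m) ⟩
          + m                      ∎)
          where open ≡.≡-Reasoning

      homogeneous-⟦⟧ : ∀ {n} {ρ : Fin n → S} → (∀ i → IsHomogeneous (ρ i) (+ 1)) →
                       ∀ {p d} → IsHomogeneous p d → IsHomogeneous (p ⟦ ρ ⟧) d
      homogeneous-⟦⟧ hρ {p} hp = homogeneous-ev hρ (bound p) hp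

-- Coordinates adapted to a vertex, and linear combinations of monomials.

module Coordinates {c r s} (K : HeytingField c r s) (ℓ : ℕ) where
  open Polynomials K
  open PolynomialRing K
  open Evaluation K
  open Substitution K
  open F using () renaming (Carrier to 𝕂)
  open CommutativeRing (polyRing ℓ) hiding (zero)
  open NonZeroDivisors (polyRing ℓ)
  open Differences K ℓ
  open Homogeneity K
  open Sum (polyRing ℓ) using (sum; sum-cong-≋; *-distribˡ-sum)

  private S = Poly ℓ

  homogeneous-diff : ∀ a b → IsHomogeneous (diff a b) (+ 1)
  homogeneous-diff a b = homogeneous-+ {p = X a} {⊟ X b} (homogeneous-X a)
    (homogeneous-neg {p = X b} (homogeneous-X b))

  homogeneous-difference : ∀ L → IsHomogeneous (∏ L difference) (+ List.length L)
  homogeneous-difference []            = homogeneous-≃ (trans (⟦⟧-const X F.1#) one) (homogeneous-⟦⟧ homogeneous-X {const F.1#} (homogeneous-const λ 0≢0 → contradiction ≡.refl 0≢0))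
    where
    opaque
      unfolding _⊞_ constHom
      one : const F.1# ≃ 1#
      one = Homomorphism.ι-1 (constHom ℓ)
  homogeneous-difference ((a , b) ∷ L) =
    homogeneous-* {p = diff a b} {∏ L difference} (homogeneous-diff a b) (homogeneous-difference L)

  -- `diff-cancel` works in one degree at a time, so the vanishing of the product outside degree 1 +
  -- d passes to `p` outside degree d.
  homogeneous-diff-cancel : ∀ {a b} → a ≢ b → ∀ {p d} →
                            IsHomogeneous (diff a b * p) (+ 1 ℤ.+ d) → IsHomogeneous p d
  homogeneous-diff-cancel a≢b {p} {d} h e ne = diff-cancel a≢b p (Vec.sum e)
    (λ e′ eq → h e′ λ eq′ → ne (cancel (≡.trans (≡.cong +_ (≡.sym eq)) eq′))) e ≡.refl
    where
    cancel : ∀ {x y} → + 1 ℤ.+ x ≡ + 1 ℤ.+ y → x ≡ y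
    cancel {x} {y} eq = ≡.trans (≡.sym (undo x)) (≡.trans (≡.cong (λ z → ℤ.- + 1 ℤ.+ z) eq) (undo y))
      where
      undo : ∀ z → ℤ.- + 1 ℤ.+ (+ 1 ℤ.+ z) ≡ z
      undo z = ≡.trans (≡.sym (ℤₚ.+-assoc (ℤ.- + 1) (+ 1) z)) (ℤₚ.+-identityˡ z)

  homogeneous-∏-cancel : ∀ L → (∀ a b → (a , b) ∈ L → a ≢ b) → ∀ {p d} →
                         IsHomogeneous (∏ L difference * p) (+ List.length L ℤ.+ d) → IsHomogeneous p d
  homogeneous-∏-cancel []            sep {p} {d} h =
    homogeneous-≃ (*-identityˡ p) (≡.subst (IsHomogeneous (1# * p)) (ℤₚ.+-identityˡ d) h)
  homogeneous-∏-cancel ((a , b) ∷ L) sep {p} {d} h = homogeneous-∏-cancel L (λ i j → sep i j ∘ there) {p}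
    (homogeneous-diff-cancel (sep a b (here ≡.refl)) {∏ L difference * p}
      (homogeneous-≃ (*-assoc (diff a b) (∏ L difference) p)
        (≡.subst (IsHomogeneous (diff a b * ∏ L difference * p)) (ℤₚ.+-assoc (+ 1) (+ List.length L) d) h)))

  -- The change of coordinates x_v ↦ x_v, x_j ↦ u_j = x_v - x_j. It is an involution, so one
  -- substitution passes to the new coordinates and back.
  reflection : Fin ℓ → Fin ℓ → S
  reflection v j = if does (j Finₚ.≟ v) then X v else diff v j

  reflect : Fin ℓ → S → S
  reflect v p = p ⟦ reflection v ⟧

  reflection-self : ∀ v → reflection v v ≡ X v
  reflection-self v with v Finₚ.≟ v
  ... | yes _   = ≡.refl
  ... | no  v≢v = contradiction ≡.refl v≢v

  reflection-other : ∀ {v j} → j ≢ v → reflection v j ≡ diff v j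
  reflection-other {v} {j} j≢v with j Finₚ.≟ v
  ... | yes j≡v = contradiction j≡v j≢v
  ... | no  _   = ≡.refl

  reflect-diff : ∀ {v j} → j ≢ v → reflect v (diff v j) ≈ X j
  reflect-diff {v} {j} j≢v = begin
    reflect v (diff v j)                    ≈⟨ diff-⟦⟧ (reflection v) v j ⟩
    reflection v v - reflection v j         ≡⟨ ≡.cong₂ _-_ (reflection-self v) (reflection-other j≢v) ⟩
    X v - diff v j                          ≈⟨ +-congˡ (⁻¹-anti-homo‿- (X v) (X j)) ⟩
    X v + (X j - X v)                       ≈⟨ +-assoc _ _ _ ⟨
    X v + X j - X v                         ≈⟨ xyx⁻¹≈y (X v) (X j) ⟩
    X j                                     ∎
    where
    open SetoidReasoning setoid
    open AbelianGroupProperties +-abelianGroup using (⁻¹-anti-homo‿-; xyx⁻¹≈y)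

  reflect-X : ∀ {v j} → j ≢ v → reflect v (X j) ≈ diff v j
  reflect-X {v} {j} j≢v = trans (⟦⟧-X (reflection v) j) (reflexive (reflection-other j≢v))

  reflect-reflect : ∀ v p → reflect v (reflect v p) ≈ p
  reflect-reflect v p = trans (⟦⟧-∘ (reflection v) (reflection v) p) (trans (⟦⟧-ext twice p) (⟦⟧-id p))
    where
    twice : ∀ i → reflection v i ⟦ reflection v ⟧ ≈ X i
    twice i with i Finₚ.≟ v
    ... | yes ≡.refl = trans (⟦⟧-X (reflection v) v) (reflexive (reflection-self v))
    ... | no  i≢v    = reflect-diff i≢v

  homogeneous-reflect : ∀ v {p d} → IsHomogeneous p d → IsHomogeneous (reflect v p) d
  homogeneous-reflect v = homogeneous-⟦⟧ hom
    where
    hom : ∀ i → IsHomogeneous (reflection v i) (+ 1)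
    hom i with i Finₚ.≟ v
    ... | yes _ = homogeneous-X v
    ... | no  _ = homogeneous-diff v i

  opaque
    X^_ : Vec ℕ ℓ → S
    X^_ = monomial

    coeff-X^-≡ : ∀ m → coeff (X^ m) m F.≈ F.1#
    coeff-X^-≡ m with Vecₚ.≡-dec ℕₚ._≟_ m m
    ... | yes _   = F.refl
    ... | no  m≢m = contradiction ≡.refl m≢m

    coeff-X^-≢ : ∀ {m e} → m ≢ e → coeff (X^ m) e F.≈ F.0#
    coeff-X^-≢ {m} {e} m≢e with Vecₚ.≡-dec ℕₚ._≟_ m e
    ... | yes m≡e = contradiction m≡e m≢e
    ... | no  _   = F.refl

    homogeneous-X^ : ∀ m → IsHomogeneous (X^ m) (+ Vec.sum m)
    homogeneous-X^ = homogeneous-monomial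

  X*X^ : ∀ i m → X i * X^ m ≈ X^ (Vec.updateAt m i suc)
  X*X^ i m = ⟪ coefficient ⟫
    where
    coefficient : ∀ e → coeff (X i * X^ m) e F.≈ coeff (X^ (Vec.updateAt m i suc)) e
    coefficient e with Vec.lookup e i in eq
    ... | zero  = F.trans (coeff-X*-0 i (X^ m) e eq) (F.sym (coeff-X^-≢ λ { ≡.refl →
            case ≡.trans (≡.sym (Vecₚ.lookup∘updateAt i m)) eq of λ () }))
    ... | suc t with decrement e i eq
    ...   | e′ , ≡.refl , _ = F.trans (coeff-X* i (X^ m) e′) (compare (Vecₚ.≡-dec ℕₚ._≟_ m e′))
      where
      compare : Dec (m ≡ e′) → coeff (X^ m) e′ F.≈ coeff (X^ (Vec.updateAt m i suc)) (Vec.updateAt e′ i suc)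
      compare (yes ≡.refl) = F.trans (coeff-X^-≡ m) (F.sym (coeff-X^-≡ (Vec.updateAt m i suc)))
      compare (no m≢e′)    = F.trans (coeff-X^-≢ m≢e′) (F.sym (coeff-X^-≢ (m≢e′ ∘ increment-injective i)))

  combination : ∀ {n} → (Fin n → 𝕂) → (Fin n → S) → S
  combination x p = sum λ i → const (x i) * p i

  combination-cong : ∀ {n} (x : Fin n → 𝕂) {p q : Fin n → S} → (∀ i → p i ≈ q i) → combination x p ≈ combination x q
  combination-cong {n} x p≈q = sum-cong-≋ {n} λ i → *-congˡ (p≈q i)

  combination-⟦⟧ : ∀ {n} (ρ : Fin ℓ → S) (x : Fin n → 𝕂) p →
                   combination x p ⟦ ρ ⟧ ≈ combination x (λ i → p i ⟦ ρ ⟧)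
  combination-⟦⟧ {zero}  ρ x p = ⟦⟧-0 ρ
  combination-⟦⟧ {suc n} ρ x p = trans (⟦⟧-+ ρ (const (x zero) * p zero) _) (+-cong
    (trans (⟦⟧-* ρ (const (x zero)) (p zero)) (*-congʳ (⟦⟧-const ρ (x zero))))
    (combination-⟦⟧ ρ (x ∘ suc) (p ∘ suc)))

  *-combination : ∀ {n} q (x : Fin n → 𝕂) p → q * combination x p ≈ combination x (λ i → q * p i)
  *-combination {n} q x p = trans (*-distribˡ-sum q (λ i → const (x i) * p i))
    (sum-cong-≋ {n} λ i → x∙yz≈y∙xz q (const (x i)) (p i))
    where open CommutativeSemigroupProperties *-commutativeSemigroup using (x∙yz≈y∙xz)

  opaque
    unfolding _⊞_

    coeff-combination : ∀ {n} (x : Fin n → 𝕂) (p : Fin n → S) e →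
                        coeff (combination x p) e F.≈ FS.sum λ i → x i F.* coeff (p i) e
    coeff-combination {zero}  x p e = F.refl
    coeff-combination {suc n} x p e = F.+-cong
      (F.trans (conv-*ˡ (x zero) 1ᶜ (coeff (p zero)) e)
        (F.*-congˡ (CommutativeRing.*-identityˡ (coefficientRing ℓ) (coeff (p zero)) e)))
      (coeff-combination (x ∘ suc) (p ∘ suc) e)

  coefficient-sum : ∀ (L : List (Vec ℕ ℓ)) → (Fin (List.length L) → 𝕂) → Vec ℕ ℓ → 𝕂
  coefficient-sum L x e = FS.sum λ i → x i F.* coeff (X^ (List.lookup L i)) e

  coefficient-sum-0 : ∀ L x e → (∀ i → List.lookup L i ≡ e → x i F.≈ F.0#) → coefficient-sum L x e F.≈ F.0#
  coefficient-sum-0 []      x e z = F.refl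
  coefficient-sum-0 (m ∷ L) x e z = F.trans (F.+-cong (term (Vecₚ.≡-dec ℕₚ._≟_ m e))
    (coefficient-sum-0 L (x ∘ suc) e (z ∘ suc))) (F.+-identityˡ _)
    where
    term : Dec (m ≡ e) → x zero F.* coeff (X^ m) e F.≈ F.0#
    term (yes m≡e) = F.trans (F.*-congʳ (z zero m≡e)) (F.zeroˡ _)
    term (no  m≢e) = F.trans (F.*-congˡ (coeff-X^-≢ m≢e)) (F.zeroʳ _)

  coefficient-sum-lookup : ∀ {L} → Unique L → ∀ x i → coefficient-sum L x (List.lookup L i) F.≈ x i
  coefficient-sum-lookup {m ∷ L} (m∉L ∷ uniq) x zero = F.trans
    (F.+-cong (F.trans (F.*-congˡ (coeff-X^-≡ m)) (F.*-identityʳ _))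
      (coefficient-sum-0 L (x ∘ suc) m λ i eq → contradiction (≡.sym eq) (All.lookup m∉L (∈-lookup i))))
    (F.+-identityʳ _)
  coefficient-sum-lookup {m ∷ L} (m∉L ∷ uniq) x (suc i) = F.trans
    (F.+-cong (F.trans (F.*-congˡ (coeff-X^-≢ (All.lookup m∉L (∈-lookup i)))) (F.zeroʳ _))
      (coefficient-sum-lookup uniq (x ∘ suc) i))
    (F.+-identityˡ _)

  monomials-independent : ∀ {L} → Unique L → ∀ x →
                          combination x (λ i → X^ (List.lookup L i)) ≈ 0# → ∀ i → x i F.≈ F.0#
  monomials-independent {L} uniq x eq i = F.trans (F.sym (coefficient-sum-lookup uniq x i))
    (F.trans (F.sym (coeff-combination x (λ i → X^ (List.lookup L i)) (List.lookup L i)))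
      (F.trans (at eq (List.lookup L i)) (coeff-0 (List.lookup L i))))

  -- The support cannot be computed from `p`, as coefficients cannot be tested for zero. The
  -- disjunction is therefore supplied for every exponent from outside.
  monomials-span : ∀ {L} → Unique L → ∀ p → (∀ e → coeff p e F.≈ F.0# ⊎ e ∈ L) →
                   p ≈ combination (λ i → coeff p (List.lookup L i)) (λ i → X^ (List.lookup L i))
  monomials-span {L} uniq p supp = ⟪ (λ e → F.sym (F.trans
      (coeff-combination x (λ i → X^ (List.lookup L i)) e) (value e (supp e)))) ⟫
    where
    x = λ i → coeff p (List.lookup L i)
    value : ∀ e → coeff p e F.≈ F.0# ⊎ e ∈ L → coefficient-sum L x e F.≈ coeff p e
    value e (inj₁ p[e]≈0) = F.trans (coefficient-sum-0 L x e λ { i ≡.refl → p[e]≈0 }) (F.sym p[e]≈0)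
    value e (inj₂ e∈L)    = ≡.subst (λ e → coefficient-sum L x e F.≈ coeff p e)
      (≡.sym (lookup-index e∈L)) (coefficient-sum-lookup uniq x (Any.index e∈L))

-- Dimensions along a filtration by subspaces.

concatenate : ∀ {a} {A : Set a} {m n} → Vector A m → Vector A n → Vector A (m ℕ.+ n)
concatenate {m = zero}  x y i       = y i
concatenate {m = suc m} x y zero    = x zero
concatenate {m = suc m} x y (suc i) = concatenate (x ∘ suc) y i

concatenate-all : ∀ {a p} {A : Set a} (P : A → Set p) {m n} {x : Vector A m} {y : Vector A n} →
                  (∀ i → P (x i)) → (∀ i → P (y i)) → ∀ i → P (concatenate x y i)
concatenate-all P {zero}  p q i       = q i
concatenate-all P {suc m} p q zero    = p zero
concatenate-all P {suc m} p q (suc i) = concatenate-all P (p ∘ suc) q i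

concatenate-split : ∀ {a p} {A : Set a} (P : A → Set p) m {n} (z : Vector A (m ℕ.+ n)) →
                    (∀ i → P (z (i Fin.↑ˡ n))) → (∀ i → P (z (m Fin.↑ʳ i))) → ∀ i → P (z i)
concatenate-split P zero    z p q i       = q i
concatenate-split P (suc m) z p q zero    = p zero
concatenate-split P (suc m) z p q (suc i) = concatenate-split P m (z ∘ suc) (p ∘ suc) q i

module Dimension {c r s} (K : HeytingField c r s) where
  open Polynomials K
  open PolynomialRing K using (𝕂-ring)
  private module F = CommutativeRing 𝕂-ring

  module _ {m ℓm} (M : LeftModule F.ring m ℓm) where
    open LeftModule M
    open SetoidReasoning ≈ᴹ-setoid
    private
      lc : ∀ {n} → Vector F.Carrier n → Vector Carrierᴹ n → Carrierᴹ
      lc = linearCombination M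

    record IsSubspace {w} (P : Carrierᴹ → Set w) : Set (c ⊔ m ⊔ w) where
      field
        contains-0 : P 0ᴹ
        contains-+ : ∀ {u v} → P u → P v → P (u +ᴹ v)
        contains-* : ∀ x {u} → P u → P (x *ₗ u)

      contains-lc : ∀ {n} (x : Vector F.Carrier n) (b : Vector Carrierᴹ n) → (∀ i → P (b i)) → P (lc x b)
      contains-lc {zero}  x b p = contains-0
      contains-lc {suc n} x b p = contains-+ (contains-* (x zero) (p zero)) (contains-lc (x ∘ suc) (b ∘ suc) (p ∘ suc))

    SubspaceHasDimension : ∀ {w} → (Carrierᴹ → Set w) → ℕ → Set (c ⊔ r ⊔ m ⊔ ℓm ⊔ w)
    SubspaceHasDimension P n = Σ[ b ∈ Vector Carrierᴹ n ]
      (∀ i → P (b i)) × IsLinearlyIndependent M b × (∀ v → P v → ∃ λ x → v ≈ᴹ lc x b)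

    lc-zeroˡ : ∀ {n} (x : Vector F.Carrier n) b → (∀ i → x i F.≈ F.0#) → lc x b ≈ᴹ 0ᴹ
    lc-zeroˡ {zero}  x b z = ≈ᴹ-refl
    lc-zeroˡ {suc n} x b z = ≈ᴹ-trans
      (+ᴹ-cong (≈ᴹ-trans (*ₗ-cong (z zero) ≈ᴹ-refl) (*ₗ-zeroˡ _)) (lc-zeroˡ (x ∘ suc) (b ∘ suc) (z ∘ suc)))
      (+ᴹ-identityˡ 0ᴹ)

    lc-concatenate : ∀ {k n} (x : Vector F.Carrier k) (y : Vector F.Carrier n) a b →
                     lc (concatenate x y) (concatenate a b) ≈ᴹ lc x a +ᴹ lc y b
    lc-concatenate {zero}  x y a b = ≈ᴹ-sym (+ᴹ-identityˡ _)
    lc-concatenate {suc k} x y a b = ≈ᴹ-trans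
      (+ᴹ-congˡ (lc-concatenate (x ∘ suc) y (a ∘ suc) b)) (≈ᴹ-sym (+ᴹ-assoc _ _ _))

    lc-split : ∀ {k n} (z : Vector F.Carrier (k ℕ.+ n)) a b →
               lc z (concatenate a b) ≈ᴹ lc (λ i → z (i Fin.↑ˡ n)) a +ᴹ lc (λ i → z (k Fin.↑ʳ i)) b
    lc-split {zero}  z a b = ≈ᴹ-sym (+ᴹ-identityˡ _)
    lc-split {suc k} z a b = ≈ᴹ-trans
      (+ᴹ-congˡ (lc-split {k} (z ∘ suc) (a ∘ suc) b)) (≈ᴹ-sym (+ᴹ-assoc _ _ _))

    x≈y+[x-y] : ∀ x y → x ≈ᴹ y +ᴹ (x +ᴹ -ᴹ y)
    x≈y+[x-y] x y = begin
      x                     ≈⟨ +ᴹ-identityʳ x ⟨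
      x +ᴹ 0ᴹ               ≈⟨ +ᴹ-congˡ (-ᴹ‿inverseˡ y) ⟨
      x +ᴹ (-ᴹ y +ᴹ y)      ≈⟨ +ᴹ-assoc x (-ᴹ y) y ⟨
      (x +ᴹ -ᴹ y) +ᴹ y      ≈⟨ +ᴹ-comm _ y ⟩
      y +ᴹ (x +ᴹ -ᴹ y)      ∎

    -- Additivity of dimension for P inside P′ without forming the quotient: the two conditions on
    -- `a` say that it is independent modulo P and spans P′ modulo P. Independence modulo P kills
    -- the coefficients of `a` first, and what remains is a relation in P.
    extend-dimension : ∀ {w w′} {P : Carrierᴹ → Set w} {P′ : Carrierᴹ → Set w′} {k n} →
      IsSubspace P → (∀ v → P v → P′ v) →
      (a : Vector Carrierᴹ k) → (∀ i → P′ (a i)) →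
      (∀ x v → P v → lc x a +ᴹ v ≈ᴹ 0ᴹ → ∀ i → x i F.≈ F.0#) →
      (∀ v → P′ v → ∃ λ x → ∃ λ u → P u × v ≈ᴹ lc x a +ᴹ u) →
      SubspaceHasDimension P n → SubspaceHasDimension P′ (k ℕ.+ n)
    extend-dimension {P = P} {P′} {k} {n} isSubspace P⊆P′ a P′a independent spanning (b , Pb , b-independent , b-spanning) =
      concatenate a b , concatenate-all P′ P′a (λ i → P⊆P′ _ (Pb i)) , ab-independent , ab-spanning
      where
      open IsSubspace isSubspace

      ab-independent : IsLinearlyIndependent M (concatenate a b)
      ab-independent z eq = concatenate-split (F._≈ F.0#) k z x≈0 (b-independent y (begin
        lc y b            ≈⟨ +ᴹ-identityˡ _ ⟨
        0ᴹ +ᴹ lc y b      ≈⟨ +ᴹ-congʳ (lc-zeroˡ x a x≈0) ⟨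
        lc x a +ᴹ lc y b  ≈⟨ xa+yb≈0 ⟩
        0ᴹ                ∎))
        where
        x = λ i → z (i Fin.↑ˡ n)
        y = λ i → z (k Fin.↑ʳ i)
        xa+yb≈0 = ≈ᴹ-trans (≈ᴹ-sym (lc-split z a b)) eq
        x≈0 = independent x (lc y b) (contains-lc y b Pb) xa+yb≈0

      ab-spanning : ∀ v → P′ v → ∃ λ z → v ≈ᴹ lc z (concatenate a b)
      ab-spanning v P′v with spanning v P′v
      ... | x , u , Pu , v≈ with b-spanning u Pu
      ...   | y , u≈ = concatenate x y , ≈ᴹ-trans v≈ (≈ᴹ-trans (+ᴹ-congˡ u≈) (≈ᴹ-sym (lc-concatenate x y a b)))

-- Enumeration of lists, subsets and exponent vectors.

module _ {a} {A : Set a} where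
  sameElements⇒↭ : ∀ {xs ys : List A} → Unique xs → Unique ys →
                   (∀ {x} → x ∈ xs → x ∈ ys) → (∀ {x} → x ∈ ys → x ∈ xs) → xs ↭ ys
  sameElements⇒↭ uniq uniq′ f g = ∼bag⇒↭ (unique∧set⇒bag uniq uniq′ (mk⇔ f g))

  module _ {b} {B : Set b} (f : A → List B) where
    length-concatMap : ∀ xs → List.length (List.concatMap f xs) ≡ ℕList.sum (List.map (List.length ∘ f) xs)
    length-concatMap []       = ≡.refl
    length-concatMap (x ∷ xs) = ≡.trans (Listₚ.length-++ (f x)) (≡.cong (List.length (f x) ℕ.+_) (length-concatMap xs))

    concatMap⁺ : ∀ {xs} → Unique xs → (∀ {x} → x ∈ xs → Unique (f x)) →
                 (∀ {x y z} → x ∈ xs → y ∈ xs → z ∈ f x → z ∈ f y → x ≡ y) → Unique (List.concatMap f xs)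
    concatMap⁺ {[]}     []            uniq disj = []
    concatMap⁺ {x ∷ xs} (x∉xs ∷ uxs) uniq disj = Uniqueₚ.++⁺ (uniq (here ≡.refl))
      (concatMap⁺ uxs (uniq ∘ there) λ x∈xs y∈xs → disj (there x∈xs) (there y∈xs))
      λ (z∈fx , z∈rest) → let y , y∈xs , z∈fy = find (∈-concatMap⁻ f z∈rest) in
        All.lookup x∉xs y∈xs (disj (here ≡.refl) (there y∈xs) z∈fx z∈fy)

  module _ {p q u} {P : Pred A p} {Q : Pred A q} {R : Pred A u}
           (P? : Decidable P) (Q? : Decidable Q) (R? : Decidable R) where
    -- Meant for splitting a sum over cliques according to whether a given vertex belongs to them.
    -- The equation `0 ≡ 1` stands for absurdity.
    sum-filter-split : (∀ {x} → R x → P x ⊎ Q x) → (∀ {x} → P x → R x) → (∀ {x} → Q x → R x) →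
                       (∀ {x} → P x → Q x → R x → _≡_ {A = ℕ} 0 1) → (h : A → ℕ) → ∀ xs →
                       ℕList.sum (List.map h (List.filter R? xs)) ≡
                       ℕList.sum (List.map h (List.filter P? xs)) ℕ.+ ℕList.sum (List.map h (List.filter Q? xs))
    sum-filter-split split P⊆R Q⊆R disj h [] = ≡.refl
    sum-filter-split split P⊆R Q⊆R disj h (x ∷ xs) with IH ← sum-filter-split split P⊆R Q⊆R disj h xs
      with P? x | Q? x | R? x
    ... | yes px | yes qx | rx     = contradiction (disj px qx (P⊆R px)) λ ()
    ... | yes px | no ¬qx | no ¬rx = contradiction (P⊆R px) ¬rx
    ... | no ¬px | yes qx | no ¬rx = contradiction (Q⊆R qx) ¬rx
    ... | no ¬px | no ¬qx | no ¬rx = IH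
    ... | yes px | no ¬qx | yes rx = ≡.trans (≡.cong (h x ℕ.+_) IH) (≡.sym (ℕₚ.+-assoc (h x) _ _))
    ... | no ¬px | yes qx | yes rx = ≡.trans (≡.cong (h x ℕ.+_) IH) (x∙yz≈y∙xz (h x) (ℕList.sum (List.map h (List.filter P? xs))) (ℕList.sum (List.map h (List.filter Q? xs))))
      where open CommutativeSemigroupProperties ℕₚ.+-commutativeSemigroup using (x∙yz≈y∙xz)
    ... | no ¬px | no ¬qx | yes rx with split rx
    ...   | inj₁ px = contradiction px ¬px
    ...   | inj₂ qx = contradiction qx ¬qx

allSubsets-complete : ∀ {n} (F : Subset n) → F ∈ allSubsets n
allSubsets-complete []            = here ≡.refl
allSubsets-complete (outside ∷ F) = ∈-++⁺ˡ (∈-map⁺ (outside ∷_) (allSubsets-complete F))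
allSubsets-complete (inside ∷ F)  = ∈-++⁺ʳ _ (∈-map⁺ (inside ∷_) (allSubsets-complete F))

allSubsets-unique : ∀ n → Unique (allSubsets n)
allSubsets-unique zero    = [] ∷ []
allSubsets-unique (suc n) = Uniqueₚ.++⁺
  (Uniqueₚ.map⁺ Vecₚ.∷-injectiveʳ (allSubsets-unique n))
  (Uniqueₚ.map⁺ Vecₚ.∷-injectiveʳ (allSubsets-unique n))
  λ (p , q) → case ∈-map⁻ (outside ∷_) p , ∈-map⁻ (inside ∷_) q of λ { ((_ , _ , ≡.refl) , (_ , _ , ())) }

subset-ext : ∀ {n} {F F′ : Subset n} → (∀ {x} → x Subset.∈ F → x Subset.∈ F′) →
             (∀ {x} → x Subset.∈ F′ → x Subset.∈ F) → F ≡ F′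
subset-ext f g = Subsetₚ.⊆-antisym f g

-- The recursion imitates that of `[1-t]⁻_`: a position inside the subset is a convolution with 1 +
-- t + t² + ⋯ , one outside changes nothing. This makes the count in `length-exponents` immediate.
exponents : ∀ {n} → Subset n → ℕ → List (Vec ℕ n)
exponents []            zero    = [] ∷ []
exponents []            (suc d) = []
exponents (outside ∷ W) d       = List.map (0 ∷_) (exponents W d)
exponents (inside ∷ W)  d       =
  List.concatMap (λ i → List.map (i ∷_) (exponents W (d ∸ i))) (List.upTo (suc d))

SupportedIn : ∀ {n} → Subset n → Vec ℕ n → Set
SupportedIn W e = ∀ j → j Subset.∉ W → Vec.lookup e j ≡ 0

length-exponents : ∀ {n} (W : Subset n) d → List.length (exponents W d) ≡ ([1-t]⁻ ∣ W ∣) d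
length-exponents []            zero    = ≡.refl
length-exponents []            (suc d) = ≡.refl
length-exponents (outside ∷ W) d       = ≡.trans (Listₚ.length-map (0 ∷_) (exponents W d)) (length-exponents W d)
length-exponents (inside ∷ W)  d       = ≡.trans (length-concatMap (λ i → List.map (i ∷_) (exponents W (d ∸ i))) (List.upTo (suc d)))
  (≡.cong ℕList.sum (Listₚ.map-cong (λ i → ≡.trans (Listₚ.length-map (i ∷_) (exponents W (d ∸ i)))
    (≡.trans (length-exponents W (d ∸ i)) (≡.sym (ℕₚ.*-identityˡ _)))) (List.upTo (suc d))))

exponents-unique : ∀ {n} (W : Subset n) d → Unique (exponents W d)
exponents-unique []            zero    = [] ∷ []
exponents-unique []            (suc d) = []
exponents-unique (outside ∷ W) d       = Uniqueₚ.map⁺ Vecₚ.∷-injectiveʳ (exponents-unique W d)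
exponents-unique (inside ∷ W)  d       = concatMap⁺ (λ i → List.map (i ∷_) (exponents W (d ∸ i))) (Uniqueₚ.upTo⁺ (suc d))
  (λ {i} _ → Uniqueₚ.map⁺ Vecₚ.∷-injectiveʳ (exponents-unique W (d ∸ i)))
  (λ {i} {j} _ _ p q → head≡ (∈-map⁻ (i ∷_) p) (∈-map⁻ (j ∷_) q))
  where
  head≡ : ∀ {i j z} → (∃ λ e → e ∈ exponents W (d ∸ i) × z ≡ i ∷ e) →
          (∃ λ e → e ∈ exponents W (d ∸ j) × z ≡ j ∷ e) → i ≡ j
  head≡ (_ , _ , ≡.refl) (_ , _ , ≡.refl) = ≡.refl

∈-exponents⁺ : ∀ {n} (W : Subset n) e → SupportedIn W e → e ∈ exponents W (Vec.sum e)
∈-exponents⁺ []            []      s = here ≡.refl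
∈-exponents⁺ (outside ∷ W) (k ∷ e) s with s zero (λ ())
... | ≡.refl = ∈-map⁺ (0 ∷_) (∈-exponents⁺ W e λ j j∉W → s (suc j) λ { (Vec.there j∈W) → j∉W j∈W })
∈-exponents⁺ (inside ∷ W)  (k ∷ e) s = ∈-concatMap⁺ (λ i → List.map (i ∷_) (exponents W (k ℕ.+ Vec.sum e ∸ i)))
  (Any.map (λ { {i} ≡.refl → ∈-map⁺ (k ∷_) (≡.subst (λ m → e ∈ exponents W m) (≡.sym (ℕₚ.m+n∸m≡n k (Vec.sum e)))
    (∈-exponents⁺ W e λ j j∉W → s (suc j) λ { (Vec.there j∈W) → j∉W j∈W })) })
    (∈-upTo⁺ (s≤s (ℕₚ.m≤m+n k (Vec.sum e)))))

∈-exponents⁻ : ∀ {n} (W : Subset n) {d e} → e ∈ exponents W d → Vec.sum e ≡ d × SupportedIn W e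
∈-exponents⁻ []            {zero} (here ≡.refl) = ≡.refl , λ ()
∈-exponents⁻ (outside ∷ W) {d} p with ∈-map⁻ (0 ∷_) p
... | e , e∈ , ≡.refl with ∈-exponents⁻ W e∈
...   | Σe≡d , s = Σe≡d , λ where
  zero    _   → ≡.refl
  (suc j) j∉W → s j (j∉W ∘ Vec.there)
∈-exponents⁻ (inside ∷ W) {d} p with find (∈-concatMap⁻ (λ i → List.map (i ∷_) (exponents W (d ∸ i))) {xs = List.upTo (suc d)} p)
... | i , i∈ , q with ∈-map⁻ (i ∷_) q | ∈-upTo⁻ i∈
...   | e , e∈ , ≡.refl | s≤s i≤d with ∈-exponents⁻ W e∈
...     | Σe≡ , s = ≡.trans (≡.cong (_ ℕ.+_) Σe≡) (ℕₚ.m+[n∸m]≡n i≤d) , λ where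
  zero    j∉W → contradiction Vec.here j∉W
  (suc j) j∉W → s j (j∉W ∘ Vec.there)

-- Empty in negative degrees, where `t^_·_` has the coefficient 0.
exponentsℤ : ∀ {n} → Subset n → ℤ → List (Vec ℕ n)
exponentsℤ W (+ d)    = exponents W d
exponentsℤ W -[1+ _ ] = []

length-exponentsℤ : ∀ {n} (W : Subset n) a k → List.length (exponentsℤ W (k ℤ.- a)) ≡ (t^ a · [1-t]⁻ ∣ W ∣) k
length-exponentsℤ W a k with k ℤ.- a
... | + d      = length-exponents W d
... | -[1+ _ ] = ≡.refl

exponentsℤ-unique : ∀ {n} (W : Subset n) d → Unique (exponentsℤ W d)
exponentsℤ-unique W (+ d)    = exponents-unique W d
exponentsℤ-unique W -[1+ _ ] = []

∈-exponentsℤ⁺ : ∀ {n} (W : Subset n) {e d} → + Vec.sum e ≡ d → SupportedIn W e → e ∈ exponentsℤ W d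
∈-exponentsℤ⁺ W {e} ≡.refl s = ∈-exponents⁺ W e s

∈-exponentsℤ⁻ : ∀ {n} (W : Subset n) {d e} → e ∈ exponentsℤ W d → + Vec.sum e ≡ d × SupportedIn W e
∈-exponentsℤ⁻ W {+ d} p with ∈-exponents⁻ W p
... | Σe≡d , s = ≡.cong +_ Σe≡d , s

elements : ∀ {n} → Subset n → List (Fin n)
elements []            = []
elements (outside ∷ F) = List.map suc (elements F)
elements (inside ∷ F)  = zero ∷ List.map suc (elements F)

length-elements : ∀ {n} (F : Subset n) → List.length (elements F) ≡ ∣ F ∣
length-elements []            = ≡.refl
length-elements (outside ∷ F) = ≡.trans (Listₚ.length-map suc (elements F)) (length-elements F)
length-elements (inside ∷ F)  = ≡.cong suc (≡.trans (Listₚ.length-map suc (elements F)) (length-elements F))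

elements-unique : ∀ {n} (F : Subset n) → Unique (elements F)
elements-unique []            = []
elements-unique (outside ∷ F) = Uniqueₚ.map⁺ Finₚ.suc-injective (elements-unique F)
elements-unique (inside ∷ F)  = All.tabulate (λ p eq → zero≢ (∈-map⁻ suc p) eq)
                              ∷ Uniqueₚ.map⁺ Finₚ.suc-injective (elements-unique F)
  where
  zero≢ : ∀ {n} {xs : List (Fin n)} {y} → (∃ λ x → x ∈ xs × y ≡ suc x) → zero ≢ y
  zero≢ (_ , _ , ≡.refl) ()

∈-elements⁺ : ∀ {n} {F : Subset n} {x} → x Subset.∈ F → x ∈ elements F
∈-elements⁺ {F = inside ∷ F}  Vec.here      = here ≡.refl
∈-elements⁺ {F = inside ∷ F}  (Vec.there p) = there (∈-map⁺ suc (∈-elements⁺ p))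
∈-elements⁺ {F = outside ∷ F} (Vec.there p) = ∈-map⁺ suc (∈-elements⁺ p)

∈-elements⁻ : ∀ {n} (F : Subset n) {x} → x ∈ elements F → x Subset.∈ F
∈-elements⁻ (outside ∷ F) p with ∈-map⁻ suc p
... | _ , q , ≡.refl = Vec.there (∈-elements⁻ F q)
∈-elements⁻ (inside ∷ F) (here ≡.refl) = Vec.here
∈-elements⁻ (inside ∷ F) (there p) with ∈-map⁻ suc p
... | _ , q , ≡.refl = Vec.there (∈-elements⁻ F q)

module _ {n : ℕ} where
  increments : List (Fin n) → Vec ℕ n → Vec ℕ n
  increments js e = List.foldr (λ j e → Vec.updateAt e j suc) e js

  increments-injective : ∀ js {e e′} → increments js e ≡ increments js e′ → e ≡ e′
  increments-injective []       eq = eq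
  increments-injective (j ∷ js) eq = increments-injective js (increment-injective j eq)

  sum-increments : ∀ js e → Vec.sum (increments js e) ≡ List.length js ℕ.+ Vec.sum e
  sum-increments []       e = ≡.refl
  sum-increments (j ∷ js) e = ≡.trans (sum-increment (increments js e) j) (≡.cong suc (sum-increments js e))

  lookup-increments : ∀ {js i} e → i ∉ js → Vec.lookup (increments js e) i ≡ Vec.lookup e i
  lookup-increments {[]}     e i∉js = ≡.refl
  lookup-increments {j ∷ js} {i} e i∉js = ≡.trans
    (Vecₚ.lookup∘updateAt′ i j (λ i≡j → i∉js (here i≡j)) (increments js e))
    (lookup-increments e (i∉js ∘ there))

  lookup-increments-≢0 : ∀ {js i} e → i ∈ js → Vec.lookup (increments js e) i ≢ 0
  lookup-increments-≢0 {j ∷ js} {i} e p eq with i Finₚ.≟ j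
  ... | yes ≡.refl = contradiction (≡.trans (≡.sym (Vecₚ.lookup∘updateAt i (increments js e))) eq) λ ()
  lookup-increments-≢0 {j ∷ js} {i} e (here i≡j) eq | no i≢j = i≢j i≡j
  lookup-increments-≢0 {j ∷ js} {i} e (there p)  eq | no i≢j = lookup-increments-≢0 e p
    (≡.trans (≡.sym (Vecₚ.lookup∘updateAt′ i j i≢j (increments js e))) eq)

  decrements : ∀ {js} → Unique js → ∀ e → (∀ j → j ∈ js → Vec.lookup e j ≢ 0) →
               ∃ λ e′ → e ≡ increments js e′
  decrements []            e pos = e , ≡.refl
  decrements {j ∷ js} (j∉js ∷ uniq) e pos with Vec.lookup e j in eq
  ... | zero  = contradiction eq (pos j (here ≡.refl))
  ... | suc t with decrement e j eq
  ...   | e₁ , ≡.refl , _ with decrements uniq e₁ (λ i i∈js →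
              ≡.subst (_≢ 0) (Vecₚ.lookup∘updateAt′ i j (λ { ≡.refl → All.lookup j∉js i∈js ≡.refl }) e₁) (pos i (there i∈js)))
  ...     | e₂ , ≡.refl = e₂ , ≡.refl

-- For a clique F with least vertex v this counts the coordinates with free exponents, namely x_v
-- and the u_j with j ∉ F. It is the source of the power of 1 - t in the summand of F.
∣∁[]≔∣ : ∀ {n} (F : Subset n) v → v Subset.∈ F → ∣ ∁ F Vec.[ v ]≔ inside ∣ ≡ (n ∸ ∣ F ∣) ℕ.+ 1
∣∁[]≔∣ {n} F v v∈F = ≡.trans (go F v v∈F) (≡.trans (≡.cong suc (Subsetₚ.∣∁p∣≡n∸∣p∣ F)) (ℕₚ.+-comm 1 (n ∸ ∣ F ∣)))
  where
  go : ∀ {n} (F : Subset n) v → v Subset.∈ F → ∣ ∁ F Vec.[ v ]≔ inside ∣ ≡ suc ∣ ∁ F ∣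
  go (inside ∷ F)  zero    v∈F             = ≡.refl
  go (inside ∷ F)  (suc v) (Vec.there v∈F) = go F v v∈F
  go (outside ∷ F) (suc v) (Vec.there v∈F) = ≡.cong suc (go F v v∈F)

allPairs-map∈ : ∀ {a p q} {A : Set a} {R : A → A → Set p} {T : A → A → Set q} {xs} →
                (∀ {x y} → x ∈ xs → y ∈ xs → R x y → T x y) → AllPairs R xs → AllPairs T xs
allPairs-map∈ f []        = []
allPairs-map∈ f (r ∷ rs) =
  All.tabulate (λ y∈xs → f (here ≡.refl) (there y∈xs) (All.lookup r y∈xs))
  ∷ allPairs-map∈ (λ x∈xs y∈xs → f (there x∈xs) (there y∈xs)) rs

merge-target : ∀ {ℓ} (a b : Fin ℓ) → merge a b b ≡ b
merge-target a b with b Finₚ.≟ a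
... | yes _ = ≡.refl
... | no  _ = ≡.refl

-- The logarithmic condition as a condition on hyperplane restrictions.

module Arrangements {c r s} (K : HeytingField c r s) {ℓ} (G : SimpleGraph ℓ) where
  open SimpleGraph G
  open Polynomials K
  open PolynomialRing K
  open Evaluation K
  open Substitution K
  open F using () renaming (Carrier to 𝕂)
  open CommutativeRing (polyRing ℓ) hiding (zero)
  open NonZeroDivisors (polyRing ℓ)
  open RingProperties ring using (-1*x≈-x)
  open GroupProperties +-group using () renaming
    (x∙y⁻¹≈ε⇒x≈y to x-y≈0⇒x≈y; x≈y⇒x∙y⁻¹≈ε to x≈y⇒x-y≈0)
  open Differences K ℓ
  open SetoidReasoning setoid

  private
    S = Poly ℓ
    E = edges G

  Edge : Fin ℓ → Fin ℓ → Set
  Edge a b = (a , b) ∈ E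

  edge⁺ : ∀ {a b} → a Fin.< b → a ~ b → Edge a b
  edge⁺ a<b a~b = ∈-filter⁺ (λ (u , v) → (u Finₚ.<? v) ×-dec (u ~? v))
    (∈-cartesianProduct⁺ (∈-allFin _) (∈-allFin _)) (a<b , a~b)

  edge⁻ : ∀ {a b} → Edge a b → a Fin.< b × a ~ b
  edge⁻ p = ∈-filter⁻ (λ (u , v) → (u Finₚ.<? v) ×-dec (u ~? v))
    {xs = List.cartesianProduct (List.allFin ℓ) (List.allFin ℓ)} p .proj₂

  edges-unique : Unique E
  edges-unique = Uniqueₚ.filter⁺ (λ (u , v) → (u Finₚ.<? v) ×-dec (u ~? v))
    (Uniqueₚ.cartesianProduct⁺ (Uniqueₚ.allFin⁺ ℓ) (Uniqueₚ.allFin⁺ ℓ))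

  edge-≢ : ∀ {a b} → Edge a b → a ≢ b
  edge-≢ ab a≡b = Finₚ.<⇒≢ (edge⁻ ab .proj₁) a≡b

  edges-independent : ∀ {L} → Unique L → (∀ {x} → x ∈ L → x ∈ E) → AllPairs Independent L
  edges-independent uniq L⊆E = allPairs-map∈ (λ p q → separate (L⊆E p) (L⊆E q)) uniq
    where
    separate : ∀ {x y} → x ∈ E → y ∈ E → x ≢ y → Independent x y
    separate {a , b} {i , j} ab ij ne eq with a Finₚ.≟ i | b Finₚ.≟ i
    ... | yes ≡.refl | yes ≡.refl = edge-≢ ab ≡.refl
    ... | yes ≡.refl | no _       = ne (≡.cong (a ,_) (≡.sym eq))
    -- Here b = i goes to j, so the ends merge only if a = j, against a < b = i < j. This is where
    -- the orientation of the edges enters.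
    ... | no _       | yes ≡.refl = Finₚ.<⇒≢ (Finₚ.<-trans (edge⁻ ab .proj₁) (edge⁻ ij .proj₁)) eq
    ... | no _       | no _       = edge-≢ ab eq

  edgeForm : Fin ℓ × Fin ℓ → LinearForm ℓ
  edgeForm (a , b) i = coordinate a i F.- coordinate b i

  edgeForm-source : ∀ {a b} → a ≢ b → edgeForm (a , b) a F.≈ F.1#
  edgeForm-source {a} {b} a≢b with a Finₚ.≟ a | b Finₚ.≟ a
  ... | no a≢a | _       = contradiction ≡.refl a≢a
  ... | yes _  | yes b≡a = contradiction (≡.sym b≡a) a≢b
  ... | yes _  | no _    = F.trans (F.+-congˡ FP.-0#≈0#) (F.+-identityʳ _)

  edgeForm-target : ∀ {a b} → a ≢ b → edgeForm (a , b) b F.≈ F.- F.1#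
  edgeForm-target {a} {b} a≢b with a Finₚ.≟ b | b Finₚ.≟ b
  ... | _       | no b≢b = contradiction ≡.refl b≢b
  ... | yes a≡b | _      = contradiction a≡b a≢b
  ... | no _    | yes _  = F.+-identityˡ _

  edgeForm-other : ∀ {a b i} → i ≢ a → i ≢ b → edgeForm (a , b) i F.≈ F.0#
  edgeForm-other {a} {b} {i} i≢a i≢b with a Finₚ.≟ i | b Finₚ.≟ i
  ... | yes a≡i | _       = contradiction (≡.sym a≡i) i≢a
  ... | no _    | yes b≡i = contradiction (≡.sym b≡i) i≢b
  ... | no _    | no _    = F.-‿inverseʳ _

  private
    sum-coordinate : ∀ {n} (a : Fin n) (f : Fin n → 𝕂) → FS.sum (λ i → coordinate a i F.* f i) F.≈ f a
    sum-coordinate {suc n} zero    f = F.trans (F.+-cong (F.*-identityˡ _)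
      (F.trans (FS.sum-cong-≋ {n} λ i → F.zeroˡ (f (suc i))) (FS.sum-replicate-zero n))) (F.+-identityʳ _)
    sum-coordinate {suc n} (suc a) f = F.trans (F.+-cong (F.zeroˡ _) (sum-coordinate a (f ∘ suc))) (F.+-identityˡ _)

    sum-edgeForm : ∀ (x : Fin ℓ × Fin ℓ) (f : Fin ℓ → 𝕂) →
                   FS.sum (λ i → edgeForm x i F.* f i) F.≈ f (x .proj₁) F.- f (x .proj₂)
    sum-edgeForm (a , b) f = F.trans
      (FS.sum-cong-≋ {ℓ} λ i → F.trans (F.distribʳ (f i) (coordinate a i) (F.- coordinate b i))
        (F.+-congˡ (F.sym (FP.-‿distribˡ-* (coordinate b i) (f i)))))
      (F.trans (FS.∑-distrib-+ {ℓ} (λ i → coordinate a i F.* f i) (λ i → F.- (coordinate b i F.* f i)))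
        (F.+-cong (sum-coordinate a f) (F.trans (negate (λ i → coordinate b i F.* f i)) (F.-‿cong (sum-coordinate b f)))))
      where
      negate : ∀ {n} (g : Fin n → 𝕂) → FS.sum (λ i → F.- g i) F.≈ F.- FS.sum g
      negate {zero}  g = F.sym FP.-0#≈0#
      negate {suc n} g = F.trans (F.+-congˡ (negate (g ∘ suc))) (FP.-‿+-comm _ _)

    coeff-linear : ∀ {n} (α : Fin n → 𝕂) (p : Fin n → S) e →
                   coeff (foldr _+ₚ_ 0ₚ λ i → α i ·ₚ p i) e F.≈ FS.sum λ i → α i F.* coeff (p i) e
    coeff-linear {zero}  α p e = F.refl
    coeff-linear {suc n} α p e = F.+-congˡ (coeff-linear (α ∘ suc) (p ∘ suc) e)

  opaque
    unfolding _⊞_ X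

    linear-edgeForm : ∀ x → linear (edgeForm x) ≃ difference x
    linear-edgeForm x@(a , b) = ⟪ (λ e → F.trans (coeff-linear (edgeForm x) var e) (sum-edgeForm x λ i → coeff (var i) e)) ⟫

    wedge-def : ∀ (η : OneForm ℓ) α i j i<j → (η ∧ d α) i j i<j ≃ η i * const (α j) - η j * const (α i)
    wedge-def η α i j i<j = ⟪ (λ e → F.refl) ⟫

    •-def : ∀ (p : S) (θ : TwoForm ℓ) i j i<j → (p • θ) i j i<j ≃ p * θ i j i<j
    •-def p θ i j i<j = ⟪ (λ e → F.refl) ⟫

    const-cong : ∀ {x y} → x F.≈ y → const {ℓ} x ≃ const y
    const-cong = Homomorphism.ι-cong (constHom ℓ)

    const-1 : const {ℓ} F.1# ≃ 1#
    const-1 = Homomorphism.ι-1 (constHom ℓ)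

    const-0 : const {ℓ} F.0# ≃ 0#
    const-0 = Homomorphism.ι-0 (constHom ℓ)

    const-neg : ∀ x → const {ℓ} (F.- x) ≃ - const x
    const-neg x = ⟪ (λ e → F.sym (FP.-‿distribˡ-* x _)) ⟫

  -- The restriction of η to x_a = x_b is a multiple of d(x_a − x_b).
  record LogarithmicAt (a b : Fin ℓ) (η : OneForm ℓ) : Set r where
    field
      off : ∀ i → i ≢ a → i ≢ b → identify a b (η i) ≈ 0#
      opp : identify a b (η b) ≈ - identify a b (η a)

  module _ {a b : Fin ℓ} (a≢b : a ≢ b) (η : OneForm ℓ) where
    private
      α = edgeForm (a , b)
      κ : Fin ℓ → S
      κ i = identify a b (η i)

      ident-const : ∀ p x → identify a b (p * const x) ≈ identify a b p * const x
      ident-const p x = trans (⟦⟧-* (X ∘ merge a b) p (const x)) (*-congˡ (⟦⟧-const (X ∘ merge a b) x))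

      identify-wedge : ∀ i j → identify a b (η i * const (α j) - η j * const (α i)) ≈ κ i * const (α j) - κ j * const (α i)
      identify-wedge i j = trans (⟦⟧-+ (X ∘ merge a b) _ _) (+-cong (ident-const (η i) (α j))
        (trans (⟦⟧-neg (X ∘ merge a b) _) (-‿cong (ident-const (η j) (α i)))))

      cα : ∀ i → S
      cα i = const (α i)

      cα-source : cα a ≈ 1#
      cα-source = trans (const-cong (edgeForm-source a≢b)) const-1

      cα-target : cα b ≈ - 1#
      cα-target = trans (const-cong (edgeForm-target a≢b)) (trans (const-neg F.1#) (-‿cong const-1))

      cα-other : ∀ {i} → i ≢ a → i ≢ b → cα i ≈ 0#
      cα-other i≢a i≢b = trans (const-cong (edgeForm-other i≢a i≢b)) const-0

    -- Being a multiple of α, the form η ∧ dα restricts to zero on x_a = x_b. Comparison with the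
    -- index a, where α has coefficient 1, gives κ_i = κ_a α_i for every i.
    logarithmicAt⁻ : Σ[ θ ∈ TwoForm ℓ ] η ∧ d α ≈₂ linear α • θ → LogarithmicAt a b η
    logarithmicAt⁻ (θ , eq) = record
      { off = λ i i≢a i≢b → trans (proportional i) (trans (*-congˡ (cα-other i≢a i≢b)) (zeroʳ _))
      ; opp = trans (proportional b) (trans (*-congˡ cα-target)
                (trans (*-comm _ _) (-1*x≈-x (κ a))))
      }
      where
      ordered : ∀ i j → i Fin.< j → κ i * cα j ≈ κ j * cα i
      ordered i j i<j = x-y≈0⇒x≈y _ _ (trans (sym (identify-wedge i j)) (identify-multiple (begin
        η i * const (α j) - η j * const (α i)  ≈⟨ wedge-def η α i j i<j ⟨
        (η ∧ d α) i j i<j                      ≈⟨ ⟪ eq i j i<j ⟫ ⟩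
        (linear α • θ) i j i<j                 ≈⟨ •-def (linear α) θ i j i<j ⟩
        linear α * θ i j i<j                   ≈⟨ *-congʳ (linear-edgeForm (a , b)) ⟩
        diff a b * θ i j i<j                   ∎)))

      -- A `TwoForm` has components only for i < j, but the relation obtained from them is symmetric
      -- and trivial on the diagonal.
      symmetric : ∀ i j → κ i * cα j ≈ κ j * cα i
      symmetric i j with Finₚ.<-cmp i j
      ... | tri< i<j _ _      = ordered i j i<j
      ... | tri≈ _ ≡.refl _   = refl
      ... | tri> _ _ j<i      = sym (ordered j i j<i)

      proportional : ∀ i → κ i ≈ κ a * cα i
      proportional i = trans (sym (*-identityʳ _)) (trans (*-congˡ (sym cα-source)) (symmetric i a))

    -- If the restriction of η is proportional to α, every component of η ∧ dα vanishes on x_a = x_b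
    -- and is divisible by x_a - x_b; the quotients are the components of θ.
    logarithmicAt⁺ : LogarithmicAt a b η → Σ[ θ ∈ TwoForm ℓ ] η ∧ d α ≈₂ linear α • θ
    logarithmicAt⁺ log = (λ i j i<j → quotient i j .proj₁) , λ i j i<j → at (begin
      (η ∧ d α) i j i<j                          ≈⟨ wedge-def η α i j i<j ⟩
      η i * const (α j) - η j * const (α i)      ≈⟨ quotient i j .proj₂ ⟩
      diff a b * quotient i j .proj₁             ≈⟨ *-congʳ (linear-edgeForm (a , b)) ⟨
      linear α * quotient i j .proj₁             ≈⟨ •-def (linear α) (λ i j i<j → quotient i j .proj₁) i j i<j ⟨
      (linear α • λ i j i<j → quotient i j .proj₁) i j i<j  ∎)
      where
      open LogarithmicAt log

      proportional : ∀ i → κ i ≈ κ a * cα i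
      proportional i with i Finₚ.≟ a | i Finₚ.≟ b
      ... | yes ≡.refl | _          = trans (sym (*-identityʳ _)) (*-congˡ (sym cα-source))
      ... | no _       | yes ≡.refl = trans opp (trans (sym (-1*x≈-x (κ a)))
                                        (trans (*-comm _ _) (*-congˡ (sym cα-target))))
      ... | no i≢a     | no i≢b     = trans (off i i≢a i≢b) (sym (trans (*-congˡ (cα-other i≢a i≢b)) (zeroʳ _)))

      quotient : ∀ i j → ∃ λ q → η i * const (α j) - η j * const (α i) ≈ diff a b * q
      quotient i j = identify-0-divides (trans (identify-wedge i j) (x≈y⇒x-y≈0 (begin
        κ i * cα j           ≈⟨ *-congʳ (proportional i) ⟩
        κ a * cα i * cα j    ≈⟨ *-assoc _ _ _ ⟩
        κ a * (cα i * cα j)  ≈⟨ *-congˡ (*-comm _ _) ⟩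
        κ a * (cα j * cα i)  ≈⟨ *-assoc _ _ _ ⟨
        κ a * cα j * cα i    ≈⟨ *-congʳ (proportional j) ⟨
        κ j * cα i           ∎)))

  isLogarithmic⁻ : ∀ {η} → IsLogarithmic (graphicArrangement G) η → ∀ {a b} → Edge a b → LogarithmicAt a b η
  isLogarithmic⁻ {η} log ab = logarithmicAt⁻ (edge-≢ ab) η (All.lookup (Allₚ.map⁻ log) ab)

  isLogarithmic⁺ : ∀ {η} → (∀ {a b} → Edge a b → LogarithmicAt a b η) → IsLogarithmic (graphicArrangement G) η
  isLogarithmic⁺ {η} log = Allₚ.map⁺ (All.tabulate λ ab → logarithmicAt⁺ (edge-≢ ab) η (log ab))

-- The logarithmic forms attached to cliques.

-- The degree count for a clique form: `n` is #F less one, the number of factors in each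
-- denominator, and `e` is the number of edges.
degree-shift : ∀ k n e → k ℤ.- (+ 1 ℤ.- (+ 1 ℤ.+ n)) ℤ.+ e ≡ n ℤ.+ (k ℤ.+ e)
degree-shift = solve 3 (λ k n e → k :- (con (+ 1) :- (con (+ 1) :+ n)) :+ e := n :+ (k :+ e)) ≡.refl
  where open +-*-Solver

module CliqueForms {c r s} (K : HeytingField c r s) {ℓ} (G : SimpleGraph ℓ) where
  open SimpleGraph G
  open Polynomials K
  open PolynomialRing K
  open Evaluation K
  open Substitution K
  open CommutativeRing (polyRing ℓ) hiding (zero)
  open NonZeroDivisors (polyRing ℓ)
  open RingProperties ring using (-0#≈0#; -‿distribʳ-*; -‿distribˡ-*)
  open GroupProperties +-group using () renaming (⁻¹-involutive to -‿involutive)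
  open CommutativeSemigroupProperties *-commutativeSemigroup using (x∙yz≈y∙xz)
  open Differences K ℓ
  open Homogeneity K
  open Coordinates K ℓ
  open Arrangements K G
  open SetoidReasoning setoid

  private
    S = Poly ℓ
    E = edges G

  𝒬 : S
  𝒬 = ∏ E difference

  spokes : Fin ℓ → List (Fin ℓ) → S
  spokes w js = ∏ js (diff w)

  spokes-difference : ∀ w js → ∏ (List.map (w ,_) js) difference ≈ spokes w js
  spokes-difference w js = ∏-map (w ,_) difference js

  nzd-spokes : ∀ (t : Fin ℓ → Fin ℓ) w js → (∀ j → j ∈ js → t w ≢ t j) → NonZeroDivisor (spokes w js ⟦ X ∘ t ⟧)
  nzd-spokes t w js sep = nzd-≈ (sym (⟦⟧-∏ (X ∘ t) (diff w) js))
    (nzd-∏ js λ j j∈js → nzd-≈ (sym (diff-rename t w j)) (nzd-diff (sep j j∈js)))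

  identify-neg : ∀ a b p → identify a b (- p) ≈ - identify a b p
  identify-neg a b = ⟦⟧-neg (X ∘ merge a b)

  identify-* : ∀ a b p q → identify a b (p * q) ≈ identify a b p * identify a b q
  identify-* a b = ⟦⟧-* (X ∘ merge a b)

  identify-cong : ∀ a b {p q} → p ≈ q → identify a b p ≈ identify a b q
  identify-cong a b = ⟦⟧-cong (X ∘ merge a b)

  divides-∏ : ∀ {A : Set} {x : A} (f : A → S) {xs} → x ∈ xs → ∃ λ q → ∏ xs f ≈ f x * q
  divides-∏ f {x ∷ xs} (here ≡.refl) = ∏ xs f , refl
  divides-∏ f {y ∷ xs} (there p) with divides-∏ f p
  ... | q , eq = f y * q , trans (*-congˡ eq) (x∙yz≈y∙xz (f y) _ q)

  identify-𝒬 : ∀ {a b} → Edge a b → identify a b 𝒬 ≈ 0#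
  identify-𝒬 ab = identify-multiple (divides-∏ difference ab .proj₂)

  identify-adjacent-𝒬 : ∀ {a b} → a ~ b → identify a b 𝒬 ≈ 0#
  identify-adjacent-𝒬 {a} {b} a~b with Finₚ.<-cmp a b
  ... | tri< a<b _ _    = identify-𝒬 (edge⁺ a<b a~b)
  ... | tri≈ _ a≡b _    = contradiction a~b (~-irrefl a≡b)
  ... | tri> _ _ b<a with divides-∏ difference (edge⁺ b<a (~-sym a~b))
  ...   | q , eq = identify-multiple {q = - q} (begin
    𝒬                       ≈⟨ eq ⟩
    diff b a * q            ≈⟨ *-congʳ (diff-antisym b a) ⟩
    - diff a b * q          ≈⟨ -‿distribˡ-* _ _ ⟨
    - (diff a b * q)        ≈⟨ -‿distribʳ-* _ _ ⟩
    diff a b * - q          ∎)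

  others : Subset ℓ → Fin ℓ → List (Fin ℓ)
  others F w = List.filter (λ j → ¬? (j Finₚ.≟ w)) (elements F)

  ∈-others⁺ : ∀ {F w j} → j Subset.∈ F → j ≢ w → j ∈ others F w
  ∈-others⁺ {w = w} j∈F j≢w = ∈-filter⁺ (λ j → ¬? (j Finₚ.≟ w)) (∈-elements⁺ j∈F) j≢w

  ∈-others⁻ : ∀ {F w j} → j ∈ others F w → j Subset.∈ F × j ≢ w
  ∈-others⁻ {F} {w} p with ∈-filter⁻ (λ j → ¬? (j Finₚ.≟ w)) {xs = elements F} p
  ... | q , j≢w = ∈-elements⁻ F q , j≢w

  others-unique : ∀ F w → Unique (others F w)
  others-unique F w = Uniqueₚ.filter⁺ (λ j → ¬? (j Finₚ.≟ w)) (elements-unique F)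

  length-others : ∀ {F w} → w Subset.∈ F → suc (List.length (others F w)) ≡ ∣ F ∣
  length-others {F} {w} w∈F = ≡.trans (↭-length (sameElements⇒↭
      (All.tabulate (λ p w≡j → ∈-others⁻ {F} p .proj₂ (≡.sym w≡j)) ∷ others-unique F w)
      (elements-unique F)
      (λ { (here ≡.refl) → ∈-elements⁺ w∈F ; (there p) → ∈-elements⁺ (∈-others⁻ {F} p .proj₁) })
      forward)) (length-elements F)
    where
    forward : ∀ {j} → j ∈ elements F → j ∈ w ∷ others F w
    forward {j} p with j Finₚ.≟ w
    ... | yes j≡w = here j≡w
    ... | no  j≢w = there (∈-others⁺ (∈-elements⁻ F p) j≢w)

  module _ {F : Subset ℓ} (clique : IsClique G F) where

    -- In a clique each pair w, j is an edge in one of the two orientations, so `𝒬` vanishes on x_w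
    -- = x_j. The differences at w are pairwise independent, and `product-divides` applies.
    spokes-divide-𝒬 : ∀ {w} → w Subset.∈ F → ∃ λ q → 𝒬 ≈ spokes w (others F w) * q
    spokes-divide-𝒬 {w} w∈F =
      let q , eq = product-divides (List.map (w ,_) (others F w)) 𝒬 independent vanishes
      in  q , trans eq (*-congʳ (spokes-difference w (others F w)))
      where
      independent : AllPairs Independent (List.map (w ,_) (others F w))
      independent = AllPairsₚ.map⁺ (allPairs-map∈
        (λ {i} {j} i∈ _ i≢j eq → i≢j (≡.trans (≡.sym (merge-miss (∈-others⁻ {F} i∈ .proj₂)))
          (≡.trans (≡.sym eq) (merge-hit w j))))
        (others-unique F w))

      vanishes : ∀ a b → (a , b) ∈ List.map (w ,_) (others F w) → identify a b 𝒬 ≈ 0#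
      vanishes a b p with ∈-map⁻ (w ,_) p
      ... | j , q , ≡.refl = let j∈F , j≢w = ∈-others⁻ {F} q in
        identify-adjacent-𝒬 (clique w j w∈F j∈F (j≢w ∘ ≡.sym))

    cofactor : ∀ w → Dec (w Subset.∈ F) → S
    cofactor w (yes w∈F) = spokes-divide-𝒬 w∈F .proj₁
    cofactor w (no  _)   = 0#

    -- The coefficients of Q(𝒜) m ∑_{w ∈ F} dx_w / ∏_{j ∈ F, j ≠ w} (x_w − x_j).
    cliqueForm : S → OneForm ℓ
    cliqueForm m w = m * cofactor w (w Subsetₚ.∈? F)

    module _ (m : S) where
      private η = cliqueForm m

      cliqueForm-∈ : ∀ {w} → w Subset.∈ F → spokes w (others F w) * η w ≈ m * 𝒬
      cliqueForm-∈ {w} w∈F with w Subsetₚ.∈? F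
      ... | no  w∉F  = contradiction w∈F w∉F
      ... | yes w∈F′ = trans (x∙yz≈y∙xz _ m _) (*-congˡ (sym (spokes-divide-𝒬 w∈F′ .proj₂)))

      cliqueForm-∉ : ∀ {w} → w Subset.∉ F → η w ≈ 0#
      cliqueForm-∉ {w} w∉F with w Subsetₚ.∈? F
      ... | no  _   = zeroʳ m
      ... | yes w∈F = contradiction w∈F w∉F

      private
        -- The spokes at i times η_i give m `𝒬`, which vanishes on x_a = x_b. If no spoke at i
        -- vanishes there, the spokes can be cancelled after restriction.
        kill : ∀ {a b} → Edge a b → ∀ i → (i Subset.∈ F → ∀ j → j ∈ others F i → merge a b i ≢ merge a b j) →
               identify a b (η i) ≈ 0#
        kill {a} {b} ab i sep with i Subsetₚ.∈? F
        ... | no  i∉F = trans (identify-cong a b (zeroʳ m)) (⟦⟧-0 (X ∘ merge a b))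
        ... | yes i∈F = nzd-spokes (merge a b) i (others F i) (sep i∈F) _ (begin
          identify a b (spokes i (others F i)) * identify a b (m * spokes-divide-𝒬 i∈F .proj₁)
            ≈⟨ identify-* a b (spokes i (others F i)) _ ⟨
          identify a b (spokes i (others F i) * (m * spokes-divide-𝒬 i∈F .proj₁))
            ≈⟨ identify-cong a b (trans (x∙yz≈y∙xz _ m _) (*-congˡ (sym (spokes-divide-𝒬 i∈F .proj₂)))) ⟩
          identify a b (m * 𝒬)
            ≈⟨ identify-* a b m 𝒬 ⟩
          identify a b m * identify a b 𝒬
            ≈⟨ *-congˡ (identify-𝒬 ab) ⟩
          identify a b m * 0#
            ≈⟨ zeroʳ _ ⟩
          0# ∎)

        -- The poles along x_a = x_b at the two ends cancel. The factor x_a - x_b occurs in the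
        -- spokes at a and, with the opposite sign, in those at b; once it is removed, the remaining
        -- spokes run over the same vertices and agree on the hyperplane.
        both : ∀ {a b} → a ≢ b → a Subset.∈ F → b Subset.∈ F → identify a b (η b) ≈ - identify a b (η a)
        both {a} {b} a≢b a∈F b∈F = trans (sym (-‿involutive _)) (-‿cong (sym (nzd-cancelˡ nzd-T (begin
            T * identify a b (η a)                   ≈⟨ identify-* a b (spokes a R) (η a) ⟨
            identify a b (spokes a R * η a)          ≈⟨ identify-cong a b opposite ⟩
            identify a b (- (spokes b R * η b))      ≈⟨ identify-neg a b _ ⟩
            - identify a b (spokes b R * η b)        ≈⟨ -‿cong (identify-* a b (spokes b R) (η b)) ⟩
            - (identify a b (spokes b R) * identify a b (η b))  ≈⟨ -‿cong (*-congʳ (sym T≈)) ⟩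
            - (T * identify a b (η b))               ≈⟨ -‿distribʳ-* _ _ ⟩
            T * - identify a b (η b)                 ∎))))
          where
          R = List.filter (λ j → ¬? (j Finₚ.≟ b)) (others F a)
          T = identify a b (spokes a R)

          R⁻ : ∀ {j} → j ∈ R → j Subset.∈ F × j ≢ a × j ≢ b
          R⁻ p = let q , j≢b = ∈-filter⁻ (λ j → ¬? (j Finₚ.≟ b)) {xs = others F a} p
                     j∈F , j≢a = ∈-others⁻ {F} q
                 in j∈F , j≢a , j≢b

          R⁺ : ∀ {j} → j Subset.∈ F → j ≢ a → j ≢ b → j ∈ R
          R⁺ j∈F j≢a j≢b = ∈-filter⁺ (λ j → ¬? (j Finₚ.≟ b)) (∈-others⁺ j∈F j≢a) j≢b

          R-unique : Unique R
          R-unique = Uniqueₚ.filter⁺ (λ j → ¬? (j Finₚ.≟ b)) (others-unique F a)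

          others-a : others F a ↭ b ∷ R
          others-a = sameElements⇒↭ (others-unique F a)
            (All.tabulate (λ p b≡j → R⁻ p .proj₂ .proj₂ (≡.sym b≡j)) ∷ R-unique) to
            λ { (here ≡.refl) → ∈-others⁺ b∈F (a≢b ∘ ≡.sym)
              ; (there p) → ∈-others⁺ (R⁻ p .proj₁) (R⁻ p .proj₂ .proj₁) }
            where
            to : ∀ {j} → j ∈ others F a → j ∈ b ∷ R
            to {j} p with j Finₚ.≟ b
            ... | yes j≡b = here j≡b
            ... | no  j≢b = there (R⁺ (∈-others⁻ {F} p .proj₁) (∈-others⁻ {F} p .proj₂) j≢b)

          others-b : others F b ↭ a ∷ R
          others-b = sameElements⇒↭ (others-unique F b)
            (All.tabulate (λ p a≡j → R⁻ p .proj₂ .proj₁ (≡.sym a≡j)) ∷ R-unique) to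
            λ { (here ≡.refl) → ∈-others⁺ a∈F a≢b
              ; (there p) → ∈-others⁺ (R⁻ p .proj₁) (R⁻ p .proj₂ .proj₂) }
            where
            to : ∀ {j} → j ∈ others F b → j ∈ a ∷ R
            to {j} p with j Finₚ.≟ a
            ... | yes j≡a = here j≡a
            ... | no  j≢a = there (R⁺ (∈-others⁻ {F} p .proj₁) j≢a (∈-others⁻ {F} p .proj₂))

          opposite : spokes a R * η a ≈ - (spokes b R * η b)
          opposite = nzd-cancelˡ (nzd-diff a≢b) (begin
            diff a b * (spokes a R * η a)       ≈⟨ *-assoc _ _ _ ⟨
            spokes a (b ∷ R) * η a              ≈⟨ *-congʳ (∏-↭ (diff a) others-a) ⟨
            spokes a (others F a) * η a         ≈⟨ cliqueForm-∈ a∈F ⟩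
            m * 𝒬                               ≈⟨ cliqueForm-∈ b∈F ⟨
            spokes b (others F b) * η b         ≈⟨ *-congʳ (∏-↭ (diff b) others-b) ⟩
            spokes b (a ∷ R) * η b              ≈⟨ *-assoc _ _ _ ⟩
            diff b a * (spokes b R * η b)       ≈⟨ *-congʳ (diff-antisym b a) ⟩
            - diff a b * (spokes b R * η b)     ≈⟨ -‿distribˡ-* _ _ ⟨
            - (diff a b * (spokes b R * η b))   ≈⟨ -‿distribʳ-* _ _ ⟩
            diff a b * - (spokes b R * η b)     ∎)

          T≈ : T ≈ identify a b (spokes b R)
          T≈ = begin
            T                                                   ≈⟨ ⟦⟧-∏ (X ∘ merge a b) (diff a) R ⟩
            ∏ R (λ j → identify a b (diff a j))                 ≈⟨ ∏-cong R (λ j _ → begin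
              identify a b (diff a j)                  ≈⟨ diff-rename (merge a b) a j ⟩
              diff (merge a b a) (merge a b j)         ≡⟨ ≡.cong (λ i → diff i (merge a b j))
                                                            (≡.trans (merge-hit a b) (≡.sym (merge-target a b))) ⟩
              diff (merge a b b) (merge a b j)         ≈⟨ diff-rename (merge a b) b j ⟨
              identify a b (diff b j)                  ∎) ⟩
            ∏ R (λ j → identify a b (diff b j))                 ≈⟨ ⟦⟧-∏ (X ∘ merge a b) (diff b) R ⟨
            identify a b (spokes b R)                           ∎

          nzd-T : NonZeroDivisor T
          nzd-T = nzd-spokes (merge a b) a R λ j p eq → R⁻ p .proj₂ .proj₂
            (≡.trans (≡.sym (merge-miss (R⁻ p .proj₂ .proj₁))) (≡.trans (≡.sym eq) (merge-hit a b)))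

      cliqueForm-logarithmic : ∀ {a b} → Edge a b → LogarithmicAt a b η
      cliqueForm-logarithmic {a} {b} ab = record { off = off ; opp = opp }
        where
        off : ∀ i → i ≢ a → i ≢ b → identify a b (η i) ≈ 0#
        off i i≢a i≢b = kill ab i λ _ j p eq → distinct j (∈-others⁻ {F} p .proj₂) (≡.trans (≡.sym eq) (merge-miss i≢a))
          where
          distinct : ∀ j → j ≢ i → merge a b j ≢ i
          distinct j j≢i eq with j Finₚ.≟ a
          ... | yes _ = i≢b (≡.sym eq)
          ... | no  _ = j≢i eq

        opp : identify a b (η b) ≈ - identify a b (η a)
        opp = go (a Subsetₚ.∈? F) (b Subsetₚ.∈? F)
          where
          go : Dec (a Subset.∈ F) → Dec (b Subset.∈ F) → identify a b (η b) ≈ - identify a b (η a)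
          -- Only with both ends in F is there anything to compare; in the other cases both
          -- components vanish on the hyperplane.
          go (yes a∈F) (yes b∈F) = both (edge-≢ ab) a∈F b∈F
          go a∈?F      (no b∉F)  = trans (trans (identify-cong a b (cliqueForm-∉ b∉F)) (⟦⟧-0 (X ∘ merge a b)))
              (sym (trans (-‿cong (kill ab a λ _ j p eq → b∉F (≡.subst (Subset._∈ F)
                (≡.trans (≡.sym (merge-miss (∈-others⁻ {F} p .proj₂))) (≡.trans (≡.sym eq) (merge-hit a b)))
                (∈-others⁻ {F} p .proj₁)))) -0#≈0#))
          go (no a∉F)  (yes _)   = trans
              (kill ab b λ _ j p eq → ∈-others⁻ {F} p .proj₂ (≡.trans
                (≡.sym (merge-miss (λ j≡a → a∉F (≡.subst (Subset._∈ F) j≡a (∈-others⁻ {F} p .proj₁)))))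
                (≡.trans (≡.sym eq) (merge-target a b))))
              (sym (trans (-‿cong (trans (identify-cong a b (cliqueForm-∉ a∉F)) (⟦⟧-0 (X ∘ merge a b)))) -0#≈0#))

      -- The cofactor is known only as a quotient. Its degree is found by multiplying the spokes
      -- back, which gives m `𝒬`, and cancelling them within homogeneous polynomials.
      cliqueForm-homogeneous : ∀ {k} → IsHomogeneous m (k ℤ.- (+ 1 ℤ.- + ∣ F ∣)) →
                               ∀ w → IsHomogeneous (η w) (k ℤ.+ + deg-Q (graphicArrangement G))
      cliqueForm-homogeneous {k} hm w with w Subsetₚ.∈? F
      ... | no  _   = homogeneous-≃ (sym (zeroʳ m)) (homogeneous-0 _)
      ... | yes w∈F = homogeneous-∏-cancel (List.map (w ,_) (others F w)) sep {m * q} (homogeneous-≃ (begin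
          m * 𝒬                              ≈⟨ *-congˡ (spokes-divide-𝒬 w∈F .proj₂) ⟩
          m * (spokes w (others F w) * q)    ≈⟨ x∙yz≈y∙xz m _ q ⟩
          spokes w (others F w) * (m * q)    ≈⟨ *-congʳ (spokes-difference w (others F w)) ⟨
          ∏ (List.map (w ,_) (others F w)) difference * (m * q)  ∎)
          (≡.subst (IsHomogeneous (m * 𝒬)) degree
            (homogeneous-* {p = m} {𝒬} hm (homogeneous-difference E))))
        where
        q = spokes-divide-𝒬 w∈F .proj₁

        sep : ∀ a b → (a , b) ∈ List.map (w ,_) (others F w) → a ≢ b
        sep a b p with ∈-map⁻ (w ,_) p
        ... | j , p′ , ≡.refl = ∈-others⁻ {F} p′ .proj₂ ∘ ≡.sym

        degree : k ℤ.- (+ 1 ℤ.- + ∣ F ∣) ℤ.+ + List.length E ≡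
                 + List.length (List.map (w ,_) (others F w)) ℤ.+ (k ℤ.+ + deg-Q (graphicArrangement G))
        degree = ≡.trans
          (≡.trans (≡.cong (λ n → k ℤ.- (+ 1 ℤ.- + n) ℤ.+ + List.length E) (≡.sym (length-others w∈F)))
                   (degree-shift k (+ List.length (others F w)) (+ List.length E)))
          (≡.cong₂ (λ n e → + n ℤ.+ (k ℤ.+ + e)) (≡.sym (Listₚ.length-map (w ,_) (others F w)))
                   (≡.sym (Listₚ.length-map edgeForm E)))

-- Constraints on leading coefficients.

module LeadingCoefficients {c r s} (K : HeytingField c r s) {ℓ} (G : SimpleGraph ℓ) (v : Fin ℓ) where
  open SimpleGraph G
  open Polynomials K
  open PolynomialRing K
  open Evaluation K
  open Substitution K
  open CommutativeRing (polyRing ℓ) hiding (zero)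
  open NonZeroDivisors (polyRing ℓ)
  open RingProperties ring using (-0#≈0#; -‿distribʳ-*; -‿distribˡ-*)
  open Differences K ℓ
  open Homogeneity K
  open Coordinates K ℓ
  open Arrangements K G
  open CliqueForms K G
  open SetoidReasoning setoid

  private
    S = Poly ℓ
    E = edges G

  neighbour? : Decidable (λ j → v Fin.< j × v ~ j)
  neighbour? j = (v Finₚ.<? j) ×-dec (v ~? j)

  neighbours : List (Fin ℓ)
  neighbours = List.filter neighbour? (List.allFin ℓ)

  neighbours-unique : Unique neighbours
  neighbours-unique = Uniqueₚ.filter⁺ neighbour? (Uniqueₚ.allFin⁺ ℓ)

  ∈-neighbours⁺ : ∀ {j} → v Fin.< j → v ~ j → j ∈ neighbours
  ∈-neighbours⁺ {j} v<j v~j = ∈-filter⁺ neighbour? (∈-allFin j) (v<j , v~j)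

  ∈-neighbours⁻ : ∀ {j} → j ∈ neighbours → v Fin.< j × v ~ j
  ∈-neighbours⁻ p = ∈-filter⁻ neighbour? {xs = List.allFin ℓ} p .proj₂

  notFrom? : Decidable {A = Fin ℓ × Fin ℓ} (λ x → x .proj₁ ≢ v)
  notFrom? x = ¬? (x .proj₁ Finₚ.≟ v)

  rest : List (Fin ℓ × Fin ℓ)
  rest = List.filter notFrom? E

  rest⁻ : ∀ {x} → x ∈ rest → x ∈ E × x .proj₁ ≢ v
  rest⁻ = ∈-filter⁻ notFrom? {xs = E}

  rest-unique : Unique rest
  rest-unique = Uniqueₚ.filter⁺ notFrom? edges-unique

  edges↭ : E ↭ List.map (v ,_) neighbours ++ rest
  edges↭ = sameElements⇒↭ edges-unique
    (Uniqueₚ.++⁺ (Uniqueₚ.map⁺ (λ { ≡.refl → ≡.refl }) neighbours-unique) rest-unique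
      λ (p , q) → rest⁻ q .proj₂ (source p))
    to from
    where
    source : ∀ {x} → x ∈ List.map (v ,_) neighbours → x .proj₁ ≡ v
    source p with ∈-map⁻ (v ,_) p
    ... | _ , _ , ≡.refl = ≡.refl

    to : ∀ {x} → x ∈ E → x ∈ List.map (v ,_) neighbours ++ rest
    to {a , b} ab with a Finₚ.≟ v
    ... | yes ≡.refl = ∈-++⁺ˡ (∈-map⁺ (v ,_) (∈-neighbours⁺ (edge⁻ ab .proj₁) (edge⁻ ab .proj₂)))
    ... | no  a≢v    = ∈-++⁺ʳ _ (∈-filter⁺ notFrom? ab a≢v)

    from : ∀ {x} → x ∈ List.map (v ,_) neighbours ++ rest → x ∈ E
    from p with ∈-++⁻ (List.map (v ,_) neighbours) p
    ... | inj₂ q = rest⁻ q .proj₁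
    ... | inj₁ q with ∈-map⁻ (v ,_) q
    ...   | j , q′ , ≡.refl = edge⁺ (∈-neighbours⁻ q′ .proj₁) (∈-neighbours⁻ q′ .proj₂)

  -- The part of Q(𝒜) that cancels in the leading coefficient: the edges that do not have v as their
  -- smaller end.
  A : S
  A = ∏ rest difference

  nzd-A : NonZeroDivisor A
  nzd-A = nzd-∏ rest λ (a , b) p → nzd-diff (edge-≢ (rest⁻ p .proj₁))

  𝒬-splits : 𝒬 ≈ spokes v neighbours * A
  𝒬-splits = trans (∏-↭ difference edges↭) (trans (∏-++ difference (List.map (v ,_) neighbours) rest)
    (*-congʳ (spokes-difference v neighbours)))

  length-edges : List.length E ≡ List.length neighbours ℕ.+ List.length rest
  length-edges = ≡.trans (↭-length edges↭) (≡.trans (Listₚ.length-++ (List.map (v ,_) neighbours))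
    (≡.cong (ℕ._+ List.length rest) (Listₚ.length-map (v ,_) neighbours)))

  -- Forms ω with leading coefficient ω_v, i.e. ω_w = 0 for w < v: then ω_v = g / ∏_{j ∈ neighbours} (x_v − x_j).
  module Leading {η : OneForm ℓ} (log : ∀ {a b} → Edge a b → LogarithmicAt a b η)
                 (leading : ∀ w → w Fin.< v → η w ≈ 0#) where

    -- An edge (a , b) in `rest` either avoids v, and η_v vanishes on x_a = x_b as a component off
    -- the edge, or ends at b = v, and there η_v is opposite to η_a, which is zero because a < v.
    A-divides : ∃ λ g → η v ≈ A * g
    A-divides = product-divides rest (η v) (edges-independent rest-unique (λ p → rest⁻ p .proj₁)) vanishes
      where
      vanishes : ∀ a b → (a , b) ∈ rest → identify a b (η v) ≈ 0#
      vanishes a b p with rest⁻ p | b Finₚ.≟ v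
      ... | ab , a≢v | no  b≢v    = LogarithmicAt.off (log ab) v (a≢v ∘ ≡.sym) (b≢v ∘ ≡.sym)
      ... | ab , a≢v | yes ≡.refl = trans (LogarithmicAt.opp (log ab)) (trans
        (-‿cong (trans (identify-cong a b (leading a (edge⁻ ab .proj₁))) (⟦⟧-0 (X ∘ merge a b)))) -0#≈0#)

    g : S
    g = A-divides .proj₁

    homogeneous-g : ∀ {k} → IsHomogeneous (η v) (k ℤ.+ + deg-Q (graphicArrangement G)) →
                    IsHomogeneous g (k ℤ.+ + List.length neighbours)
    homogeneous-g {k} h = homogeneous-∏-cancel rest (λ a b p → edge-≢ (rest⁻ p .proj₁)) {g}
      (homogeneous-≃ (A-divides .proj₂) (≡.subst (IsHomogeneous (η v)) degree h))
      where
      degree : k ℤ.+ + deg-Q (graphicArrangement G) ≡ + List.length rest ℤ.+ (k ℤ.+ + List.length neighbours)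
      degree = ≡.trans (≡.cong (λ n → k ℤ.+ + n) (≡.trans (Listₚ.length-map edgeForm E) length-edges))
        (solve 3 (λ k n m → k :+ (n :+ m) := m :+ (k :+ n)) ≡.refl k (+ List.length neighbours) (+ List.length rest))
        where open +-*-Solver

    -- On the subspace x_v = x_i = x_j the factor A does not vanish, but η_v does.
    module _ {i j : Fin ℓ} (i∈N : i ∈ neighbours) (j∈N : j ∈ neighbours) (i≢j : i ≢ j) (i≁j : ¬ i ~ j) where
      private
        v<i = ∈-neighbours⁻ i∈N .proj₁
        v<j = ∈-neighbours⁻ j∈N .proj₁
        i≢v = Finₚ.<⇒≢ v<i ∘ ≡.sym
        j≢v = Finₚ.<⇒≢ v<j ∘ ≡.sym
        vi = edge⁺ v<i (∈-neighbours⁻ i∈N .proj₂)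
        vj = edge⁺ v<j (∈-neighbours⁻ j∈N .proj₂)

        t : Fin ℓ → Fin ℓ
        t = merge j v ∘ merge i v

        t-i : t i ≡ v
        t-i = ≡.trans (≡.cong (merge j v) (merge-hit i v)) (merge-target j v)

        t-j : t j ≡ v
        t-j = ≡.trans (≡.cong (merge j v) (merge-miss (i≢j ∘ ≡.sym))) (merge-hit j v)

        t-v : t v ≡ v
        t-v = ≡.trans (≡.cong (merge j v) (merge-target i v)) (merge-target j v)

        t-other : ∀ {a} → a ≢ i → a ≢ j → t a ≡ a
        t-other a≢i a≢j = ≡.trans (≡.cong (merge j v) (merge-miss a≢i)) (merge-miss a≢j)

        t≡v : ∀ a → t a ≡ v → a ≡ i ⊎ a ≡ j ⊎ a ≡ v
        t≡v a eq with a Finₚ.≟ i | a Finₚ.≟ j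
        ... | yes a≡i | _       = inj₁ a≡i
        ... | no _    | yes a≡j = inj₂ (inj₁ a≡j)
        ... | no a≢i  | no a≢j  = inj₂ (inj₂ (≡.trans (≡.sym (merge-miss a≢j)) eq))

        -- Only i, j and v are sent to v. An edge in `rest` does not start at v; it cannot run from
        -- i or j down to v, by orientation, nor join i and j, which are not adjacent.
        not-edge : ∀ {a b} → (a , b) ∈ rest → t a ≡ v → t b ≡ v → ⊥
        not-edge {a} {b} p ta≡v tb≡v with rest⁻ p
        ... | ab , a≢v with edge⁻ ab | t≡v a ta≡v | t≡v b tb≡v
        ...   | a<b , a~b | inj₂ (inj₂ a≡v)     | _                  = a≢v a≡v
        ...   | a<b , a~b | inj₁ ≡.refl         | inj₁ ≡.refl        = Finₚ.<⇒≢ a<b ≡.refl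
        ...   | a<b , a~b | inj₁ ≡.refl         | inj₂ (inj₁ ≡.refl) = i≁j a~b
        ...   | a<b , a~b | inj₁ ≡.refl         | inj₂ (inj₂ ≡.refl) = Finₚ.<-asym a<b v<i
        ...   | a<b , a~b | inj₂ (inj₁ ≡.refl)  | inj₁ ≡.refl        = i≁j (~-sym a~b)
        ...   | a<b , a~b | inj₂ (inj₁ ≡.refl)  | inj₂ (inj₁ ≡.refl) = Finₚ.<⇒≢ a<b ≡.refl
        ...   | a<b , a~b | inj₂ (inj₁ ≡.refl)  | inj₂ (inj₂ ≡.refl) = Finₚ.<-asym a<b v<j

        separates : ∀ a b → (a , b) ∈ rest → t a ≢ t b
        separates a b p eq = go (a Finₚ.≟ i) (a Finₚ.≟ j)
          where
          collapse : t a ≡ v → ⊥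
          collapse ta≡v = not-edge p ta≡v (≡.trans (≡.sym eq) ta≡v)

          go : Dec (a ≡ i) → Dec (a ≡ j) → ⊥
          go (yes ≡.refl) _            = collapse t-i
          go (no _)       (yes ≡.refl) = collapse t-j
          go (no a≢i)     (no a≢j)     = go′ (b Finₚ.≟ i) (b Finₚ.≟ j)
            where
            ta≡a = t-other a≢i a≢j

            go′ : Dec (b ≡ i) → Dec (b ≡ j) → ⊥
            go′ (yes ≡.refl) _            = rest⁻ p .proj₂ (≡.trans (≡.sym ta≡a) (≡.trans eq t-i))
            go′ (no _)       (yes ≡.refl) = rest⁻ p .proj₂ (≡.trans (≡.sym ta≡a) (≡.trans eq t-j))
            go′ (no b≢i)     (no b≢j)     = edge-≢ (rest⁻ p .proj₁)
              (≡.trans (≡.sym ta≡a) (≡.trans eq (t-other b≢i b≢j)))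

        kill : ∀ {a b p q} → t a ≡ t b → p ≈ diff a b * q → p ⟦ X ∘ t ⟧ ≈ 0#
        kill {a} {b} {p} {q} ta≡tb p≈ = begin
          p ⟦ X ∘ t ⟧                                 ≈⟨ ⟦⟧-cong (X ∘ t) p≈ ⟩
          (diff a b * q) ⟦ X ∘ t ⟧                    ≈⟨ ⟦⟧-* (X ∘ t) (diff a b) q ⟩
          diff a b ⟦ X ∘ t ⟧ * q ⟦ X ∘ t ⟧            ≈⟨ *-congʳ (diff-rename t a b) ⟩
          diff (t a) (t b) * q ⟦ X ∘ t ⟧              ≡⟨ ≡.cong (λ c → diff c (t b) * q ⟦ X ∘ t ⟧) ta≡tb ⟩
          diff (t b) (t b) * q ⟦ X ∘ t ⟧              ≈⟨ *-congʳ (diff-self (t b)) ⟩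
          0# * q ⟦ X ∘ t ⟧                            ≈⟨ zeroˡ _ ⟩
          0#                                          ∎

        -- This uses the edge {v , j}, and the next lemma the edge {v , i}. Neither edge alone
        -- forces η_v to vanish; on the common subspace the two together do.
        η-i-vanishes : η i ⟦ X ∘ t ⟧ ≈ 0#
        η-i-vanishes = kill (≡.trans t-v (≡.sym t-j))
          (identify-0-divides (LogarithmicAt.off (log vj) i i≢v i≢j) .proj₂)

        η-v+η-i-vanishes : (η i + η v) ⟦ X ∘ t ⟧ ≈ 0#
        η-v+η-i-vanishes = kill (≡.trans t-v (≡.sym t-i)) (identify-0-divides (trans
          (⟦⟧-+ (X ∘ merge v i) (η i) (η v)) (trans (+-congʳ (LogarithmicAt.opp (log vi))) (-‿inverseˡ _))) .proj₂)

        η-v-vanishes : η v ⟦ X ∘ t ⟧ ≈ 0#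
        η-v-vanishes = begin
          η v ⟦ X ∘ t ⟧                      ≈⟨ +-identityˡ _ ⟨
          0# + η v ⟦ X ∘ t ⟧                 ≈⟨ +-congʳ η-i-vanishes ⟨
          η i ⟦ X ∘ t ⟧ + η v ⟦ X ∘ t ⟧      ≈⟨ ⟦⟧-+ (X ∘ t) (η i) (η v) ⟨
          (η i + η v) ⟦ X ∘ t ⟧              ≈⟨ η-v+η-i-vanishes ⟩
          0#                                 ∎

        g-vanishes : g ⟦ X ∘ t ⟧ ≈ 0#
        g-vanishes = nzd-difference-rename t rest separates (g ⟦ X ∘ t ⟧)
          (trans (sym (⟦⟧-* (X ∘ t) A g)) (trans (⟦⟧-cong (X ∘ t) (sym (A-divides .proj₂))) η-v-vanishes))

        identify-g : identify j v (identify i v g) ≈ 0#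
        identify-g = trans (⟦⟧-∘ (X ∘ merge i v) (X ∘ merge j v) g) (trans
          (⟦⟧-ext (λ a → ⟦⟧-X (X ∘ merge j v) (merge i v a)) g) g-vanishes)

        -- In the reflected coordinates x_i - x_v becomes -x_i, and a multiple of x_i has no
        -- monomial free of x_i.
        coeff-multiple : ∀ {i} → i ≢ v → ∀ q e → Vec.lookup e i ≡ 0 → coeff (reflect v (diff i v * q)) e F.≈ F.0#
        coeff-multiple {i} i≢v q e e[i]≡0 = F.trans (at reflect-multiple e) (coeff-X*-0 i (- reflect v q) e e[i]≡0)
          where
          reflect-multiple : reflect v (diff i v * q) ≈ X i * - reflect v q
          reflect-multiple = begin
            reflect v (diff i v * q)                    ≈⟨ ⟦⟧-* (reflection v) (diff i v) q ⟩
            reflect v (diff i v) * reflect v q          ≈⟨ *-congʳ (⟦⟧-cong (reflection v) (diff-antisym i v)) ⟩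
            reflect v (- diff v i) * reflect v q        ≈⟨ *-congʳ (⟦⟧-neg (reflection v) (diff v i)) ⟩
            - reflect v (diff v i) * reflect v q        ≈⟨ *-congʳ (-‿cong (reflect-diff i≢v)) ⟩
            - X i * reflect v q                         ≈⟨ -‿distribˡ-* _ _ ⟨
            - (X i * reflect v q)                       ≈⟨ -‿distribʳ-* _ _ ⟩
            X i * - reflect v q                         ∎

      -- Dividing g by x_i - x_v leaves a remainder divisible by x_j - x_v. After reflection g is
      -- thus a multiple of x_i plus a multiple of x_j, and neither contributes to a monomial that
      -- avoids both variables.
      reflect-g-vanishes : ∀ e → Vec.lookup e i ≡ 0 → Vec.lookup e j ≡ 0 → coeff (reflect v g) e F.≈ F.0#
      reflect-g-vanishes e e[i]≡0 e[j]≡0 = F.trans (at reflect-g e) (F.trans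
        (coeff-+ (reflect v (diff j v * q′)) (reflect v (diff i v * q)) e)
        (F.trans (F.+-cong (coeff-multiple j≢v q′ e e[j]≡0) (coeff-multiple i≢v q e e[i]≡0)) (F.+-identityˡ _)))
        where
        q  = identify-divides i v g .proj₁
        q′ = identify-0-divides {j} {v} {identify i v g} identify-g .proj₁

        reflect-g : reflect v g ≈ reflect v (diff j v * q′) + reflect v (diff i v * q)
        reflect-g = trans
          (⟦⟧-cong (reflection v) (trans (identify-divides i v g .proj₂)
            (+-congʳ (identify-0-divides {j} {v} {identify i v g} identify-g .proj₂))))
          (⟦⟧-+ (reflection v) (diff j v * q′) (diff i v * q))

-- One step of the filtration: cliques with least vertex v.

cliqueSeries : ∀ {ℓ} → Subset ℓ → LaurentSeries
cliqueSeries {ℓ} F = t^ (+ 1 ℤ.- + ∣ F ∣) · [1-t]⁻ ((ℓ ∸ ∣ F ∣) ℕ.+ 1)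

AllAbove : ∀ {ℓ} → ℕ → Subset ℓ → Set
AllAbove n F = ∀ w → w Subset.∈ F → n ℕ.≤ toℕ w

allAbove? : ∀ {ℓ} n → Decidable (AllAbove {ℓ} n)
allAbove? n F = Finₚ.all? λ w → (w Subsetₚ.∈? F) →-dec (n ℕₚ.≤? toℕ w)

HasLeast : ∀ {ℓ} → Fin ℓ → Subset ℓ → Set
HasLeast v F = v Subset.∈ F × AllAbove (toℕ v) F

hasLeast? : ∀ {ℓ} (v : Fin ℓ) → Decidable (HasLeast v)
hasLeast? v F = (v Subsetₚ.∈? F) ×-dec allAbove? (toℕ v) F

module Filtration {c r s} (K : HeytingField c r s) {ℓ} (G : SimpleGraph ℓ) (v : Fin ℓ) where
  open SimpleGraph G
  open Polynomials K
  open PolynomialRing K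
  open Evaluation K
  open Substitution K
  open F using () renaming (Carrier to 𝕂)
  open CommutativeRing (polyRing ℓ) hiding (zero)
  open NonZeroDivisors (polyRing ℓ)
  open CommutativeSemigroupProperties *-commutativeSemigroup using (x∙yz≈y∙xz)
  open Differences K ℓ
  open Homogeneity K
  open Coordinates K ℓ
  open Arrangements K G
  open CliqueForms K G
  open LeadingCoefficients K G v
  open SetoidReasoning setoid

  private
    S = Poly ℓ
    𝒜 = graphicArrangement G

  -- Clearing the denominators u_j of all neighbours raises their exponents by one. The neighbours
  -- in F then have exponent 0 and those in `outer F` at least 1, which is why leading exponents are
  -- `increments (outer F)` of free ones.
  outer : Subset ℓ → List (Fin ℓ)
  outer F = List.filter (λ j → ¬? (j Subsetₚ.∈? F)) neighbours

  ∈-outer⁺ : ∀ {F j} → j ∈ neighbours → j Subset.∉ F → j ∈ outer F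
  ∈-outer⁺ {F} = ∈-filter⁺ (λ j → ¬? (j Subsetₚ.∈? F))

  ∈-outer⁻ : ∀ {F j} → j ∈ outer F → j ∈ neighbours × j Subset.∉ F
  ∈-outer⁻ {F} = ∈-filter⁻ (λ j → ¬? (j Subsetₚ.∈? F)) {xs = neighbours}

  outer-unique : ∀ F → Unique (outer F)
  outer-unique F = Uniqueₚ.filter⁺ (λ j → ¬? (j Subsetₚ.∈? F)) neighbours-unique

  neighbour-≢ : ∀ {j} → j ∈ neighbours → j ≢ v
  neighbour-≢ p = Finₚ.<⇒≢ (∈-neighbours⁻ p .proj₁) ∘ ≡.sym

  support : Subset ℓ → Subset ℓ
  support F = ∁ F Vec.[ v ]≔ inside

  ∉-support⁻ : ∀ {F j} → j Subset.∉ support F → j Subset.∈ F × j ≢ v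
  ∉-support⁻ {F} {j} j∉ = go (j Finₚ.≟ v)
    where
    go : Dec (j ≡ v) → j Subset.∈ F × j ≢ v
    go (yes ≡.refl) = contradiction (Vecₚ.[]≔-updates (∁ F) v) j∉
    go (no j≢v)     = Subsetₚ.x∉∁p⇒x∈p (λ j∈∁F → j∉ (Vecₚ.[]≔-minimal (∁ F) j v j≢v j∈∁F)) , j≢v

  ∉-support⁺ : ∀ {F j} → j Subset.∈ F → j ≢ v → j Subset.∉ support F
  ∉-support⁺ {F} {j} j∈F j≢v j∈ = Subsetₚ.x∈p⇒x∉∁p j∈F (Vecₚ.lookup⇒[]= j (∁ F)
    (≡.trans (≡.sym (Vecₚ.lookup∘update′ j≢v (∁ F) inside)) (Vecₚ.[]=⇒lookup j∈)))

  reflect-increments : ∀ js e → (∀ j → j ∈ js → j ≢ v) →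
                       reflect v (X^ (increments js e)) ≈ spokes v js * reflect v (X^ e)
  reflect-increments []       e ne = sym (*-identityˡ _)
  reflect-increments (j ∷ js) e ne = begin
    reflect v (X^ (increments (j ∷ js) e))                 ≈⟨ ⟦⟧-cong (reflection v) (X*X^ j (increments js e)) ⟨
    reflect v (X j * X^ (increments js e))                 ≈⟨ ⟦⟧-* (reflection v) (X j) _ ⟩
    reflect v (X j) * reflect v (X^ (increments js e))     ≈⟨ *-cong (reflect-X (ne j (here ≡.refl)))
                                                                (reflect-increments js e λ i → ne i ∘ there) ⟩
    diff v j * (spokes v js * reflect v (X^ e))            ≈⟨ *-assoc _ _ _ ⟨
    spokes v (j ∷ js) * reflect v (X^ e)                   ∎

  module _ {F : Subset ℓ} (clique : IsClique G F) (least : HasLeast v F) where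
    private
      v∈F = least .proj₁

    clique-neighbour : ∀ {j} → j Subset.∈ F → j ≢ v → j ∈ neighbours
    clique-neighbour {j} j∈F j≢v = ∈-neighbours⁺
      (ℕₚ.≤∧≢⇒< (least .proj₂ j j∈F) (λ eq → j≢v (≡.sym (Finₚ.toℕ-injective eq))))
      (clique v j v∈F j∈F (j≢v ∘ ≡.sym))

    neighbours↭ : neighbours ↭ others F v ++ outer F
    neighbours↭ = sameElements⇒↭ neighbours-unique
      (Uniqueₚ.++⁺ (others-unique F v) (outer-unique F) λ (p , q) → ∈-outer⁻ q .proj₂ (∈-others⁻ {F} p .proj₁))
      to from
      where
      to : ∀ {j} → j ∈ neighbours → j ∈ others F v ++ outer F
      to {j} p with j Subsetₚ.∈? F
      ... | yes j∈F = ∈-++⁺ˡ (∈-others⁺ j∈F (neighbour-≢ p))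
      ... | no  j∉F = ∈-++⁺ʳ _ (∈-outer⁺ p j∉F)

      from : ∀ {j} → j ∈ others F v ++ outer F → j ∈ neighbours
      from p with ∈-++⁻ (others F v) p
      ... | inj₁ q = clique-neighbour (∈-others⁻ {F} q .proj₁) (∈-others⁻ {F} q .proj₂)
      ... | inj₂ q = ∈-outer⁻ q .proj₁

    -- Of the factors x_v - x_j in `𝒬` those with j ∈ F cancel against the denominator of ω_F; the
    -- outer ones survive and raise the exponents of the monomial.
    cliqueForm-leading : ∀ e → cliqueForm clique (reflect v (X^ e)) v ≈ A * reflect v (X^ (increments (outer F) e))
    cliqueForm-leading e = nzd-cancelˡ nzd-others (begin
      spokes v (others F v) * cliqueForm clique m v                    ≈⟨ cliqueForm-∈ clique m v∈F ⟩
      m * 𝒬                                                            ≈⟨ *-congˡ 𝒬-splits ⟩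
      m * (spokes v neighbours * A)                                    ≈⟨ *-congˡ (*-congʳ (trans (∏-↭ (diff v) neighbours↭)
                                                                            (∏-++ (diff v) (others F v) (outer F)))) ⟩
      m * (spokes v (others F v) * spokes v (outer F) * A)             ≈⟨ *-congˡ (*-assoc _ _ _) ⟩
      m * (spokes v (others F v) * (spokes v (outer F) * A))           ≈⟨ x∙yz≈y∙xz m _ _ ⟩
      spokes v (others F v) * (m * (spokes v (outer F) * A))           ≈⟨ *-congˡ (begin
        m * (spokes v (outer F) * A)     ≈⟨ *-assoc _ _ _ ⟨
        m * spokes v (outer F) * A       ≈⟨ *-comm _ _ ⟩
        A * (m * spokes v (outer F))     ≈⟨ *-congˡ (*-comm _ _) ⟩
        A * (spokes v (outer F) * m)     ≈⟨ *-congˡ (reflect-increments (outer F) e λ j p → neighbour-≢ (∈-outer⁻ {F} p .proj₁)) ⟨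
        A * reflect v (X^ (increments (outer F) e))  ∎) ⟩
      spokes v (others F v) * (A * reflect v (X^ (increments (outer F) e)))  ∎)
      where
      m = reflect v (X^ e)
      nzd-others : NonZeroDivisor (spokes v (others F v))
      nzd-others = nzd-∏ (others F v) λ j p → nzd-diff (∈-others⁻ {F} p .proj₂ ∘ ≡.sym)

    ∈-clique⁺ : ∀ {e j} → j ∈ neighbours →
                Vec.lookup (increments (outer F) e) j ≡ 0 → j Subset.∈ F
    ∈-clique⁺ {e} {j} j∈N eq with j Subsetₚ.∈? F
    ... | yes j∈F = j∈F
    ... | no  j∉F = contradiction eq (lookup-increments-≢0 e (∈-outer⁺ j∈N j∉F))

    ∈-clique⁻ : ∀ {e j} → SupportedIn (support F) e → j Subset.∈ F → j ≢ v →
                Vec.lookup (increments (outer F) e) j ≡ 0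
    ∈-clique⁻ {e} {j} supp j∈F j≢v = ≡.trans (lookup-increments e λ p → ∈-outer⁻ {F} p .proj₂ j∈F)
      (supp j (∉-support⁺ j∈F j≢v))

  cliques : List (Subset ℓ)
  cliques = List.filter (hasLeast? v) (nonemptyCliques G)

  ∈-cliques⁻ : ∀ {F} → F ∈ cliques → IsClique G F × HasLeast v F
  ∈-cliques⁻ p = let q , least = ∈-filter⁻ (hasLeast? v) {xs = nonemptyCliques G} p in
    ∈-filter⁻ (λ F → Subsetₚ.nonempty? F ×-dec isClique? G F) {xs = allSubsets ℓ} q .proj₂ .proj₂ , least

  ∈-cliques⁺ : ∀ {F} → IsClique G F → HasLeast v F → F ∈ cliques
  ∈-cliques⁺ {F} clique least = ∈-filter⁺ (hasLeast? v)
    (∈-filter⁺ (λ F → Subsetₚ.nonempty? F ×-dec isClique? G F) (allSubsets-complete F)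
      ((v , least .proj₁) , clique)) least

  cliques-unique : Unique cliques
  cliques-unique = Uniqueₚ.filter⁺ (hasLeast? v)
    (Uniqueₚ.filter⁺ (λ F → Subsetₚ.nonempty? F ×-dec isClique? G F) (allSubsets-unique ℓ))

  module _ (k : ℤ) where

    leadingExponents : Subset ℓ → List (Vec ℕ ℓ)
    leadingExponents F = List.map (increments (outer F)) (exponentsℤ (support F) (k ℤ.- (+ 1 ℤ.- + ∣ F ∣)))

    index : List (Vec ℕ ℓ)
    index = List.concatMap leadingExponents cliques

    length-index : List.length index ≡ ∑ₗ cliques cliqueSeries k
    length-index = ≡.trans (length-concatMap leadingExponents cliques)
      (≡.cong ℕList.sum (Listₚ.map-cong-local (All.tabulate λ {F} p → ≡.trans
        (Listₚ.length-map (increments (outer F)) (exponentsℤ (support F) (k ℤ.- (+ 1 ℤ.- + ∣ F ∣))))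
        (≡.trans (length-exponentsℤ (support F) (+ 1 ℤ.- + ∣ F ∣) k)
          (≡.cong (λ n → (t^ (+ 1 ℤ.- + ∣ F ∣) · [1-t]⁻ n) k) (∣∁[]≔∣ F v (∈-cliques⁻ p .proj₂ .proj₁)))))))

    ∈-leadingExponents⁻ : ∀ {F e} → e ∈ leadingExponents F →
      ∃ λ e′ → e ≡ increments (outer F) e′ × + Vec.sum e′ ≡ k ℤ.- (+ 1 ℤ.- + ∣ F ∣) × SupportedIn (support F) e′
    ∈-leadingExponents⁻ {F} p with ∈-map⁻ (increments (outer F)) p
    ... | e′ , q , eq = e′ , eq , ∈-exponentsℤ⁻ (support F) q

    -- An exponent determines its clique, as v together with the neighbours of exponent 0. Hence the
    -- lists of different cliques are disjoint.
    index-unique : Unique index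
    index-unique = concatMap⁺ leadingExponents cliques-unique
      (λ {F} _ → Uniqueₚ.map⁺ (increments-injective (outer F)) (exponentsℤ-unique (support F) (k ℤ.- (+ 1 ℤ.- + ∣ F ∣))))
      λ p q x y → subset-ext (⊆-by p q x y) (⊆-by q p y x)
      where
      ⊆-by : ∀ {F F′ e} → F ∈ cliques → F′ ∈ cliques → e ∈ leadingExponents F → e ∈ leadingExponents F′ →
             ∀ {j} → j Subset.∈ F → j Subset.∈ F′
      ⊆-by {F} {F′} p q x y {j} j∈F with ∈-cliques⁻ p | ∈-cliques⁻ q | ∈-leadingExponents⁻ x | ∈-leadingExponents⁻ y
      ... | clique , least | clique′ , least′ | e₁ , ≡.refl , _ , supp | e₂ , eq , _ = go (j Finₚ.≟ v)
        where
        go : Dec (j ≡ v) → j Subset.∈ F′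
        go (yes ≡.refl) = least′ .proj₁
        go (no j≢v)     = ∈-clique⁺ clique′ least′ {e₂} (clique-neighbour clique least j∈F j≢v)
          (≡.trans (≡.cong (λ e → Vec.lookup e j) (≡.sym eq)) (∈-clique⁻ clique least supp j∈F j≢v))

    Leading : LogForm 𝒜 k → ℕ → Set r
    Leading ω n = ∀ w → toℕ w ℕ.< n → numerator ω w ≈ 0#

    -- The multiplier of the clique form is the monomial in x_v and the u_j whose exponent is `e`
    -- lowered by one at the outer neighbours. Components below v are zero since v is the least
    -- vertex of F.
    indexForm : ∀ {e} → e ∈ index → ∃ λ ω → Leading ω (toℕ v) × numerator ω v ≈ A * reflect v (X^ e)
    indexForm p with find (∈-concatMap⁻ leadingExponents {xs = cliques} p)
    ... | F , F∈ , q with ∈-cliques⁻ F∈ | ∈-leadingExponents⁻ q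
    ...   | clique , least | e′ , ≡.refl , Σe′ , supp = ω , below , cliqueForm-leading clique least e′
      where
      m = reflect v (X^ e′)

      ω : LogForm 𝒜 k
      ω = record
        { numerator   = cliqueForm clique m
        ; logarithmic = isLogarithmic⁺ {cliqueForm clique m} (cliqueForm-logarithmic clique m)
        ; homogeneous = cliqueForm-homogeneous clique m {k} (homogeneous-reflect v {X^ e′}
            (≡.subst (IsHomogeneous (X^ e′)) Σe′ (homogeneous-X^ e′)))
        }

      below : Leading ω (toℕ v)
      below w w<v = cliqueForm-∉ clique m λ w∈F → ℕₚ.<⇒≱ w<v (least .proj₂ w w∈F)

    -- The clique consists of v and the neighbours of exponent 0, pairwise adjacent by hypothesis.
    -- All other neighbours have positive exponent, so lowering them is possible and leaves an
    -- exponent supported in `support F`.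
    classify : ∀ {e} → + Vec.sum e ≡ k ℤ.+ + List.length neighbours →
               (∀ {i j} → i ∈ neighbours → j ∈ neighbours → i ≢ j → Vec.lookup e i ≡ 0 → Vec.lookup e j ≡ 0 → i ~ j) →
               e ∈ index
    classify {e} Σe≡ adjacent = ∈-concatMap⁺ leadingExponents (lose (∈-cliques⁺ clique least) e∈)
      where
      Member : Fin ℓ → Set
      Member j = j ≡ v ⊎ (v Fin.< j × v ~ j) × Vec.lookup e j ≡ 0

      member? : Decidable Member
      member? j = (j Finₚ.≟ v) ⊎-dec (neighbour? j ×-dec (Vec.lookup e j ℕₚ.≟ 0))

      F : Subset ℓ
      F = Vec.tabulate (does ∘ member?)

      F⁺ : ∀ {j} → Member j → j Subset.∈ F
      F⁺ {j} p = Vecₚ.lookup⇒[]= j F (≡.trans (Vecₚ.lookup∘tabulate (does ∘ member?) j) (dec-true (member? j) p))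

      F⁻ : ∀ {j} → j Subset.∈ F → Member j
      F⁻ {j} p with member? j in eq
      ... | yes q = q
      ... | no  _ = contradiction (≡.trans (≡.sym (≡.cong does eq))
              (≡.trans (≡.sym (Vecₚ.lookup∘tabulate (does ∘ member?) j)) (Vecₚ.[]=⇒lookup p))) λ ()

      clique : IsClique G F
      clique i j i∈F j∈F i≢j with F⁻ i∈F | F⁻ j∈F
      ... | inj₁ ≡.refl            | inj₁ ≡.refl            = contradiction ≡.refl i≢j
      ... | inj₁ ≡.refl            | inj₂ ((_ , v~j) , _)   = v~j
      ... | inj₂ ((_ , v~i) , _)   | inj₁ ≡.refl            = ~-sym v~i
      ... | inj₂ ((v<i , v~i) , z) | inj₂ ((v<j , v~j) , z′) =
        adjacent (∈-neighbours⁺ v<i v~i) (∈-neighbours⁺ v<j v~j) i≢j z z′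

      least : HasLeast v F
      least = F⁺ (inj₁ ≡.refl) , λ w w∈F → above (F⁻ w∈F)
        where
        above : ∀ {w} → Member w → toℕ v ℕ.≤ toℕ w
        above (inj₁ ≡.refl)          = ℕₚ.≤-refl
        above (inj₂ ((v<w , _) , _)) = ℕₚ.<⇒≤ v<w

      lowered : ∃ λ e′ → e ≡ increments (outer F) e′
      lowered = decrements (outer-unique F) e λ j p e[j]≡0 → ∈-outer⁻ {F} p .proj₂
        (F⁺ (inj₂ (∈-neighbours⁻ (∈-outer⁻ {F} p .proj₁) , e[j]≡0)))

      e′ = lowered .proj₁

      supported : SupportedIn (support F) e′
      supported j j∉ with ∉-support⁻ {F} j∉
      ... | j∈F , j≢v with F⁻ j∈F
      ...   | inj₁ j≡v           = contradiction j≡v j≢v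
      ...   | inj₂ (_ , e[j]≡0)  = ≡.trans (≡.sym (lookup-increments e′ λ p → ∈-outer⁻ {F} p .proj₂ j∈F))
              (≡.trans (≡.cong (λ e → Vec.lookup e j) (≡.sym (lowered .proj₂))) e[j]≡0)

      -- The neighbours are the #F less one other elements of F and the outer ones; lowering removes
      -- exactly the latter from the degree.
      degree : + Vec.sum e′ ≡ k ℤ.- (+ 1 ℤ.- + ∣ F ∣)
      degree = ≡.trans (ℤ-cancel (+ List.length (outer F)) (+ Vec.sum e′) total)
        (≡.trans (arith k (+ List.length (others F v)) (+ List.length (outer F)))
          (≡.cong (λ n → k ℤ.- (+ 1 ℤ.- + n)) (length-others {F} (least .proj₁))))
        where
        total : + List.length (outer F) ℤ.+ + Vec.sum e′ ≡ k ℤ.+ (+ List.length (others F v) ℤ.+ + List.length (outer F))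
        total = ≡.trans
          (≡.cong +_ (≡.trans (≡.sym (sum-increments (outer F) e′)) (≡.cong Vec.sum (≡.sym (lowered .proj₂)))))
          (≡.trans Σe≡ (≡.cong (λ n → k ℤ.+ + n)
            (≡.trans (↭-length (neighbours↭ clique least)) (Listₚ.length-++ (others F v)))))

        ℤ-cancel : ∀ a b {d} → a ℤ.+ b ≡ d → b ≡ d ℤ.- a
        ℤ-cancel a b ≡.refl = solve 2 (λ a b → b := a :+ b :- a) ≡.refl a b
          where open +-*-Solver
        arith : ∀ k n m → k ℤ.+ (n ℤ.+ m) ℤ.- m ≡ k ℤ.- (+ 1 ℤ.- (+ 1 ℤ.+ n))
        arith = solve 3 (λ k n m → k :+ (n :+ m) :- m := k :- (con (+ 1) :- (con (+ 1) :+ n))) ≡.refl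
          where open +-*-Solver

      e∈ : e ∈ leadingExponents F
      e∈ = ≡.subst (_∈ leadingExponents F) (≡.sym (lowered .proj₂))
        (∈-map⁺ (increments (outer F)) (∈-exponentsℤ⁺ (support F) degree supported))

    private
      M = Ω¹ 𝒜 k
      module M = LeftModule M

    module _ where
      open Dimension K

      numerator-lc : ∀ {n} (x : Fin n → 𝕂) (b : Fin n → LogForm 𝒜 k) w →
                     numerator (linearCombination M x b) w ≈ combination x (λ i → numerator (b i) w)
      numerator-lc x b w = ⟪ (λ e → F.trans (coefficients x b e)
        (F.sym (coeff-combination x (λ i → numerator (b i) w) e))) ⟫
        where
        coefficients : ∀ {n} (x : Fin n → 𝕂) (b : Fin n → LogForm 𝒜 k) e →
                       coeff (numerator (linearCombination M x b) w) e F.≈ FS.sum λ i → x i F.* coeff (numerator (b i) w) e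
        coefficients {zero}  x b e = F.refl
        coefficients {suc n} x b e = F.+-congˡ (coefficients (x ∘ suc) (b ∘ suc) e)

      opaque
        unfolding _⊞_

        leading-isSubspace : ∀ n → IsSubspace M (λ ω → Leading ω n)
        leading-isSubspace n = record
          { contains-0 = λ w w<n → refl
          ; contains-+ = λ p q w w<n → trans (+-cong (p w w<n) (q w w<n)) (+-identityˡ 0#)
          ; contains-* = λ x p w w<n → ⟪ (λ e → F.trans (F.*-congˡ (at (p w w<n) e)) (F.zeroʳ x)) ⟫
          }

        numerator-+ : ∀ ω ω′ w → numerator (ω M.+ᴹ ω′) w ≈ numerator ω w + numerator ω′ w
        numerator-+ ω ω′ w = refl

        numerator-neg : ∀ ω w → numerator (M.-ᴹ ω) w ≈ - numerator ω w
        numerator-neg ω w = ⟪ (λ e → FP.-1*x≈-x _) ⟫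

        numerator-0 : ∀ w → numerator M.0ᴹ w ≈ 0#
        numerator-0 w = refl

      basis : Fin (List.length index) → LogForm 𝒜 k
      basis i = indexForm (∈-lookup i) .proj₁

      monomials : Fin (List.length index) → S
      monomials i = X^ (List.lookup index i)

      basis-leading : ∀ x → numerator (linearCombination M x basis) v ≈ A * reflect v (combination x monomials)
      basis-leading x = begin
        numerator (linearCombination M x basis) v                  ≈⟨ numerator-lc x basis v ⟩
        combination x (λ i → numerator (basis i) v)                ≈⟨ combination-cong x (λ i → indexForm (∈-lookup i) .proj₂ .proj₂) ⟩
        combination x (λ i → A * reflect v (monomials i))          ≈⟨ *-combination A x (reflect v ∘ monomials) ⟨
        A * combination x (reflect v ∘ monomials)                  ≈⟨ *-congˡ (combination-⟦⟧ (reflection v) x monomials) ⟨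
        A * reflect v (combination x monomials)                    ∎

      -- A form in this step determines g and hence `h = reflect v g`, which is zero exactly when
      -- the form lies in the next step, as `A` is cancellable. The monomials in `index` are a basis
      -- of the possible `h`, and the clique forms lift them.
      extend : ∀ {n} → SubspaceHasDimension M (λ ω → Leading ω (suc (toℕ v))) n →
               SubspaceHasDimension M (λ ω → Leading ω (toℕ v)) (List.length index ℕ.+ n)
      extend = extend-dimension M (leading-isSubspace (suc (toℕ v)))
        (λ ω p w w<v → p w (ℕₚ.m<n⇒m<1+n w<v))
        basis (λ i → indexForm (∈-lookup i) .proj₂ .proj₁) independent spanning
        where
        independent : ∀ x ω → Leading ω (suc (toℕ v)) → linearCombination M x basis M.+ᴹ ω M.≈ᴹ M.0ᴹ → ∀ i → x i F.≈ F.0#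
        independent x ω p eq = monomials-independent index-unique x (begin
          combination x monomials                               ≈⟨ reflect-reflect v _ ⟨
          reflect v (reflect v (combination x monomials))       ≈⟨ ⟦⟧-cong (reflection v) (nzd-A _ (begin
            A * reflect v (combination x monomials)               ≈⟨ basis-leading x ⟨
            numerator (linearCombination M x basis) v             ≈⟨ +-identityʳ _ ⟨
            numerator (linearCombination M x basis) v + 0#        ≈⟨ +-congˡ (p v ℕₚ.≤-refl) ⟨
            numerator (linearCombination M x basis) v + numerator ω v  ≈⟨ numerator-+ (linearCombination M x basis) ω v ⟨
            numerator (linearCombination M x basis M.+ᴹ ω) v      ≈⟨ ⟪ eq v ⟫ ⟩
            numerator M.0ᴹ v                                      ≈⟨ numerator-0 v ⟩
            0#                                                    ∎)) ⟩
          reflect v 0#                                          ≈⟨ ⟦⟧-0 (reflection v) ⟩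
          0#                                                    ∎)

        spanning : ∀ ω → Leading ω (toℕ v) → ∃ λ x → ∃ λ u → Leading u (suc (toℕ v)) × ω M.≈ᴹ linearCombination M x basis M.+ᴹ u
        spanning ω p = x , u , u-leading , decompose
          where
          open Leading {numerator ω} (isLogarithmic⁻ {numerator ω} (logarithmic ω)) (λ w w<v → p w w<v)

          h = reflect v g
          homogeneous-h : IsHomogeneous h (k ℤ.+ + List.length neighbours)
          homogeneous-h = homogeneous-reflect v {g} (homogeneous-g {k} (homogeneous ω v))

          -- An obstruction to the zero exponents forming a clique. It is decidable from `e` and the
          -- graph, so either the coefficient of `h` at `e` vanishes or `e` is in `index`, without
          -- inspecting the coefficient.
          Bad : Vec ℕ ℓ → Set
          Bad e = ∃ λ i → ∃ λ j → (i ∈ neighbours × j ∈ neighbours) × (i ≢ j × ¬ i ~ j) ×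
                                  (Vec.lookup e i ≡ 0 × Vec.lookup e j ≡ 0)

          bad? : ∀ e → Dec (Bad e)
          bad? e = Finₚ.any? λ i → Finₚ.any? λ j → ((i ∈? neighbours) ×-dec (j ∈? neighbours)) ×-dec
            ((¬? (i Finₚ.≟ j) ×-dec ¬? (i ~? j)) ×-dec ((Vec.lookup e i ℕₚ.≟ 0) ×-dec (Vec.lookup e j ℕₚ.≟ 0)))
            where open import Data.List.Membership.DecPropositional Finₚ._≟_ using (_∈?_)

          coefficients : ∀ e → coeff h e F.≈ F.0# ⊎ e ∈ index
          coefficients e = go (+ Vec.sum e ℤₚ.≟ k ℤ.+ + List.length neighbours) (bad? e)
            where
            go : Dec (+ Vec.sum e ≡ k ℤ.+ + List.length neighbours) → Dec (Bad e) → coeff h e F.≈ F.0# ⊎ e ∈ index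
            go (no ≢d)  _ = inj₁ (homogeneous-h e ≢d)
            go (yes _)  (yes (i , j , (i∈N , j∈N) , (i≢j , i≁j) , e[i] , e[j])) =
              inj₁ (reflect-g-vanishes i∈N j∈N i≢j i≁j e e[i] e[j])
            go (yes ≡d) (no ¬bad) = inj₂ (classify ≡d λ {i} {j} i∈N j∈N i≢j e[i] e[j] →
              decidable-stable (i ~? j) λ i≁j → ¬bad (i , j , (i∈N , j∈N) , (i≢j , i≁j) , e[i] , e[j]))

          x : Fin (List.length index) → 𝕂
          x i = coeff h (List.lookup index i)

          lc = linearCombination M x basis
          -- What is left of ω after its leading coefficient has been matched.
          u = ω M.+ᴹ (M.-ᴹ lc)

          lc-v : numerator lc v ≈ numerator ω v
          lc-v = begin
            numerator lc v                              ≈⟨ basis-leading x ⟩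
            A * reflect v (combination x monomials)     ≈⟨ *-congˡ (⟦⟧-cong (reflection v) (monomials-span index-unique h coefficients)) ⟨
            A * reflect v h                             ≈⟨ *-congˡ (reflect-reflect v g) ⟩
            A * g                                       ≈⟨ A-divides .proj₂ ⟨
            numerator ω v                               ∎

          u-component : ∀ w → numerator ω w ≈ numerator lc w → numerator u w ≈ 0#
          u-component w eq = trans (numerator-+ ω (M.-ᴹ lc) w) (trans (+-cong eq (numerator-neg lc w)) (-‿inverseʳ _))

          u-leading : Leading u (suc (toℕ v))
          u-leading w w<1+v = u-component w (compare (w Finₚ.≟ v))
            where
            compare : Dec (w ≡ v) → numerator ω w ≈ numerator lc w
            compare (yes ≡.refl) = sym lc-v
            compare (no  w≢v)    = trans (p w w<v) (sym
              (IsSubspace.contains-lc (leading-isSubspace (toℕ v)) x basis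
                (λ i → indexForm (∈-lookup i) .proj₂ .proj₁) w w<v))
              where
              w<v = ℕₚ.≤∧≢⇒< (ℕₚ.≤-pred w<1+v) (w≢v ∘ Finₚ.toℕ-injective)

          decompose : ω M.≈ᴹ lc M.+ᴹ u
          decompose = x≈y+[x-y] M ω lc

-- Summation over the filtration.

module _ {c r s} (K : HeytingField c r s) {ℓ} (G : SimpleGraph ℓ) where
  open Polynomials K
  open PolynomialRing K using (_≃_; at; zeroPoly)
  open Dimension K

  private
    Leading : ∀ k → LogForm (graphicArrangement G) k → ℕ → Set r
    Leading k ω n = ∀ w → toℕ w ℕ.< n → numerator ω w ≃ zeroPoly

    cliquesAbove : ℕ → List (Subset ℓ)
    cliquesAbove n = List.filter (allAbove? n) (nonemptyCliques G)

  -- Induction downwards from ℓ. Lowering the threshold to v admits the leading coefficients at v on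
  -- one side and the cliques with least vertex v on the other.
  leading-dimension : ∀ k (i : Fin (suc ℓ)) →
    SubspaceHasDimension (Ω¹ (graphicArrangement G) k) (λ ω → Leading k ω (toℕ i)) (∑ₗ (cliquesAbove (toℕ i)) cliqueSeries k)
  leading-dimension k = >-weakInduction _ base step
    where
    P : ℕ → ℕ → Set _
    P n d = SubspaceHasDimension (Ω¹ (graphicArrangement G) k) (λ ω → Leading k ω n) d

    -- At threshold ℓ every component is zero and no nonempty clique remains, so both sides are 0.
    base : P (toℕ (Fin.fromℕ ℓ)) (∑ₗ (cliquesAbove (toℕ (Fin.fromℕ ℓ))) cliqueSeries k)
    base = ≡.subst (P n) (≡.cong (λ xs → ∑ₗ xs cliqueSeries k) (≡.sym none))
      ((λ ()) , (λ ()) , (λ x eq ()) , λ ω p → (λ ()) , λ w → zero-form ω p w)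
      where
      n = toℕ (Fin.fromℕ ℓ)

      below : ∀ (w : Fin ℓ) → toℕ w ℕ.< n
      below w = ≡.subst (toℕ w ℕ.<_) (≡.sym (Finₚ.toℕ-fromℕ ℓ)) (Finₚ.toℕ<n w)

      none : cliquesAbove n ≡ []
      none = Listₚ.filter-none (allAbove? n) (All.tabulate λ {F} p above →
        let w , w∈F = ∈-filter⁻ (λ F → Subsetₚ.nonempty? F ×-dec isClique? G F) {xs = allSubsets ℓ} p .proj₂ .proj₁
        in  ℕₚ.<⇒≱ (below w) (above w w∈F))

      opaque
        unfolding zeroPoly
        zero-form : ∀ ω → Leading k ω n → ∀ w → numerator ω w ≈ₚ 0ₚ
        zero-form ω p w = at (p w (below w))

    step : ∀ v → P (suc (toℕ v)) (∑ₗ (cliquesAbove (suc (toℕ v))) cliqueSeries k) →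
           P (toℕ (Fin.inject₁ v)) (∑ₗ (cliquesAbove (toℕ (Fin.inject₁ v))) cliqueSeries k)
    step v IH rewrite Finₚ.toℕ-inject₁ v = ≡.subst (P (toℕ v)) count (Filtration.extend K G v k IH)
      where
      open Filtration K G v using (index; length-index)

      split : ∀ {F} → AllAbove (toℕ v) F → HasLeast v F ⊎ AllAbove (suc (toℕ v)) F
      split {F} above with v Subsetₚ.∈? F
      ... | yes v∈F = inj₁ (v∈F , above)
      ... | no  v∉F = inj₂ λ w w∈F → ℕₚ.≤∧≢⇒< (above w w∈F)
              λ eq → v∉F (≡.subst (Subset._∈ F) (≡.sym (Finₚ.toℕ-injective eq)) w∈F)

      -- Cliques with all vertices at least v either contain v, and then have it as least vertex, or
      -- lie strictly above it.
      count : List.length (index k) ℕ.+ ∑ₗ (cliquesAbove (suc (toℕ v))) cliqueSeries k ≡ ∑ₗ (cliquesAbove (toℕ v)) cliqueSeries k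
      count = ≡.trans (≡.cong (ℕ._+ ∑ₗ (cliquesAbove (suc (toℕ v))) cliqueSeries k) (length-index k))
        (≡.sym (sum-filter-split (hasLeast? v) (allAbove? (suc (toℕ v))) (allAbove? (toℕ v)) split proj₂
          (λ above w w∈F → ℕₚ.<⇒≤ (above w w∈F))
          (λ (v∈F , _) above _ → contradiction (above v v∈F) (ℕₚ.<-irrefl ≡.refl))
          (λ F → cliqueSeries F k) (nonemptyCliques G)))

open import Data.Integer using (+_; _-_)
open import Data.Nat using (ℕ; _∸_; _+_)

theorem7p11 : ∀ {c r s} (K : HeytingField c r s) (ℓ : ℕ) (G : SimpleGraph ℓ) →
    let open Polynomials K in
    HasHilbertSeries (Ω¹ (graphicArrangement G))
    (∑ₗ (nonemptyCliques G) λ F → t^ (+ 1 - + ∣ F ∣) · [1-t]⁻ ((ℓ ∸ ∣ F ∣) + 1))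
theorem7p11 K ℓ G k with leading-dimension K G k zero
-- At threshold 0 the conditions on forms and on cliques are both vacuous, so the subspace is the
-- whole graded piece and the sum runs over all nonempty cliques.
... | whole rewrite Listₚ.filter-all (allAbove? {ℓ} 0) {nonemptyCliques G} (All.tabulate λ _ _ _ → z≤n) =
  let b , _ , independent , spanning = whole in b , independent , λ ω → spanning ω λ _ ()
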